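{- The charge scheduling problem with multiple deadlines and a polynomially bounded number of periods is strongly NP-hard, even when restricted to instances with three deadlines per agent, constant demand (i.e. there is a constant $D$ such that it remains strongly NP-hard when all demands satisfy $w_{i,k}\le D$), and no bound on charging speeds.
   Context: Charge scheduling problem with multiple deadlines. An instance consists of a number $|T|\ge 1$ of periods, $T=\{1,\dots,|T|\}$; a supply $m_t\in\mathbb{Z}_{\ge 0}$ for each $t\in T$; and $n$ agents, where agent $i$ has a finite list of triples $(v_{i,k},d_{i,k},w_{i,k})$, $k\in K(i)$, consisting of a value $v_{i,k}$ (positive integer), a deadline $d_{i,k}\in T$ and a demand $w_{i,k}$ (positive integer); $|K(i)|$ is the number of deadlines of agent $i$. A feasible allocation is a family of functions $a_i:T\to\mathbb{R}_{\ge 0}$ with $\sum_i a_i(t)\le m_t$ for all $t$. "No bound on charging speeds" means that there is no further constraint on the $a_i(t)$ of individual agents. Writing $\bar a_i(t)=\sum_{t'=1}^{t}a_i(t')$, agent $i$'s value is $v_i(a_i)=\sum_{k\in K(i):\ \bar a_i(d_{i,k})\ge w_{i,k}} v_{i,k}$ (so the demands are cumulative: all charge received up to and including $d_{i,k}$ counts towards $w_{i,k}$). The goal is to maximize $\sum_i v_i(a_i)$; in the decision version one is also given an integer $V$ and asks whether a feasible allocation with $\sum_i v_i(a_i)\ge V$ exists. "Polynomially bounded number of periods" means that $|T|$ is part of the input and may be large, but is bounded by a fixed polynomial in the input size. "Strongly NP-hard" means that the decision version is NP-hard even when all numbers in the input are bounded by a polynomial in the input length. -}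

module Defs where

open import Data.Bool.Base using (Bool; true; false)
open import Data.Fin.Base using (Fin; zero; suc; toℕ)
open import Data.Fin.Properties using (toℕ-injective)
open import Data.Integer.Base as ℤ using (ℤ; +_; -[1+_]; ∣_∣)
open import Data.List.Base as List using (List; []; _∷_; [_]; _++_; length)
open import Data.List.Properties using (++-assoc; ∷-injective)
open import Data.List.Relation.Unary.All using (All)
open import Data.Maybe.Base using (Maybe; just; nothing)
open import Data.Nat.Base using (ℕ; zero; suc; _+_; _*_; _≤_; _⊔_; NonZero)
open import Data.Nat.Properties using (≤-trans; m≤m⊔n; m≤n⊔m; suc-injective)
open import Data.Nat.Binary.Base using (ℕᵇ; zero; 2[1+_]; 1+[2_]; fromℕ)
open import Data.Nat.Binary.Properties using (fromℕ-injective)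
open import Data.Product.Base using (Σ-syntax; ∃-syntax; _×_; _,_; proj₁; proj₂)
open import Data.Rational as ℚ using (ℚ; 0ℚ; ½)
import Data.Rational.Properties as ℚ
open import Data.Rational.Solver using (module +-*-Solver)
open import Data.Vec.Base as Vec using (Vec; []; _∷_)
open import Data.Vec.Functional as Vector using (Vector)
open import Data.Vec.Relation.Unary.All as VecAll using ()
open import Function.Base using (_∘_)
open import Function.Bundles using (_⇔_)
open import Relation.Binary.PropositionalEquality
  using (_≡_; refl; sym; trans; cong; subst)
open import Relation.Nullary.Negation using (¬_)

data Polynomial : Set where
  X       : Polynomial
  con     : ℕ → Polynomial
  _⊕_ _⊗_ : Polynomial → Polynomial → Polynomial

⟦_⟧ : Polynomial → ℕ → ℕ
⟦ X ⟧     n = n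
⟦ con c ⟧ n = c
⟦ p ⊕ q ⟧ n = ⟦ p ⟧ n + ⟦ q ⟧ n
⟦ p ⊗ q ⟧ n = ⟦ p ⟧ n * ⟦ q ⟧ n

Word : Set
Word = List Bool

data Symbol (marks : ℕ) : Set where
  blank : Symbol marks
  bit   : Bool → Symbol marks
  mark  : Fin marks → Symbol marks

data Move : Set where
  left stay right : Move

-- A tape is infinite in both directions. The cells to the left of the head
-- are listed nearest first; all cells not listed are blank.
record Tape (marks : ℕ) : Set where
  constructor tape
  field
    before : List (Symbol marks)
    head   : Symbol marks
    after  : List (Symbol marks)

module _ {marks : ℕ} where

  emptyTape : Tape marks
  emptyTape = tape [] blank []

  inputTape : Word → Tape marks
  inputTape []      = emptyTape
  inputTape (b ∷ w) = tape [] (bit b) (List.map bit w)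

  moveHead : Move → Tape marks → Tape marks
  moveHead left  (tape []       s as)       = tape [] blank (s ∷ as)
  moveHead left  (tape (b ∷ bs) s as)       = tape bs b (s ∷ as)
  moveHead stay  t                          = t
  moveHead right (tape bs       s [])       = tape (s ∷ bs) blank []
  moveHead right (tape bs       s (a ∷ as)) = tape (s ∷ bs) a as

  act : Symbol marks × Move → Tape marks → Tape marks
  act (s , m) (tape bs _ as) = moveHead m (tape bs s as)

  readBits : List (Symbol marks) → Word
  readBits (bit b ∷ ss) = b ∷ readBits ss
  readBits _            = []

  -- The output extends from the head up to the first cell not holding a bit.
  readOutput : Tape marks → Word
  readOutput (tape _ s as) = readBits (s ∷ as)

-- Tape 0 carries the (first) input and the output, tape 1 the second input,
-- if any; there may be further work tapes.
record Machine : Set where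
  field
    states : ℕ
    marks  : ℕ
    work   : ℕ
    start  : Fin states
    -- nothing: halt
    δ      : Fin states → Vec (Symbol marks) (2 + work) →
             Maybe (Fin states × Vec (Symbol marks × Move) (2 + work))

module _ (M : Machine) where
  open Machine M

  record Config : Set where
    constructor config
    field
      state : Fin states
      tapes : Vec (Tape marks) (2 + work)

  step : Config → Maybe Config
  step (config q ts) with δ q (Vec.map Tape.head ts)
  ... | nothing       = nothing
  ... | just (q′ , a) = just (config q′ (Vec.zipWith act a ts))

  initial : Word → Word → Config
  initial x y =
    config start (inputTape x ∷ inputTape y ∷ Vec.replicate work emptyTape)

  output : Config → Word
  output (config _ ts) = readOutput (Vec.head ts)

  -- HaltsWithin c t d: from c the machine halts, after at most t steps, in d.
  data HaltsWithin : Config → ℕ → Config → Set where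
    halted : ∀ {c t} → step c ≡ nothing → HaltsWithin c t c
    next   : ∀ {c c′ d t} → step c ≡ just c′ → HaltsWithin c′ t d →
             HaltsWithin c (suc t) d

  Computes : Word → Word → ℕ → Word → Set
  Computes x y t w = ∃[ d ] HaltsWithin (initial x y) t d × output d ≡ w

PolyTime : (Word → Word) → Set
PolyTime f = ∃[ M ] ∃[ p ] ∀ x → Computes M x [] (⟦ p ⟧ (length x)) (f x)

PolyTimeTest : (Word → Word → Bool) → Set
PolyTimeTest V = ∃[ M ] ∃[ p ] ∀ x y →
  Computes M x y (⟦ p ⟧ (length x + length y)) [ V x y ]

Language : Set₁
Language = Word → Set

NP : Language → Set
NP L = ∃[ V ] PolyTimeTest V × ∃[ p ] ∀ x →
  L x ⇔ (∃[ y ] length y ≤ ⟦ p ⟧ (length x) × V x y ≡ true)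

record DecisionProblem : Set₁ where
  field
    Instance         : Set
    encode           : Instance → Word
    encode-injective : ∀ {I J} → encode I ≡ encode J → I ≡ J
    numbers          : Instance → List ℕ
    Yes              : Instance → Set

  size : Instance → ℕ
  size I = length (encode I)

module _ (Π : DecisionProblem) where
  open DecisionProblem Π

  -- Hardness of Π restricted to the instances satisfying R: all instances
  -- produced by the reduction, positive or negative, have to satisfy R.
  NPHardOn : (Instance → Set) → Set₁
  NPHardOn R = (L : Language) → NP L →
    Σ[ f ∈ (Word → Instance) ]
      PolyTime (encode ∘ f) × (∀ x → R (f x)) × (∀ x → L x ⇔ Yes (f x))

  StronglyNPHardOn : (Instance → Set) → Set₁
  StronglyNPHardOn R = ∃[ q ]
    NPHardOn (λ I → R I × All (_≤ ⟦ q ⟧ (size I)) (numbers I))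

record ℝ : Set where
  field
    seq    : ℕ → ℚ
    cauchy : ∀ ε → 0ℚ ℚ.< ε →
             ∃[ N ] ∀ m n → N ≤ m → N ≤ n → ℚ.∣ seq m ℚ.- seq n ∣ ℚ.≤ ε

open ℝ

infix  4 _≤ℝ_
infixl 6 _+ℝ_

_≤ℝ_ : ℝ → ℝ → Set
x ≤ℝ y = ∀ ε → 0ℚ ℚ.< ε → ∃[ N ] ∀ n → N ≤ n → seq x n ℚ.≤ seq y n ℚ.+ ε

_+ℝ_ : ℝ → ℝ → ℝ
seq    (x +ℝ y) n     = seq x n ℚ.+ seq y n
cauchy (x +ℝ y) ε 0<ε = proj₁ cx ⊔ proj₁ cy , bound
  where
  0<ε/2 : 0ℚ ℚ.< ½ ℚ.* ε
  0<ε/2 = subst (ℚ._< ½ ℚ.* ε) (ℚ.*-zeroʳ ½) (ℚ.*-monoʳ-<-pos ½ 0<ε)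

  cx = cauchy x (½ ℚ.* ε) 0<ε/2
  cy = cauchy y (½ ℚ.* ε) 0<ε/2

  interchange : ∀ a b c d →
    (a ℚ.+ b) ℚ.- (c ℚ.+ d) ≡ (a ℚ.- c) ℚ.+ (b ℚ.- d)
  interchange = solve 4 (λ a b c d →
    (a :+ b) :- (c :+ d) := (a :- c) :+ (b :- d)) refl
    where open +-*-Solver

  halves : ½ ℚ.* ε ℚ.+ ½ ℚ.* ε ≡ ε
  halves = trans (sym (ℚ.*-distribʳ-+ ε ½ ½)) (ℚ.*-identityˡ ε)

  bound : ∀ m n → proj₁ cx ⊔ proj₁ cy ≤ m → proj₁ cx ⊔ proj₁ cy ≤ n →
    ℚ.∣ (seq x m ℚ.+ seq y m) ℚ.- (seq x n ℚ.+ seq y n) ∣ ℚ.≤ ε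
  bound m n N≤m N≤n = begin
    ℚ.∣ (seq x m ℚ.+ seq y m) ℚ.- (seq x n ℚ.+ seq y n) ∣
      ≡⟨ cong ℚ.∣_∣ (interchange (seq x m) (seq y m) (seq x n) (seq y n)) ⟩
    ℚ.∣ (seq x m ℚ.- seq x n) ℚ.+ (seq y m ℚ.- seq y n) ∣
      ≤⟨ ℚ.∣p+q∣≤∣p∣+∣q∣ (seq x m ℚ.- seq x n) (seq y m ℚ.- seq y n) ⟩
    ℚ.∣ seq x m ℚ.- seq x n ∣ ℚ.+ ℚ.∣ seq y m ℚ.- seq y n ∣
      ≤⟨ ℚ.+-mono-≤
           (proj₂ cx m n (≤-trans (m≤m⊔n _ _) N≤m) (≤-trans (m≤m⊔n _ _) N≤n))
           (proj₂ cy m n (≤-trans (m≤n⊔m (proj₁ cx) _) N≤m)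
                         (≤-trans (m≤n⊔m (proj₁ cx) _) N≤n)) ⟩
    ½ ℚ.* ε ℚ.+ ½ ℚ.* ε
      ≡⟨ halves ⟩
    ε ∎
    where open ℚ.≤-Reasoning

fromℚ : ℚ → ℝ
seq    (fromℚ q) _     = q
cauchy (fromℚ q) ε 0<ε = 0 , λ _ _ _ _ →
  subst (λ r → ℚ.∣ r ∣ ℚ.≤ ε) (sym (ℚ.+-inverseʳ q)) (ℚ.<⇒≤ 0<ε)

natℝ : ℕ → ℝ
natℝ n = fromℚ (+ n ℚ./ 1)

sumℝ : ∀ {n} → Vector ℝ n → ℝ
sumℝ = Vector.foldr _+ℝ_ (natℝ 0)

-- Periods are numbered from 1 in the mathematics but from 0 in Fin periods.
record Request (periods : ℕ) : Set where
  constructor request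
  field
    value               : ℕ
    deadline            : Fin periods
    demand              : ℕ
    .{{value-nonZero}}  : NonZero value
    .{{demand-nonZero}} : NonZero demand

Agent : ℕ → Set
Agent periods = List (Request periods)

record ChargeInstance : Set where
  constructor mkInstance
  field
    periods              : ℕ
    .{{periods-nonZero}} : NonZero periods
    supply               : Vec ℕ periods
    agentCount           : ℕ
    agents               : Vec (Agent periods) agentCount
    target               : ℤ

cumulative : ∀ {n} → Vector ℝ n → Vector ℝ n
cumulative a zero    = a zero
cumulative a (suc t) = a zero +ℝ cumulative (a ∘ suc) t

Met : ∀ {T} → Vector ℝ T → Request T → Set
Met a r = natℝ (demand r) ≤ℝ cumulative a (deadline r)
  where open Request

-- HasValue a rs v: the values of those requests in rs that are met by a sum
-- up to v. This is the graph of the agent's valuation, which is given as a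
-- relation because the order on ℝ is not decidable.
data HasValue {T : ℕ} (a : Vector ℝ T) : Agent T → ℕ → Set where
  []    : HasValue a [] 0
  met   : ∀ {r rs v} → Met a r → HasValue a rs v →
          HasValue a (r ∷ rs) (Request.value r + v)
  unmet : ∀ {r rs v} → ¬ Met a r → HasValue a rs v →
          HasValue a (r ∷ rs) v

module _ (I : ChargeInstance) where
  open ChargeInstance I

  Allocation : Set
  Allocation = Fin agentCount → Vector ℝ periods

  Feasible : Allocation → Set
  Feasible a = (∀ i t → natℝ 0 ≤ℝ a i t)
             × (∀ t → sumℝ (λ i → a i t) ≤ℝ natℝ (Vec.lookup supply t))

  Achievable : Set
  Achievable = Σ[ a ∈ Allocation ] Feasible a ×
    Σ[ v ∈ Vector ℕ agentCount ]
      (∀ i → HasValue (a i) (Vec.lookup agents i) (v i)) ×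
      target ℤ.≤ + Vector.foldr _+_ 0 v

-- The digits in the (bijective) binary representation, least significant
-- first, each preceded by true; the end is marked by false.
encodeℕᵇ : ℕᵇ → Word
encodeℕᵇ zero     = false ∷ []
encodeℕᵇ 2[1+ n ] = true ∷ false ∷ encodeℕᵇ n
encodeℕᵇ 1+[2 n ] = true ∷ true ∷ encodeℕᵇ n

encodeℕ : ℕ → Word
encodeℕ n = encodeℕᵇ (fromℕ n)

isNegative : ℤ → Bool
isNegative (+ _)    = false
isNegative -[1+ _ ] = true

requestNumbers : ∀ {T} → Request T → List ℕ
requestNumbers (request v d w) = v ∷ suc (toℕ d) ∷ w ∷ []

agentNumbers : ∀ {T} → Agent T → List ℕ
agentNumbers rs = length rs ∷ List.concatMap requestNumbers rs

chargeNumbers : ChargeInstance → List ℕ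
chargeNumbers I =
  ∣ target ∣ ∷ periods ∷ Vec.toList supply ++
  agentCount ∷ List.concatMap agentNumbers (Vec.toList agents)
  where open ChargeInstance I

encodeCharge : ChargeInstance → Word
encodeCharge I =
  isNegative (ChargeInstance.target I) ∷ List.concatMap encodeℕ (chargeNumbers I)

private
  PrefixFree : {A B : Set} → (A → List B) → Set
  PrefixFree e = ∀ x y {us vs} → e x ++ us ≡ e y ++ vs → x ≡ y × us ≡ vs

  encodeℕᵇ-prefixFree : PrefixFree encodeℕᵇ
  encodeℕᵇ-prefixFree zero     zero     refl = refl , refl
  encodeℕᵇ-prefixFree zero     2[1+ n ] ()
  encodeℕᵇ-prefixFree zero     1+[2 n ] ()
  encodeℕᵇ-prefixFree 2[1+ m ] zero     ()
  encodeℕᵇ-prefixFree 2[1+ m ] 1+[2 n ] ()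
  encodeℕᵇ-prefixFree 1+[2 m ] zero     ()
  encodeℕᵇ-prefixFree 1+[2 m ] 2[1+ n ] ()
  encodeℕᵇ-prefixFree 2[1+ m ] 2[1+ n ] eq
    with refl , eq′ ← encodeℕᵇ-prefixFree m n
                        (proj₂ (∷-injective (proj₂ (∷-injective eq))))
    = refl , eq′
  encodeℕᵇ-prefixFree 1+[2 m ] 1+[2 n ] eq
    with refl , eq′ ← encodeℕᵇ-prefixFree m n
                        (proj₂ (∷-injective (proj₂ (∷-injective eq))))
    = refl , eq′

  encodeℕ-prefixFree : PrefixFree encodeℕ
  encodeℕ-prefixFree m n eq
    with eq₁ , eq₂ ← encodeℕᵇ-prefixFree (fromℕ m) (fromℕ n) eq
    = fromℕ-injective eq₁ , eq₂

  encodeℕ-nonEmpty : ∀ n {us} → ¬ [] ≡ encodeℕ n ++ us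
  encodeℕ-nonEmpty n eq with fromℕ n
  encodeℕ-nonEmpty n () | zero
  encodeℕ-nonEmpty n () | 2[1+ _ ]
  encodeℕ-nonEmpty n () | 1+[2 _ ]

  encodeℕs-injective : ∀ ms ns →
    List.concatMap encodeℕ ms ≡ List.concatMap encodeℕ ns → ms ≡ ns
  encodeℕs-injective []       []       eq = refl
  encodeℕs-injective []       (n ∷ ns) eq with () ← encodeℕ-nonEmpty n eq
  encodeℕs-injective (m ∷ ms) []       eq with () ← encodeℕ-nonEmpty m (sym eq)
  encodeℕs-injective (m ∷ ms) (n ∷ ns) eq
    with refl , eq′ ← encodeℕ-prefixFree m n eq
    = cong (m ∷_) (encodeℕs-injective ms ns eq′)

  ++-regroup : {B : Set} (as bs {us cs ds vs} : List B) →
    (as ++ bs) ++ us ≡ (cs ++ ds) ++ vs → as ++ (bs ++ us) ≡ cs ++ (ds ++ vs)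
  ++-regroup as bs {us} {cs} {ds} {vs} eq =
    trans (sym (++-assoc as bs us)) (trans eq (++-assoc cs ds vs))

  vec-prefixFree : {A B : Set} {e : A → List B} → PrefixFree e →
    ∀ {n} → PrefixFree (λ (xs : Vec A n) → List.concatMap e (Vec.toList xs))
  vec-prefixFree pf []       []       eq = refl , eq
  vec-prefixFree {e = e} pf (x ∷ xs) (y ∷ ys) eq
    with refl , eq₁ ← pf x y (++-regroup (e x) _ {cs = e y} eq)
    with refl , eq₂ ← vec-prefixFree pf xs ys eq₁
    = refl , eq₂

  list-prefixFree : {A : Set} {e : A → List ℕ} → PrefixFree e →
    PrefixFree (λ xs → length xs ∷ List.concatMap e xs)
  list-prefixFree pf []       []       eq = refl , proj₂ (∷-injective eq)
  list-prefixFree pf []       (y ∷ ys) ()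
  list-prefixFree pf (x ∷ xs) []       ()
  list-prefixFree {e = e} pf (x ∷ xs) (y ∷ ys) eq
    with len , eq₀ ← ∷-injective eq
    with refl , eq₁ ← pf x y (++-regroup (e x) _ {cs = e y} eq₀)
    with eq₂ , eq₃ ← list-prefixFree pf xs ys
                       (trans (cong (_∷ _) (suc-injective len)) (cong (_ ∷_) eq₁))
    = cong (x ∷_) eq₂ , eq₃

  request-prefixFree : ∀ {T} → PrefixFree (requestNumbers {T})
  request-prefixFree (request v d w) (request v′ d′ w′) eq
    with refl , eq₁ ← ∷-injective eq
    with eqd  , eq₂ ← ∷-injective eq₁
    with refl , eq₃ ← ∷-injective eq₂
    with refl ← toℕ-injective (suc-injective eqd)
    = refl , eq₃

  toList-prefixFree : {A : Set} {n : ℕ} → PrefixFree (Vec.toList {A = A} {n})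
  toList-prefixFree []       []       eq = refl , eq
  toList-prefixFree (x ∷ xs) (y ∷ ys) eq
    with refl , eq₁ ← ∷-injective eq
    with refl , eq₂ ← toList-prefixFree xs ys eq₁
    = refl , eq₂

  ℤ-injective : ∀ i j → isNegative i ≡ isNegative j → ∣ i ∣ ≡ ∣ j ∣ → i ≡ j
  ℤ-injective (+ _)    (+ _)    _  refl = refl
  ℤ-injective (+ _)    -[1+ _ ] () _
  ℤ-injective -[1+ _ ] (+ _)    () _
  ℤ-injective -[1+ _ ] -[1+ _ ] _  refl = refl

encodeCharge-injective : ∀ {I J} → encodeCharge I ≡ encodeCharge J → I ≡ J
encodeCharge-injective {I@(mkInstance T s n as V)} {J@(mkInstance T′ s′ n′ as′ V′)} eq
  with eqS , eq₀ ← ∷-injective eq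
  with eqV , eq₁ ← ∷-injective 
      (encodeℕs-injective (chargeNumbers I) (chargeNumbers J) eq₀)
  with refl ← ℤ-injective V V′ eqS eqV
  with refl , eq₂ ← ∷-injective eq₁
  with refl , eq₃ ← toList-prefixFree s s′ eq₂
  with refl , eq₄ ← ∷-injective eq₃
  with refl , _ ← vec-prefixFree (list-prefixFree request-prefixFree) as as′
                    (cong (_++ []) eq₄)
  = refl

ChargeScheduling : DecisionProblem
ChargeScheduling = record
  { Instance         = ChargeInstance
  ; encode           = encodeCharge
  ; encode-injective = encodeCharge-injective
  ; numbers          = chargeNumbers
  ; Yes              = Achievable
  }

PeriodsBoundedBy : Polynomial → ChargeInstance → Set
PeriodsBoundedBy p I = ChargeInstance.periods I ≤ ⟦ p ⟧ (length (encodeCharge I))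

DeadlinesPerAgent : ℕ → ChargeInstance → Set
DeadlinesPerAgent k I = VecAll.All (λ rs → length rs ≡ k) (ChargeInstance.agents I)

DemandsBoundedBy : ℕ → ChargeInstance → Set
DemandsBoundedBy D I =
  VecAll.All (All (λ r → Request.demand r ≤ D)) (ChargeInstance.agents I)

-- A computation of the verifier, drawn with the tapes moving under fixed
-- heads, is a tiling of a grid by Wang tiles. Joining the rows end to end
-- turns the grid into a strip, in which cell i has to match cells 1 + i and
-- C + i. For each cell and each tile g there are two triples of bins: one of
-- g with its eastern and northern colours, which belong to the neighbouring
-- cells, and one of g with its western and southern colours. When the capacity
-- of a colour is the number of tiles that have it, exactly filling all bins
-- amounts to choosing one tile per cell such that neighbours match.
--
-- The bins are the periods. Charge has a strictly decreasing price, and the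
-- agent for a triple, whose cumulative demands are 1, 2 and 3, breaks even
-- only if it meets all of them, by one unit at each of its deadlines, or none.
-- The target is the worth of the whole supply. To reach it, every agent has to
-- break even and, by summation by parts, no supply may be left over. Real
-- numbers matter only in comparing demands with cumulative supplies, and these
-- are integers.
--
-- The instances are described in a small language of nested loops over words,
-- which is translated to programs for stack machines and then to Turing
-- machines, along with polynomial bounds on sizes and running times.

module Submission where

open import Defs
open ℝ using (seq)

import Algebra.Properties.Semiring.Sum as SemiringSum
import Algebra.Properties.CommutativeSemigroup as CommutativeSemigroupProperties
open import Algebra.Bundles using (module CommutativeMonoid)
open import Data.Bool.Base using (Bool; true; false; if_then_else_; _∧_; not)
open import Data.Fin.Base as Fin using (Fin; zero; suc; toℕ; fromℕ<; combine; remQuot; splitAt; _↑ˡ_; _↑ʳ_)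
import Data.Fin.Properties as Fin
open import Data.Integer.Base as ℤ using (ℤ)
import Data.Integer.Properties as ℤ
open import Data.List.Base as List using (List; []; _∷_; _++_; _ʳ++_; length; replicate; concatMap; foldr)
import Data.List.Properties as List
open import Data.List.Relation.Unary.All as All using (All; []; _∷_)
import Data.List.Relation.Unary.All.Properties as All
open import Data.Maybe.Base as Maybe using (Maybe; just; nothing; maybe; is-just; is-nothing)
open import Data.Nat.Base
  using (ℕ; zero; suc; _+_; _*_; _∸_; _⊔_; _≤_; _<_; _<ᵇ_; _≡ᵇ_; z≤n; s≤s; s≤s⁻¹; z<s; NonZero; ⌊_/2⌋)
open import Data.Nat.Properties
open SemiringSum +-*-semiring using (sum; sum-cong-≗; ∑-distrib-+; *-distribʳ-sum; sum-replicate-zero)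
open import Data.Nat.Divisibility using (n∣m*n)
open import Data.Nat.DivMod
  using (_/_; _%_; m%n<n; m≡m%n+[m/n]*n; m<n⇒m/n≡0; m*n/n≡m; [m+kn]%n≡m%n; m<n⇒m%n≡m; +-distrib-/-∣ʳ)
open import Data.Nat.Tactic.RingSolver using (solve-∀)
open import Data.Nat.Binary.Base using (ℕᵇ; 2[1+_]; 1+[2_]; fromℕ) renaming (zero to 0ᵇ; toℕ to toℕᵇ)
import Data.Nat.Binary.Properties as ℕᵇ
open import Data.Product.Base using (Σ-syntax; ∃; ∃-syntax; ∃₂; _×_; _,_; proj₁; proj₂; uncurry)
open import Data.Rational as ℚ using (ℚ; 0ℚ; ½)
import Data.Rational.Properties as ℚ
open import Data.Rational.Unnormalised.Base using (mkℚᵘ; *≡*; *≤*)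
import Data.Rational.Unnormalised.Properties as ℚᵘ
open import Data.Sum.Base using (_⊎_; inj₁; inj₂; [_,_]′)
open import Data.Unit.Base using (⊤; tt)
open import Data.Vec.Base as Vec using (Vec; []; _∷_; lookup; tabulate)
open import Data.Vec.Functional as Vector using (Vector)
import Data.Vec.Properties as Vec
import Data.Vec.Relation.Unary.All.Properties as VecAll
open import Function.Base using (_∘_; id)
open import Function.Bundles using (mk⇔; Equivalence)
open import Relation.Binary.Definitions using (tri<; tri≈; tri>)
open import Relation.Binary.PropositionalEquality
open import Relation.Nullary using (¬_; Dec; yes; no; does; contradiction)

-- Stack programs

-- Hardness means reducing every NP language, so the reduction starts from an arbitrary verifier.
-- The tiles depend on the verifier alone; the input enters only through the number of cells and the
-- bottom colours. This is why loops around constant pieces can write an instance down.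
--
-- The bins do not demand one tile per cell: a tile bin merely makes one of the two triples of its
-- tile be used. But one place for the colour `edge` is withheld in cell 0. This forces a single
-- choice there, and the matching of colours passes it on along the strip.
--
-- One unit at each deadline meets the cumulative demands only if the deadlines are in temporal
-- order. Hence colours move to later cells only, and the bins of a cell are ordered west, south,
-- tile.
--
-- The three values of an agent differ from the prices at its deadlines by -1, -1 and 2: the last
-- request repays what the first two lose. Skipping one of the first two means buying an extra unit
-- at a later deadline, or two of them; with prices of at least 2 this costs more than it saves.

Store : Set
Store = ℕ → Word

-- Unlike if does d then x else y, this does not reduce to a test on booleans,
-- so that abstracting over d exposes its proof.
pick : {P A : Set} → Dec P → A → A → A
pick (yes _) x y = x
pick (no _)  x y = y

infixl 6 _[_↦_]

_[_↦_] : Store → ℕ → Word → Store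
(σ [ r ↦ w ]) s = pick (s ≟ r) w (σ s)

infixr 5 _⨾_

data Prog : Set where
  skip : Prog
  push : ℕ → Bool → Prog
  _⨾_  : Prog → Prog → Prog
  case : ℕ → Prog → (Bool → Prog) → Prog
  loop : ℕ → (Bool → Prog) → Prog

-- Stores are functions, so a run may end in any store pointwise equal to the computed one. The
-- times bound those of the compiled machine, where a push takes two steps: moving left and writing.
data Exec : Prog → Store → ℕ → Store → Set where
  skip   : ∀ {σ σ′} → σ ≗ σ′ → Exec skip σ 1 σ′
  push   : ∀ {σ σ′ r b} → σ [ r ↦ b ∷ σ r ] ≗ σ′ → Exec (push r b) σ 2 σ′
  _⨾_    : ∀ {p q σ σ₁ σ₂ t u} →
           Exec p σ t σ₁ → Exec q σ₁ u σ₂ → Exec (p ⨾ q) σ (t + u) σ₂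
  case[] : ∀ {r p q σ σ′ t} → σ r ≡ [] →
           Exec p σ t σ′ → Exec (case r p q) σ (suc t) σ′
  case∷  : ∀ {r p q σ σ′ t} b w → σ r ≡ b ∷ w →
           Exec (q b) (σ [ r ↦ w ]) t σ′ → Exec (case r p q) σ (suc t) σ′
  loop[] : ∀ {r q σ σ′} → σ r ≡ [] → σ ≗ σ′ → Exec (loop r q) σ 1 σ′
  loop∷  : ∀ {r q σ σ₁ σ₂ t u} b w → σ r ≡ b ∷ w →
           Exec (q b) (σ [ r ↦ w ]) t σ₁ → Exec (loop r q) σ₁ u σ₂ →
           Exec (loop r q) σ (suc (t + u)) σ₂
  weaken : ∀ {p σ σ′ t u} → t ≤ u → Exec p σ t σ′ → Exec p σ u σ′

Exec-respʳ : ∀ {p σ t σ′ τ} → σ′ ≗ τ → Exec p σ t σ′ → Exec p σ t τ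
Exec-respʳ e (skip f)          = skip λ s → trans (f s) (e s)
Exec-respʳ e (push f)          = push λ s → trans (f s) (e s)
Exec-respʳ e (x ⨾ y)           = x ⨾ Exec-respʳ e y
Exec-respʳ e (case[] f x)      = case[] f (Exec-respʳ e x)
Exec-respʳ e (case∷ b w f x)   = case∷ b w f (Exec-respʳ e x)
Exec-respʳ e (loop[] f g)      = loop[] f λ s → trans (g s) (e s)
Exec-respʳ e (loop∷ b w f x y) = loop∷ b w f x (Exec-respʳ e y)
Exec-respʳ e (weaken l x)      = weaken l (Exec-respʳ e x)

-- From programs to Turing machines

registers : Prog → ℕ
registers skip         = 0
registers (push r _)   = suc r
registers (p ⨾ q)      = registers p ⊔ registers q
registers (case r p q) = suc r ⊔ (registers p ⊔ (registers (q false) ⊔ registers (q true)))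
registers (loop r q)   = suc r ⊔ (registers (q false) ⊔ registers (q true))

positions : Prog → ℕ
positions skip         = 1
positions (push r b)   = 2
positions (p ⨾ q)      = positions p + positions q
positions (case r p q) = suc (positions p + (positions (q false) + positions (q true)))
positions (loop r q)   = suc (positions (q false) + positions (q true))

entry : ∀ p → Fin (positions p)
entry skip         = zero
entry (push r b)   = zero
entry (p ⨾ q)      = entry p ↑ˡ positions q
entry (case r p q) = zero
entry (loop r q)   = zero

-- Registers are plain numbers, and one without a tape reads as empty. The bound on `registers` in
-- `simulate` keeps this case away.
readAt : ∀ {n} → ℕ → Vec (Symbol 0) n → Symbol 0
readAt _       []       = blank
readAt zero    (h ∷ _)  = h
readAt (suc r) (_ ∷ hs) = readAt r hs

module _ {S : ℕ} where

  Heads Acts : Set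
  Heads = Vec (Symbol 0) S
  Acts  = Vec (Symbol 0 × Move) S

  idle : Heads → Acts
  idle = Vec.map (_, stay)

  actOn : ℕ → (Symbol 0 → Symbol 0 × Move) → Heads → Acts
  actOn r f hs = tabulate λ j →
    pick (toℕ j ≟ r) (f (lookup hs j)) (lookup hs j , stay)

  -- δᴾ p i hs e x: the target state and action at position i of p, whose
  -- positions are located at e and whose exit is x.
  δᴾ : ∀ p → Fin (positions p) → Heads → ∀ {Q : Set} → (Fin (positions p) → Q) → Q → Q × Acts

  branch : ∀ (p q : Prog) → Fin (positions p + positions q) → Heads →
           ∀ {Q : Set} → (Fin (positions p + positions q) → Q) → Q → Q → Q × Acts
  branch p q i hs e x y with splitAt (positions p) i
  ... | inj₁ j = δᴾ p j hs (e ∘ (_↑ˡ positions q)) x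
  ... | inj₂ j = δᴾ q j hs (e ∘ (positions p ↑ʳ_)) y

  bitEntry : ∀ (q : Bool → Prog) → Bool → Fin (positions (q false) + positions (q true))
  bitEntry q false = entry (q false) ↑ˡ positions (q true)
  bitEntry q true  = positions (q false) ↑ʳ entry (q true)

  popAct : ℕ → Heads → Acts
  popAct r = actOn r (_, right)

  δᴾ skip       _       hs e x = x , idle hs
  δᴾ (push r b) zero    hs e x = e (suc zero) , actOn r (_, left) hs
  δᴾ (push r b) (suc _) hs e x = x , actOn r (λ _ → bit b , stay) hs
  δᴾ (p ⨾ q)    i       hs e x = branch p q i hs e (e (positions p ↑ʳ entry q)) x
  δᴾ (case r p q) zero  hs e x with readAt r hs
  ... | bit b = e (suc (positions p ↑ʳ bitEntry q b)) , popAct r hs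
  ... | _     = e (suc (entry p ↑ˡ _)) , idle hs
  δᴾ (case r p q) (suc i) hs e x with splitAt (positions p) i
  ... | inj₁ j = δᴾ p j hs (e ∘ suc ∘ (_↑ˡ _)) x
  ... | inj₂ j = branch (q false) (q true) j hs (e ∘ suc ∘ (positions p ↑ʳ_)) x x
  δᴾ (loop r q) zero    hs e x with readAt r hs
  ... | bit b = e (suc (bitEntry q b)) , popAct r hs
  ... | _     = x , idle hs
  δᴾ (loop r q) (suc i) hs e x = branch (q false) (q true) i hs (e ∘ suc) (e zero) (e zero)

-- State `zero` is the exit of the whole program and halts. Register `r` lives on tape `r`, so
-- register 0 receives the input and ends with the output.
compile : Prog → Machine
compile p = record
  { states = suc (positions p)
  ; marks  = 0
  ; work   = registers p
  ; start  = suc (entry p)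
  ; δ      = δ
  }
  where
  δ : Fin (suc (positions p)) → Vec (Symbol 0) (2 + registers p) →
      Maybe (Fin (suc (positions p)) × Vec (Symbol 0 × Move) (2 + registers p))
  δ zero    _  = nothing
  δ (suc i) hs = just (δᴾ p i hs suc zero)

-- Words on tapes

data Cells : List (Symbol 0) → Word → Set where
  []    : Cells [] []
  blank : ∀ {ss} → Cells ss [] → Cells (blank ∷ ss) []
  bit   : ∀ {b ss w} → Cells ss w → Cells (bit b ∷ ss) (b ∷ w)

-- A stack has its top under the head and only blanks behind its bottom. The cells to the left are
-- arbitrary: a pop leaves its bit there, and a push overwrites it.
record Holds (t : Tape 0) (w : Word) : Set where
  constructor holds
  field cells : Cells (Tape.head t ∷ Tape.after t) w

Holds-head-[] : ∀ {t w} → Holds t w → w ≡ [] → Tape.head t ≡ blank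
Holds-head-[] (holds (blank _)) _ = refl

Holds-head-∷ : ∀ {t v b w} → Holds t v → v ≡ b ∷ w → Tape.head t ≡ bit b
Holds-head-∷ (holds (bit _)) refl = refl

Holds-right : ∀ (t : Tape 0) {v b w} → Holds t v → v ≡ b ∷ w → Holds (act (Tape.head t , right) t) w
Holds-right _ (holds (bit []))        refl = holds (blank [])
Holds-right _ (holds (bit (blank c))) refl = holds (blank c)
Holds-right _ (holds (bit (bit c)))   refl = holds (bit c)

Holds-left : ∀ (t : Tape 0) {w} b → Holds t w →
  Holds (act (bit b , stay) (act (Tape.head t , left) t)) (b ∷ w)
Holds-left (tape [] s as)       b (holds c) = holds (bit c)
Holds-left (tape (_ ∷ bs) s as) b (holds c) = holds (bit c)

Holds-input : ∀ w → Holds (inputTape w) w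
Holds-input []      = holds (blank [])
Holds-input (b ∷ w) = holds (bit (cells w))
  where
  cells : ∀ w → Cells (List.map bit w) w
  cells []      = []
  cells (b ∷ w) = bit (cells w)

readBits-cells : ∀ {ss w} → Cells ss w → readBits ss ≡ w
readBits-cells []        = refl
readBits-cells (blank c) = refl
readBits-cells (bit c)   = cong (_ ∷_) (readBits-cells c)

HaltsWithin-weaken : ∀ {M c t u d} → t ≤ u → HaltsWithin M c t d → HaltsWithin M c u d
HaltsWithin-weaken t≤u       (halted e) = halted e
HaltsWithin-weaken (s≤s t≤u) (next e h) = next e (HaltsWithin-weaken t≤u h)

module _ {S : ℕ} where

  record Represents (ts : Vec (Tape 0) S) (σ : Store) : Set where
    constructor represents
    field at : ∀ j → Holds (lookup ts j) (σ (toℕ j))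

  open Represents

  represents-≗ : ∀ {ts σ σ′} → σ ≗ σ′ → Represents ts σ → Represents ts σ′
  represents-≗ e R = represents λ j → subst (Holds _) (e (toℕ j)) (at R j)

  act-idle : ∀ (ts : Vec (Tape 0) S) → Vec.zipWith act (idle (Vec.map Tape.head ts)) ts ≡ ts
  act-idle ts = go ts
    where
    go : ∀ {n} (ts : Vec (Tape 0) n) →
         Vec.zipWith act (Vec.map (_, stay) (Vec.map Tape.head ts)) ts ≡ ts
    go []       = refl
    go (t ∷ ts) = cong (t ∷_) (go ts)

  lookup-actOn : ∀ r f (ts : Vec (Tape 0) S) j →
    lookup (Vec.zipWith act (actOn r f (Vec.map Tape.head ts)) ts) j ≡
    pick (toℕ j ≟ r) (act (f (Tape.head (lookup ts j))) (lookup ts j)) (lookup ts j)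
  lookup-actOn r f ts j
    rewrite Vec.lookup-zipWith act j (actOn r f (Vec.map Tape.head ts)) ts
          | Vec.lookup∘tabulate (λ j → pick (toℕ j ≟ r) (f (lookup (Vec.map Tape.head ts) j))
            (lookup (Vec.map Tape.head ts) j , stay)) j
          | Vec.lookup-map j Tape.head ts
    with toℕ j ≟ r
  ... | yes _ = refl
  ... | no _  = refl

  readAt-lookup : ∀ {n} (ts : Vec (Tape 0) n) r (r<n : r < n) →
    readAt r (Vec.map Tape.head ts) ≡ Tape.head (lookup ts (fromℕ< r<n))
  readAt-lookup (t ∷ ts) zero    _         = refl
  readAt-lookup (t ∷ ts) (suc r) (s≤s r<n) = readAt-lookup ts r r<n

  holds-at : ∀ {ts σ} → Represents ts σ → ∀ {r} (r<S : r < S) →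
    Holds (lookup ts (fromℕ< r<S)) (σ r)
  holds-at {ts} {σ} R r<S = subst (λ n → Holds (lookup ts (fromℕ< r<S)) (σ n)) (Fin.toℕ-fromℕ< r<S) (at R (fromℕ< r<S))

  read-[] : ∀ {ts σ} → Represents ts σ → ∀ {r} → r < S → σ r ≡ [] →
    readAt r (Vec.map Tape.head ts) ≡ blank
  read-[] {ts} R {r} r<S e = trans (readAt-lookup ts r r<S) (Holds-head-[] (holds-at R r<S) e)

  read-∷ : ∀ {ts σ} → Represents ts σ → ∀ {r} → r < S → ∀ {b w} → σ r ≡ b ∷ w →
    readAt r (Vec.map Tape.head ts) ≡ bit b
  read-∷ {ts} R {r} r<S e = trans (readAt-lookup ts r r<S) (Holds-head-∷ (holds-at R r<S) e)

  represents-pop : ∀ {ts σ} → Represents ts σ → ∀ r {b w} → σ r ≡ b ∷ w →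
    Represents (Vec.zipWith act (popAct r (Vec.map Tape.head ts)) ts) (σ [ r ↦ w ])
  represents-pop {ts} {σ} R r {w = w} e = represents λ j →
    subst (λ t → Holds t ((σ [ r ↦ w ]) (toℕ j))) (sym (lookup-actOn r (_, right) ts j)) (popped j)
    where
    popped : ∀ j → Holds (pick (toℕ j ≟ r) (act (Tape.head (lookup ts j) , right) (lookup ts j)) (lookup ts j))
                         ((σ [ r ↦ w ]) (toℕ j))
    popped j with toℕ j ≟ r
    ... | no _     = at R j
    ... | yes refl = Holds-right (lookup ts j) (at R j) e

  represents-push : ∀ {ts σ} → Represents ts σ → ∀ r b →
    let us = Vec.zipWith act (actOn r (_, left) (Vec.map Tape.head ts)) ts in
    Represents (Vec.zipWith act (actOn r (λ _ → bit b , stay) (Vec.map Tape.head us)) us)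
               (σ [ r ↦ b ∷ σ r ])
  represents-push {ts} {σ} R r b = represents λ j →
    subst (λ t → Holds t ((σ [ r ↦ b ∷ σ r ]) (toℕ j)))
      (sym (trans (lookup-actOn r (λ _ → bit b , stay) us j) (cong (write j) (lookup-actOn r (_, left) ts j))))
      (pushed j)
    where
    us = Vec.zipWith act (actOn r (_, left) (Vec.map Tape.head ts)) ts
    write : Fin S → Tape 0 → Tape 0
    write j t = pick (toℕ j ≟ r) (act (bit b , stay) t) t
    pushed : ∀ j →
      Holds (write j (pick (toℕ j ≟ r) (act (Tape.head (lookup ts j) , left) (lookup ts j)) (lookup ts j)))
            ((σ [ r ↦ b ∷ σ r ]) (toℕ j))
    pushed j with toℕ j ≟ r
    ... | no _     = at R j
    ... | yes refl = Holds-left (lookup ts j) b (at R j)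

-- Simulation of programs by the compiled machine

module _ (root : Prog) where

  private
    M = compile root
    S = 2 + registers root
    open Machine M using (states)

  -- The placement `e` and the exit `x` are arbitrary so that induction reaches subprograms; the
  -- body of a loop, for instance, exits to the test of the loop.
  Located : ∀ p → (Fin (positions p) → Fin states) → Fin states → Set
  Located p e x = ∀ i hs → Machine.δ M (e i) hs ≡ just (δᴾ p i hs e x)

  -- `HaltsWithin` speaks only of runs up to a halt. A partial run is therefore given by what it
  -- adds to each halting run that continues it.
  record Leads (i : Fin states) (ts : Vec (Tape 0) S) (t : ℕ) (j : Fin states) (us : Vec (Tape 0) S) : Set where
    constructor leads
    field
      extend : ∀ {u d} → HaltsWithin M (config j us) u d → HaltsWithin M (config i ts) (t + u) d

  open Leads

  leads-step : ∀ {i ts j as} → Machine.δ M i (Vec.map Tape.head ts) ≡ just (j , as) →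
    Leads i ts 1 j (Vec.zipWith act as ts)
  leads-step {i} {ts} {j} {as} eq = leads (next step-eq)
    where
    step-eq : step M (config i ts) ≡ just (config j (Vec.zipWith act as ts))
    step-eq rewrite eq = refl

  leads-trans : ∀ {i ts t j us u k vs} → Leads i ts t j us → Leads j us u k vs →
    Leads i ts (t + u) k vs
  leads-trans {i} {ts} {t} {u = u} f g = leads λ {v} {d} h →
    subst (λ n → HaltsWithin M (config i ts) n d) (sym (+-assoc t u v)) (extend f (extend g h))

  branchˡ : ∀ p q {e : Fin (positions p + positions q) → Fin states} {x y} →
    (∀ i hs → Machine.δ M (e i) hs ≡ just (branch p q i hs e x y)) →
    Located p (e ∘ (_↑ˡ positions q)) x
  branchˡ p q L i hs rewrite L (i ↑ˡ positions q) hs | Fin.splitAt-↑ˡ (positions p) i (positions q) = refl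

  branchʳ : ∀ p q {e : Fin (positions p + positions q) → Fin states} {x y} →
    (∀ i hs → Machine.δ M (e i) hs ≡ just (branch p q i hs e x y)) →
    Located q (e ∘ (positions p ↑ʳ_)) y
  branchʳ p q L i hs rewrite L (positions p ↑ʳ i) hs | Fin.splitAt-↑ʳ (positions p) (positions q) i = refl

  Simulates : Prog → ℕ → Store → (σ′ : Store) → Set
  Simulates p t σ σ′ = ∀ {e x ts} → Located p e x → Represents ts σ →
    ∃[ us ] Represents us σ′ × Leads (e (entry p)) ts t x us

  simulate-bit : ∀ q b {e : Fin (positions (q false) + positions (q true)) → Fin states} {x t σ σ′ ts} →
    (∀ i hs → Machine.δ M (e i) hs ≡ just (branch (q false) (q true) i hs e x x)) →
    Simulates (q b) t σ σ′ → Represents ts σ →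
    ∃[ us ] Represents us σ′ × Leads (e (bitEntry {S} q b)) ts t x us
  simulate-bit q false L s R = s (branchˡ (q false) (q true) L) R
  simulate-bit q true  L s R = s (branchʳ (q false) (q true) L) R

  register≤ : ∀ r n → suc r ⊔ n ≤ S → r < S
  register≤ r n = m⊔n≤o⇒m≤o (suc r) n

  bit≤ : ∀ (q : Bool → Prog) b → registers (q b) ≤ registers (q false) ⊔ registers (q true)
  bit≤ q false = m≤m⊔n _ _
  bit≤ q true  = m≤n⊔m (registers (q false)) _

  simulate : ∀ {p t σ σ′} → registers p ≤ S → Exec p σ t σ′ → Simulates p t σ σ′
  simulate ≤S (skip f) {ts = ts} L R = ts , represents-≗ f R ,
    subst (Leads _ ts 1 _) (act-idle ts) (leads-step (L zero _))
  simulate ≤S (push {r = r} {b} f) L R =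
    _ , represents-≗ f (represents-push R r b) ,
    leads-trans (leads-step (L zero _)) (leads-step (L (suc zero) _))
  simulate ≤S (_⨾_ {p} {q} x y) L R =
    let us , R₁ , l₁ = simulate (≤-trans (m≤m⊔n _ _) ≤S) x (branchˡ p q L) R
        vs , R₂ , l₂ = simulate (≤-trans (m≤n⊔m (registers p) _) ≤S) y (branchʳ p q L) R₁
    in vs , R₂ , leads-trans l₁ l₂
  simulate {σ = σ} ≤S (case[] {r} {p} {q} f z) {e} {x} {ts} L R =
    let us , R₁ , l₁ = simulate (≤-trans (≤-trans (m≤m⊔n _ _) (m≤n⊔m (suc r) _)) ≤S) z located R
    in us , R₁ , leads-trans (subst (Leads _ ts 1 _) (act-idle ts) (leads-step first)) l₁
    where
    located : Located p (e ∘ suc ∘ (_↑ˡ _)) x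
    located i hs rewrite L (suc (i ↑ˡ _)) hs
      | Fin.splitAt-↑ˡ (positions p) i (positions (q false) + positions (q true)) = refl
    first : Machine.δ M (e zero) (Vec.map Tape.head ts) ≡
            just (e (suc (entry p ↑ˡ _)) , idle (Vec.map Tape.head ts))
    first rewrite L zero (Vec.map Tape.head ts)
      | read-[] {ts = ts} {σ} R (register≤ r (registers p ⊔ (registers (q false) ⊔ registers (q true))) ≤S) f = refl
  simulate {σ = σ} ≤S (case∷ {r} {p} {q} b w f z) {e} {x} {ts} L R =
    let us , R₁ , l₁ = simulate-bit q b located
           (simulate (≤-trans (≤-trans (≤-trans (bit≤ q b) (m≤n⊔m (registers p) _)) (m≤n⊔m (suc r) _)) ≤S) z)
           (represents-pop R r f)
    in us , R₁ , leads-trans (leads-step first) l₁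
    where
    located : ∀ i hs → Machine.δ M (e (suc (positions p ↑ʳ i))) hs ≡
              just (branch (q false) (q true) i hs (e ∘ suc ∘ (positions p ↑ʳ_)) x x)
    located i hs rewrite L (suc (positions p ↑ʳ i)) hs
      | Fin.splitAt-↑ʳ (positions p) (positions (q false) + positions (q true)) i = refl
    first : Machine.δ M (e zero) (Vec.map Tape.head ts) ≡
            just (e (suc (positions p ↑ʳ bitEntry {S} q b)) , popAct r (Vec.map Tape.head ts))
    first rewrite L zero (Vec.map Tape.head ts)
      | read-∷ {ts = ts} {σ} R (register≤ r (registers p ⊔ (registers (q false) ⊔ registers (q true))) ≤S) f = refl
  simulate {σ = σ} ≤S (loop[] {r} {q} f g) {e} {x} {ts} L R =
    ts , represents-≗ g R ,
    subst (Leads _ ts 1 _) (act-idle ts) (leads-step first)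
    where
    first : Machine.δ M (e zero) (Vec.map Tape.head ts) ≡ just (x , idle (Vec.map Tape.head ts))
    first rewrite L zero (Vec.map Tape.head ts)
      | read-[] {ts = ts} {σ} R (register≤ r (registers (q false) ⊔ registers (q true)) ≤S) f = refl
  simulate {σ = σ} ≤S (loop∷ {r} {q} b w f y z) {e} {x} {ts} L R =
    let us , R₁ , l₁ = simulate-bit q b (L ∘ suc)
           (simulate (≤-trans (≤-trans (bit≤ q b) (m≤n⊔m (suc r) _)) ≤S) y)
           (represents-pop R r f)
        vs , R₂ , l₂ = simulate ≤S z L R₁
    in vs , R₂ , leads-trans (leads-step first) (leads-trans l₁ l₂)
    where
    first : Machine.δ M (e zero) (Vec.map Tape.head ts) ≡
            just (e (suc (bitEntry {S} q b)) , popAct r (Vec.map Tape.head ts))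
    first rewrite L zero (Vec.map Tape.head ts)
      | read-∷ {ts = ts} {σ} R (register≤ r (registers (q false) ⊔ registers (q true)) ≤S) f = refl
  simulate ≤S (weaken t≤u z) L R =
    let us , R₁ , l₁ = simulate ≤S z L R
    in us , R₁ , leads λ h → HaltsWithin-weaken (+-monoˡ-≤ _ t≤u) (extend l₁ h)

initialStore : Word → Store
initialStore x zero    = x
initialStore x (suc _) = []

Exec-computes : ∀ p x {t σ} → Exec p (initialStore x) t σ → Computes (compile p) x [] t (σ 0)
Exec-computes p x {t} run =
  let us , R , l = simulate p (m≤n+m _ 2) run {e = suc} {x = zero} (λ _ _ → refl) start-represents
  in config zero us ,
     subst (λ n → HaltsWithin (compile p) (initial (compile p) x []) n (config zero us))
       (+-identityʳ t) (Leads.extend l (halted refl)) ,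
     output-eq us (Represents.at R zero)
  where
  start-represents : Represents (inputTape x ∷ inputTape [] ∷ Vec.replicate (registers p) emptyTape) (initialStore x)
  start-represents = represents λ where
    zero          → Holds-input x
    (suc zero)    → holds (blank [])
    (suc (suc j)) → subst (λ t → Holds t []) (sym (Vec.lookup-replicate j emptyTape)) (holds (blank []))

  output-eq : ∀ us {w} → Holds (lookup us zero) w → output (compile p) (config zero us) ≡ w
  output-eq (tape _ _ _ ∷ _) (holds c) = readBits-cells c

-- Running times of stack programs

infixr 9 _∘ₚ_

_∘ₚ_ : Polynomial → Polynomial → Polynomial
X       ∘ₚ r = r
con c   ∘ₚ r = con c
(p ⊕ q) ∘ₚ r = (p ∘ₚ r) ⊕ (q ∘ₚ r)
(p ⊗ q) ∘ₚ r = (p ∘ₚ r) ⊗ (q ∘ₚ r)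

⟦∘ₚ⟧ : ∀ p r n → ⟦ p ∘ₚ r ⟧ n ≡ ⟦ p ⟧ (⟦ r ⟧ n)
⟦∘ₚ⟧ X       r n = refl
⟦∘ₚ⟧ (con c) r n = refl
⟦∘ₚ⟧ (p ⊕ q) r n = cong₂ _+_ (⟦∘ₚ⟧ p r n) (⟦∘ₚ⟧ q r n)
⟦∘ₚ⟧ (p ⊗ q) r n = cong₂ _*_ (⟦∘ₚ⟧ p r n) (⟦∘ₚ⟧ q r n)

⟦⟧-mono : ∀ p {m n} → m ≤ n → ⟦ p ⟧ m ≤ ⟦ p ⟧ n
⟦⟧-mono X       m≤n = m≤n
⟦⟧-mono (con c) m≤n = ≤-refl
⟦⟧-mono (p ⊕ q) m≤n = +-mono-≤ (⟦⟧-mono p m≤n) (⟦⟧-mono q m≤n)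
⟦⟧-mono (p ⊗ q) m≤n = *-mono-≤ (⟦⟧-mono p m≤n) (⟦⟧-mono q m≤n)

update-same : ∀ (σ : Store) r {w} → (σ [ r ↦ w ]) r ≡ w
update-same σ r with r ≟ r
... | yes _  = refl
... | no r≢r = contradiction refl r≢r

update-other : ∀ (σ : Store) {r s w} → s ≢ r → (σ [ r ↦ w ]) s ≡ σ s
update-other σ {r} {s} s≢r with s ≟ r
... | yes s≡r = contradiction s≡r s≢r
... | no _    = refl

ones : ℕ → Word
ones n = replicate n true

pushes : ℕ → Word → Prog
pushes r []      = skip
pushes r (b ∷ w) = pushes r w ⨾ push r b

move : ℕ → ℕ → Prog
move r s = loop r (push s)

clear : ℕ → Prog
clear r = loop r λ _ → skip

linear : ℕ → ℕ → ℕ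
linear c n = 1 + c * n

linear-step : ∀ c n → suc (c + linear (suc c) n) ≤ linear (suc c) (suc n)
linear-step c n = ≤-reflexive (eq c n)
  where
  eq : ∀ c n → suc (c + (1 + suc c * n)) ≡ 1 + suc c * suc n
  eq = solve-∀

Exec-pushes : ∀ r w {σ v} → σ r ≡ v → Exec (pushes r w) σ (linear 2 (length w)) (σ [ r ↦ w ++ v ])
Exec-pushes r [] {σ} refl = skip λ s → same s
  where
  same : ∀ s → σ s ≡ (σ [ r ↦ σ r ]) s
  same s with s ≟ r
  ... | yes refl = refl
  ... | no _     = refl
Exec-pushes r (b ∷ w) {σ} {v} e = weaken (≤-reflexive (eq (length w))) (Exec-pushes r w e ⨾ push same)
  where
  eq : ∀ n → 1 + 2 * n + 2 ≡ 1 + 2 * suc n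
  eq = solve-∀
  same : ∀ s → (σ [ r ↦ w ++ v ] [ r ↦ b ∷ (σ [ r ↦ w ++ v ]) r ]) s ≡ (σ [ r ↦ b ∷ w ++ v ]) s
  same s with s ≟ r
  ... | yes refl = cong (b ∷_) (update-same σ r)
  ... | no _     = refl

Exec-move : ∀ {r s} → r ≢ s → ∀ w {σ v} → σ r ≡ w → σ s ≡ v →
  Exec (move r s) σ (linear 3 (length w)) (σ [ r ↦ [] ] [ s ↦ w ʳ++ v ])
Exec-move {r} {s} r≢s [] {σ} er refl = loop[] er same
  where
  same : ∀ t → σ t ≡ (σ [ r ↦ [] ] [ s ↦ σ s ]) t
  same t with t ≟ s | t ≟ r
  ... | yes refl | _        = refl
  ... | no _     | yes refl = er
  ... | no _     | no _     = refl
Exec-move {r} {s} r≢s (b ∷ w) {σ} {v} er es =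
  weaken (linear-step 2 (length w))
    (loop∷ b w er (push λ _ → refl)
      (Exec-respʳ same (Exec-move r≢s w
        (trans (update-other σ₁ r≢s) (update-same σ r))
        (trans (update-same σ₁ s) (cong (b ∷_) (trans (update-other σ (r≢s ∘ sym)) es))))))
  where
  σ₁ = σ [ r ↦ w ]
  same : σ₁ [ s ↦ b ∷ σ₁ s ] [ r ↦ [] ] [ s ↦ w ʳ++ (b ∷ v) ] ≗ σ [ r ↦ [] ] [ s ↦ (b ∷ w) ʳ++ v ]
  same t with t ≟ s | t ≟ r
  ... | yes refl | _        = refl
  ... | no _     | yes refl = refl
  ... | no _     | no _     = refl

Exec-clear : ∀ r w {σ} → σ r ≡ w → Exec (clear r) σ (linear 2 (length w)) (σ [ r ↦ [] ])
Exec-clear r [] {σ} er = loop[] er same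
  where
  same : ∀ t → σ t ≡ (σ [ r ↦ [] ]) t
  same t with t ≟ r
  ... | yes refl = er
  ... | no _     = refl
Exec-clear r (b ∷ w) {σ} er =
  weaken (linear-step 1 (length w))
    (loop∷ b w er (skip λ _ → refl) (Exec-respʳ same (Exec-clear r w (update-same σ r))))
  where
  same : σ [ r ↦ w ] [ r ↦ [] ] ≗ σ [ r ↦ [] ]
  same t with t ≟ r
  ... | yes refl = refl
  ... | no _     = refl

move₂ : ℕ → ℕ → ℕ → Prog
move₂ r s u = loop r λ b → push s b ⨾ push u b

Exec-move₂ : ∀ {r s u} → r ≢ s → r ≢ u → s ≢ u → ∀ w {σ v v′} → σ r ≡ w → σ s ≡ v → σ u ≡ v′ →
  Exec (move₂ r s u) σ (linear 5 (length w)) (σ [ r ↦ [] ] [ s ↦ w ʳ++ v ] [ u ↦ w ʳ++ v′ ])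
Exec-move₂ {r} {s} {u} r≢s r≢u s≢u [] {σ} er refl refl = loop[] er same
  where
  same : ∀ t → σ t ≡ (σ [ r ↦ [] ] [ s ↦ σ s ] [ u ↦ σ u ]) t
  same t with t ≟ u | t ≟ s | t ≟ r
  ... | yes refl | _        | _        = refl
  ... | no _     | yes refl | _        = refl
  ... | no _     | no _     | yes refl = er
  ... | no _     | no _     | no _     = refl
Exec-move₂ {r} {s} {u} r≢s r≢u s≢u (b ∷ w) {σ} {v} {v′} er es eu =
  weaken (linear-step 4 (length w))
    (loop∷ b w er (push (λ _ → refl) ⨾ push λ _ → refl)
      (Exec-respʳ same (Exec-move₂ r≢s r≢u s≢u w
        (trans (update-other σ₂ r≢u) (trans (update-other σ₁ r≢s) (update-same σ r)))
        (trans (update-other σ₂ s≢u) (trans (update-same σ₁ s) (cong (b ∷_) (trans (update-other σ (r≢s ∘ sym)) es))))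
        (trans (update-same σ₂ u) (cong (b ∷_)
          (trans (update-other σ₁ (s≢u ∘ sym)) (trans (update-other σ (r≢u ∘ sym)) eu)))))))
  where
  σ₁ = σ [ r ↦ w ]
  σ₂ = σ₁ [ s ↦ b ∷ σ₁ s ]
  same : σ₂ [ u ↦ b ∷ σ₂ u ] [ r ↦ [] ] [ s ↦ w ʳ++ (b ∷ v) ] [ u ↦ w ʳ++ (b ∷ v′) ] ≗
         σ [ r ↦ [] ] [ s ↦ (b ∷ w) ʳ++ v ] [ u ↦ (b ∷ w) ʳ++ v′ ]
  same t with t ≟ u | t ≟ s | t ≟ r
  ... | yes refl | _        | _        = refl
  ... | no _     | yes refl | _        = refl
  ... | no _     | no _     | yes refl = refl
  ... | no _     | no _     | no _     = refl

discard : ℕ → ℕ → Prog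
discard r s = loop r λ _ → case s skip λ _ → skip

Exec-discard : ∀ {r s} → r ≢ s → ∀ w v {σ} → σ r ≡ w → σ s ≡ v →
  Exec (discard r s) σ (linear 3 (length w)) (σ [ r ↦ [] ] [ s ↦ List.drop (length w) v ])
Exec-discard {r} {s} r≢s [] v {σ} er refl = loop[] er same
  where
  same : ∀ t → σ t ≡ (σ [ r ↦ [] ] [ s ↦ σ s ]) t
  same t with t ≟ s | t ≟ r
  ... | yes refl | _        = refl
  ... | no _     | yes refl = er
  ... | no _     | no _     = refl
Exec-discard {r} {s} r≢s (b ∷ w) [] {σ} er es =
  weaken (linear-step 2 (length w))
    (loop∷ b w er (case[] (trans (update-other σ (r≢s ∘ sym)) es) (skip λ _ → refl))
      (Exec-respʳ same (Exec-discard r≢s w [] (update-same σ r) (trans (update-other σ (r≢s ∘ sym)) es))))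
  where
  drop-[] : ∀ n → List.drop n [] ≡ ([] {A = Bool})
  drop-[] zero    = refl
  drop-[] (suc n) = refl
  same : σ [ r ↦ w ] [ r ↦ [] ] [ s ↦ List.drop (length w) [] ] ≗ σ [ r ↦ [] ] [ s ↦ [] ]
  same t with t ≟ s | t ≟ r
  ... | yes refl | _        = drop-[] (length w)
  ... | no _     | yes refl = refl
  ... | no _     | no _     = refl
Exec-discard {r} {s} r≢s (b ∷ w) (c ∷ v) {σ} er es =
  weaken (linear-step 2 (length w))
    (loop∷ b w er (case∷ c v (trans (update-other σ (r≢s ∘ sym)) es) (skip λ _ → refl))
      (Exec-respʳ same (Exec-discard r≢s w v
        (trans (update-other (σ [ r ↦ w ]) r≢s) (update-same σ r)) (update-same (σ [ r ↦ w ]) s))))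
  where
  same : σ [ r ↦ w ] [ s ↦ v ] [ r ↦ [] ] [ s ↦ List.drop (length w) v ] ≗ σ [ r ↦ [] ] [ s ↦ List.drop (length w) v ]
  same t with t ≟ s | t ≟ r
  ... | yes refl | _        = refl
  ... | no _     | yes refl = refl
  ... | no _     | no _     = refl

-- Conversion from unary to binary

parity : ℕ → Word
parity zero          = []
parity (suc zero)    = true ∷ []
parity (suc (suc n)) = parity n

-- `p` is a toggle: every odd-numbered bit of `a` fills it, every even-numbered one empties it and
-- adds one to `q`. What it holds in the end is the parity.
halve : ℕ → ℕ → ℕ → Prog
halve a q p = loop a λ _ → case p (push p true) λ _ → push q true

module _ {a q p : ℕ} (a≢q : a ≢ q) (a≢p : a ≢ p) (q≢p : q ≢ p) where

  Exec-halve : ∀ w m {σ} → σ a ≡ w → σ q ≡ ones m → σ p ≡ [] →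
    Exec (halve a q p) σ (linear 4 (length w))
      (σ [ a ↦ [] ] [ q ↦ ones (m + ⌊ length w /2⌋) ] [ p ↦ parity (length w) ])
  Exec-halve [] m {σ} ea eq ep = loop[] ea same
    where
    same : σ ≗ σ [ a ↦ [] ] [ q ↦ ones (m + 0) ] [ p ↦ [] ]
    same t with t ≟ p | t ≟ q | t ≟ a
    ... | yes refl | _        | _        = ep
    ... | no _     | yes refl | _        = trans eq (cong ones (sym (+-identityʳ m)))
    ... | no _     | no _     | yes refl = ea
    ... | no _     | no _     | no _     = refl
  Exec-halve (b ∷ []) m {σ} ea eq ep =
    loop∷ b [] ea
      (case[] (trans (update-other σ (a≢p ∘ sym)) ep) (push λ _ → refl))
      (loop[] (trans (update-other σ₁ a≢p) (update-same σ a)) same)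
    where
    σ₁ = σ [ a ↦ [] ]
    same : σ₁ [ p ↦ true ∷ σ₁ p ] ≗ σ [ a ↦ [] ] [ q ↦ ones (m + 0) ] [ p ↦ true ∷ [] ]
    same t with t ≟ p | t ≟ q | t ≟ a
    ... | yes refl | _        | _        = cong (true ∷_) (trans (update-other σ (a≢p ∘ sym)) ep)
    ... | no _     | yes refl | yes refl = contradiction refl a≢q
    ... | no _     | yes refl | no _     = trans eq (cong ones (sym (+-identityʳ m)))
    ... | no _     | no _     | yes refl = refl
    ... | no _     | no _     | no _     = refl
  Exec-halve (b ∷ c ∷ w) m {σ} ea eq ep =
    weaken (≤-reflexive (cost (length w)))
      (loop∷ b (c ∷ w) ea
        (case[] (trans (update-other σ (a≢p ∘ sym)) ep) (push λ _ → refl))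
        (loop∷ c w (trans (update-other σ₁ a≢p) (update-same σ a))
          (case∷ true [] (trans (update-other σ₂ (a≢p ∘ sym))
            (trans (update-same σ₁ p) (cong (true ∷_) (trans (update-other σ (a≢p ∘ sym)) ep))))
            (push λ _ → refl))
          (Exec-respʳ same (Exec-halve w (suc m) ea′ eq′
            (trans (update-other σ₄ (q≢p ∘ sym)) (update-same σ₃ p))))))
    where
    cost : ∀ n → suc (3 + suc (3 + (1 + 4 * n))) ≡ 1 + 4 * suc (suc n)
    cost = solve-∀
    σ₁ = σ [ a ↦ c ∷ w ]
    σ₂ = σ₁ [ p ↦ true ∷ σ₁ p ]
    σ₃ = σ₂ [ a ↦ w ]
    σ₄ = σ₃ [ p ↦ [] ]
    σ₅ = σ₄ [ q ↦ true ∷ σ₄ q ]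
    ea′ : σ₅ a ≡ w
    ea′ = trans (update-other σ₄ a≢q) (trans (update-other σ₃ a≢p) (update-same σ₂ a))
    eq′ : σ₅ q ≡ ones (suc m)
    eq′ = trans (update-same σ₄ q) (cong (true ∷_)
      (trans (update-other σ₃ q≢p) (trans (update-other σ₂ (a≢q ∘ sym))
        (trans (update-other σ₁ q≢p) (trans (update-other σ (a≢q ∘ sym)) eq)))))
    same : σ₅ [ a ↦ [] ] [ q ↦ ones (suc m + ⌊ length w /2⌋) ] [ p ↦ parity (length w) ] ≗
           σ [ a ↦ [] ] [ q ↦ ones (m + suc ⌊ length w /2⌋) ] [ p ↦ parity (length w) ]
    same t with t ≟ p | t ≟ q | t ≟ a
    ... | yes refl | _        | _        = refl
    ... | no _     | yes refl | _        = cong ones (sym (+-suc m _))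
    ... | no _     | no _     | yes refl = refl
    ... | no _     | no _     | no _     = refl

digits : ℕᵇ → Word
digits 0ᵇ       = []
digits 2[1+ n ] = false ∷ digits n
digits 1+[2 n ] = true ∷ digits n

halving : ∀ n → n ≡ ⌊ n /2⌋ + ⌊ n /2⌋ + length (parity n)
halving zero          = refl
halving (suc zero)    = refl
halving (suc (suc n)) = cong suc (trans (cong suc (halving n)) (shift ⌊ n /2⌋ (length (parity n))))
  where
  shift : ∀ k l → suc (k + k + l) ≡ k + suc k + l
  shift = solve-∀

-- In bijective binary, whose digits are 1 and 2, `suc n` is `1 + 2 ⌊n/2⌋` for even `n` and
-- `2 (1 + ⌊n/2⌋)` for odd `n`. So the parity of the predecessor gives the lowest digit, and `⌊n/2⌋`
-- the others.
digits-even : ∀ n → parity n ≡ [] → digits (fromℕ (suc n)) ≡ true ∷ digits (fromℕ ⌊ n /2⌋)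
digits-even n e = cong digits {y = 1+[2 fromℕ ⌊ n /2⌋ ]} (ℕᵇ.toℕ-injective (trans (ℕᵇ.toℕ-fromℕ (suc n)) (cong suc
  (trans (trans (halving n) (cong (λ w → ⌊ n /2⌋ + ⌊ n /2⌋ + length w) e)) (trans (double ⌊ n /2⌋)
    (cong (2 *_) (sym (ℕᵇ.toℕ-fromℕ ⌊ n /2⌋))))))))
  where
  double : ∀ k → k + k + 0 ≡ 2 * k
  double = solve-∀

digits-odd : ∀ n → parity n ≡ true ∷ [] → digits (fromℕ (suc n)) ≡ false ∷ digits (fromℕ ⌊ n /2⌋)
digits-odd n e = cong digits {y = 2[1+ fromℕ ⌊ n /2⌋ ]} (ℕᵇ.toℕ-injective (trans (ℕᵇ.toℕ-fromℕ (suc n))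
  (trans (cong suc (trans (halving n) (cong (λ w → ⌊ n /2⌋ + ⌊ n /2⌋ + length w) e)))
    (trans (double ⌊ n /2⌋) (cong (λ k → 2 * suc k) (sym (ℕᵇ.toℕ-fromℕ ⌊ n /2⌋)))))))
  where
  double : ∀ k → suc (k + k + 1) ≡ 2 * suc k
  double = solve-∀

parity-cases : ∀ n → parity n ≡ [] ⊎ parity n ≡ true ∷ []
parity-cases zero          = inj₁ refl
parity-cases (suc zero)    = inj₂ refl
parity-cases (suc (suc n)) = parity-cases n

-- The pop that starts each round is the passage from `suc n` to `n` in `digits-even` and
-- `digits-odd`.
toDigits : ℕ → ℕ → ℕ → ℕ → Prog
toDigits a q p d = loop a λ _ →
  halve a q p ⨾ case p (push d true) (λ _ → push d false) ⨾ move q a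

length-ones : ∀ n → length (ones n) ≡ n
length-ones n = List.length-replicate n

length-ones-ʳ++ : ∀ n → length (ones n ʳ++ []) ≡ n
length-ones-ʳ++ n = trans (List.length-ʳ++ (ones n)) (trans (+-identityʳ _) (length-ones n))

module _ {a q p d : ℕ} (a≢q : a ≢ q) (a≢p : a ≢ p) (q≢p : q ≢ p)
         (a≢d : a ≢ d) (q≢d : q ≢ d) (p≢d : p ≢ d) where

  -- Quadratic although the lengths halve from round to round: this way the induction uses no more
  -- about the half than that it is at most `n`.
  digitsCost : ℕ → ℕ
  digitsCost n = 1 + n * (7 * n + 6)

  -- `k` bounds the recursion, since the halved word is no part of `w`.
  Exec-toDigits : ∀ k w {u σ} → length w ≤ k → σ a ≡ w → σ q ≡ [] → σ p ≡ [] → σ d ≡ u →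
    Exec (toDigits a q p d) σ (digitsCost (length w))
      (σ [ a ↦ [] ] [ d ↦ digits (fromℕ (length w)) ʳ++ u ])
  Exec-toDigits k [] {u} {σ} _ ea eq ep ed = loop[] ea same
    where
    same : σ ≗ σ [ a ↦ [] ] [ d ↦ u ]
    same t with t ≟ d | t ≟ a
    ... | yes refl | _        = ed
    ... | no _     | yes refl = ea
    ... | no _     | no _     = refl
  Exec-toDigits (suc k) (b ∷ w) {u} {σ} (s≤s w≤k) ea eq ep ed =
    weaken (cost n ⌊ n /2⌋ (⌊n/2⌋≤n n))
      (loop∷ b w ea
        (Exec-halve a≢q a≢p q≢p w 0 (update-same σ a)
           (trans (update-other σ (a≢q ∘ sym)) eq) (trans (update-other σ (a≢p ∘ sym)) ep)
         ⨾ select (parity-cases n)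
         ⨾ weaken (≤-reflexive (cong (linear 3) (length-ones ⌊ n /2⌋)))
             (Exec-move (a≢q ∘ sym) (ones ⌊ n /2⌋) qd ad))
        (Exec-respʳ final (weaken (≤-reflexive (cong digitsCost (length-ones-ʳ++ ⌊ n /2⌋)))
          (Exec-toDigits k h (≤-trans (≤-trans (≤-reflexive (length-ones-ʳ++ ⌊ n /2⌋)) (⌊n/2⌋≤n n)) w≤k)
            (update-same σ₃ a)
            (trans (update-other σ₃ (a≢q ∘ sym)) (update-same σ₂′ q))
            pd′ dd′))))
    where
    n = length w
    h = ones ⌊ n /2⌋ ʳ++ []
    first : Bool
    first = is-nothing (List.head (parity n))
    σ₁ = σ [ a ↦ w ]
    σ₂ = σ₁ [ a ↦ [] ] [ q ↦ ones ⌊ n /2⌋ ] [ p ↦ parity n ]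
    σ₂′ = σ₂ [ p ↦ [] ] [ d ↦ first ∷ u ]
    σ₃ = σ₂′ [ q ↦ [] ]
    σ₄ = σ₃ [ a ↦ h ]
    d₂ : σ₂ d ≡ u
    d₂ = trans (update-other (σ₁ [ a ↦ [] ] [ q ↦ ones ⌊ n /2⌋ ]) (p≢d ∘ sym))
           (trans (update-other (σ₁ [ a ↦ [] ]) (q≢d ∘ sym))
             (trans (update-other σ₁ (a≢d ∘ sym)) (trans (update-other σ (a≢d ∘ sym)) ed)))
    p₂ : σ₂ p ≡ parity n
    p₂ = update-same (σ₁ [ a ↦ [] ] [ q ↦ ones ⌊ n /2⌋ ]) p
    qd : σ₂′ q ≡ ones ⌊ n /2⌋
    qd = trans (update-other (σ₂ [ p ↦ [] ]) q≢d) (trans (update-other σ₂ q≢p)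
           (trans (update-other (σ₁ [ a ↦ [] ] [ q ↦ ones ⌊ n /2⌋ ]) q≢p) (update-same (σ₁ [ a ↦ [] ]) q)))
    ad : σ₂′ a ≡ []
    ad = trans (update-other (σ₂ [ p ↦ [] ]) a≢d) (trans (update-other σ₂ a≢p)
           (trans (update-other (σ₁ [ a ↦ [] ] [ q ↦ ones ⌊ n /2⌋ ]) a≢p)
             (trans (update-other (σ₁ [ a ↦ [] ]) a≢q) (update-same σ₁ a))))
    pd′ : σ₄ p ≡ []
    pd′ = trans (update-other σ₃ (a≢p ∘ sym)) (trans (update-other σ₂′ (q≢p ∘ sym))
            (trans (update-other (σ₂ [ p ↦ [] ]) p≢d) (update-same σ₂ p)))
    dd′ : σ₄ d ≡ first ∷ u
    dd′ = trans (update-other σ₃ (a≢d ∘ sym)) (trans (update-other σ₂′ (q≢d ∘ sym)) (update-same (σ₂ [ p ↦ [] ]) d))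

    select : parity n ≡ [] ⊎ parity n ≡ true ∷ [] →
      Exec (case p (push d true) λ _ → push d false) σ₂ 3 σ₂′
    select (inj₁ e) = case[] (trans p₂ e) (push same)
      where
      same : σ₂ [ d ↦ true ∷ σ₂ d ] ≗ σ₂′
      same t with t ≟ d | t ≟ p
      ... | yes refl | _        = cong₂ _∷_ (cong (is-nothing ∘ List.head) (sym e)) d₂
      ... | no _     | yes refl = e
      ... | no _     | no _     = refl
    select (inj₂ e) = case∷ true [] (trans p₂ e) (push same)
      where
      same : σ₂ [ p ↦ [] ] [ d ↦ false ∷ (σ₂ [ p ↦ [] ]) d ] ≗ σ₂′
      same t with t ≟ d
      ... | yes refl = cong₂ _∷_ (cong (is-nothing ∘ List.head) (sym e)) (trans (update-other σ₂ (p≢d ∘ sym)) d₂)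
      ... | no _     = refl

    digits-first : parity n ≡ [] ⊎ parity n ≡ true ∷ [] →
      first ∷ digits (fromℕ ⌊ n /2⌋) ≡ digits (fromℕ (suc n))
    digits-first (inj₁ e) = trans (cong (λ w → is-nothing (List.head w) ∷ digits (fromℕ ⌊ n /2⌋)) e) (sym (digits-even n e))
    digits-first (inj₂ e) = trans (cong (λ w → is-nothing (List.head w) ∷ digits (fromℕ ⌊ n /2⌋)) e) (sym (digits-odd n e))

    final : σ₄ [ a ↦ [] ] [ d ↦ digits (fromℕ (length h)) ʳ++ (first ∷ u) ] ≗
            σ [ a ↦ [] ] [ d ↦ digits (fromℕ (suc n)) ʳ++ u ]
    final t with t ≟ d | t ≟ a | t ≟ q | t ≟ p
    ... | yes refl | _        | _        | _        =
      trans (cong (λ k → digits (fromℕ k) ʳ++ (first ∷ u)) (length-ones-ʳ++ ⌊ n /2⌋))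
            (cong (_ʳ++ u) (digits-first (parity-cases n)))
    ... | no _     | yes refl | _        | _        = refl
    ... | no _     | no _     | yes refl | _        = sym eq
    ... | no _     | no _     | no _     | yes refl = sym ep
    ... | no _     | no _     | no _     | no _     = refl

    cost : ∀ n h → h ≤ n → suc ((1 + 4 * n + (3 + (1 + 3 * h))) + digitsCost h) ≤ digitsCost (suc n)
    cost n h h≤n = begin
      suc ((1 + 4 * n + (3 + (1 + 3 * h))) + digitsCost h)
        ≤⟨ s≤s (+-mono-≤ (+-monoʳ-≤ (1 + 4 * n) (s≤s (s≤s (s≤s (s≤s (*-monoʳ-≤ 3 h≤n))))))
             (s≤s (*-mono-≤ h≤n (+-monoˡ-≤ 6 (*-monoʳ-≤ 7 h≤n))))) ⟩
      suc ((1 + 4 * n + (3 + (1 + 3 * n))) + digitsCost n)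
        ≤⟨ m≤m+n _ (7 + 7 * n) ⟩
      suc ((1 + 4 * n + (3 + (1 + 3 * n))) + (1 + n * (7 * n + 6))) + (7 + 7 * n)
        ≡⟨ expand n ⟩
      digitsCost (suc n) ∎
      where
      open ≤-Reasoning
      expand : ∀ n → suc ((1 + 4 * n + (3 + (1 + 3 * n))) + (1 + n * (7 * n + 6))) + (7 + 7 * n)
                     ≡ 1 + suc n * (7 * suc n + 6)
      expand = solve-∀

emitDigits : ℕ → ℕ → Prog
emitDigits d t = loop d λ b → push t b ⨾ push t true

addDigit : Word → Bool → Word
addDigit w b = true ∷ b ∷ w

Exec-emitDigits : ∀ {d t} → d ≢ t → ∀ u {v σ} → σ d ≡ u → σ t ≡ v →
  Exec (emitDigits d t) σ (linear 5 (length u)) (σ [ d ↦ [] ] [ t ↦ List.foldl addDigit v u ])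
Exec-emitDigits {d} {t} d≢t [] {v} {σ} ed et = loop[] ed same
  where
  same : σ ≗ σ [ d ↦ [] ] [ t ↦ v ]
  same s with s ≟ t | s ≟ d
  ... | yes refl | _        = et
  ... | no _     | yes refl = ed
  ... | no _     | no _     = refl
Exec-emitDigits {d} {t} d≢t (b ∷ u) {v} {σ} ed et =
  weaken (linear-step 4 (length u))
    (loop∷ b u ed (push (λ _ → refl) ⨾ push λ _ → refl)
      (Exec-respʳ same (Exec-emitDigits d≢t u
        (trans (update-other σ₂ d≢t) (trans (update-other σ₁ d≢t) (update-same σ d)))
        (trans (update-same σ₂ t) (cong (true ∷_) (trans (update-same σ₁ t)
          (cong (b ∷_) (trans (update-other σ (d≢t ∘ sym)) et))))))))
  where
  σ₁ = σ [ d ↦ u ]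
  σ₂ = σ₁ [ t ↦ b ∷ σ₁ t ]
  same : σ₂ [ t ↦ true ∷ σ₂ t ] [ d ↦ [] ] [ t ↦ List.foldl addDigit (addDigit v b) u ] ≗
         σ [ d ↦ [] ] [ t ↦ List.foldl addDigit v (b ∷ u) ]
  same s with s ≟ t | s ≟ d
  ... | yes refl | _        = refl
  ... | no _     | yes refl = refl
  ... | no _     | no _     = refl

-- `toDigits` leaves the highest digit on top, and pushing the digits from there puts the lowest one
-- in front, where `encodeℕ` has it. The `false` pushed beforehand is the end mark.
emitted : ∀ m v → List.foldl addDigit (false ∷ v) (digits m ʳ++ []) ≡ encodeℕᵇ m ++ v
emitted m v = trans (List.foldl-ʳ++ addDigit (false ∷ v) (digits m)) (spell m)
  where
  spell : ∀ m → foldr (λ b w → addDigit w b) (false ∷ v) (digits m) ≡ encodeℕᵇ m ++ v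
  spell 0ᵇ       = refl
  spell 2[1+ m ] = cong (λ w → true ∷ false ∷ w) (spell m)
  spell 1+[2 m ] = cong (λ w → true ∷ true ∷ w) (spell m)

length-digits : ∀ n → length (digits (fromℕ n)) ≤ n
length-digits n = subst (length (digits (fromℕ n)) ≤_) (ℕᵇ.toℕ-fromℕ n) (bound (fromℕ n))
  where
  bound : ∀ m → length (digits m) ≤ toℕᵇ m
  bound 0ᵇ       = z≤n
  bound 2[1+ m ] = ≤-trans (s≤s (bound m)) (m≤m+n _ _)
  bound 1+[2 m ] = s≤s (≤-trans (bound m) (m≤m+n _ _))

toBinary : ℕ → ℕ → Prog
toBinary f t = toDigits f (1 + f) (2 + f) (3 + f) ⨾ push t false ⨾ emitDigits (3 + f) t

binaryCost : Polynomial
binaryCost = (con 1 ⊕ (X ⊗ ((con 7 ⊗ X) ⊕ con 6))) ⊕ (con 2 ⊕ (con 1 ⊕ (con 5 ⊗ X)))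

fresh≢ : ∀ {m n} k → m < n → k + n ≢ m
fresh≢ k m<n eq = <⇒≢ (≤-trans m<n (m≤n+m _ k)) (sym eq)

Exec-toBinary : ∀ {f t} → t < f → ∀ w {v σ} → σ f ≡ w → (∀ r → f < r → σ r ≡ []) → σ t ≡ v →
  Exec (toBinary f t) σ (⟦ binaryCost ⟧ (length w)) (σ [ f ↦ [] ] [ t ↦ encodeℕ (length w) ++ v ])
Exec-toBinary {f} {t} t<f w {v} {σ} ef fresh et =
  weaken (+-monoʳ-≤ (digitsCost′ (length w)) (s≤s (s≤s (s≤s (*-monoʳ-≤ 5 length-d)))))
    (Exec-toDigits f≢1 f≢2 1≢2 f≢3 1≢3 2≢3 (length w) w ≤-refl ef
       (fresh (1 + f) ≤-refl) (fresh (2 + f) (m≤n+m _ 1)) (fresh (3 + f) (m≤n+m _ 2))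
     ⨾ push same₁
     ⨾ Exec-respʳ same₂ (Exec-emitDigits (fresh≢ 3 t<f) D
         (trans (update-other σ₁ (fresh≢ 3 t<f)) (update-same (σ [ f ↦ [] ]) (3 + f)))
         (update-same σ₁ t)))
  where
  digitsCost′ : ℕ → ℕ
  digitsCost′ n = 1 + n * (7 * n + 6)
  gap : ∀ {k} n → n ≢ suc k + n
  gap n = <⇒≢ (m<n+m n z<s)
  f≢1 = gap {0} f
  f≢2 = gap {1} f
  f≢3 = gap {2} f
  1≢2 = gap {0} (1 + f)
  1≢3 = gap {1} (1 + f)
  2≢3 = gap {0} (2 + f)
  m = fromℕ (length w)
  D = digits m ʳ++ []
  length-d : length D ≤ length w
  length-d = ≤-trans (≤-reflexive (trans (List.length-ʳ++ (digits m)) (+-identityʳ _))) (length-digits (length w))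
  σ₁ = σ [ f ↦ [] ] [ 3 + f ↦ D ]
  same₁ : σ₁ [ t ↦ false ∷ σ₁ t ] ≗ σ₁ [ t ↦ false ∷ v ]
  same₁ s with s ≟ t
  ... | yes refl = cong (false ∷_) (trans (update-other (σ [ f ↦ [] ]) (fresh≢ 3 t<f ∘ sym))
                     (trans (update-other σ (fresh≢ 0 t<f ∘ sym)) et))
  ... | no _     = refl
  same₂ : σ₁ [ t ↦ false ∷ v ] [ 3 + f ↦ [] ] [ t ↦ List.foldl addDigit (false ∷ v) D ] ≗
          σ [ f ↦ [] ] [ t ↦ encodeℕ (length w) ++ v ]
  same₂ s with s ≟ t | s ≟ (3 + f) | s ≟ f
  ... | yes refl | _        | _        = emitted m v
  ... | no _     | yes refl | yes e    = contradiction (sym e) f≢3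
  ... | no _     | yes refl | no _     = sym (fresh (3 + f) (m≤n+m _ 2))
  ... | no _     | no _     | yes refl = refl
  ... | no _     | no _     | no _     = refl

-- Word functions computable in polynomial time

-- A language for polynomial-time word functions. A word also stands for its
-- length: num and drop look only at the length of their (first) argument.

infixr 5 _⊹_

data Gen (k : ℕ) : Set where
  lit  : Word → Gen k
  var  : Fin k → Gen k
  _⊹_  : Gen k → Gen k → Gen k
  num  : Gen k → Gen k
  drop : Gen k → Gen k → Gen k
  case : Gen k → Gen k → (Bool → Gen k) → Gen k
  for  : Gen k → Gen (suc k) → Gen k

-- The body sees the rest of the word, whose length counts down. Since a program puts its output in
-- front of what is there already, the pieces end up in order of increasing length, as if indexed
-- from 0 upwards.
forWord : Word → (Word → Word) → Word
forWord []      body = []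
forWord (b ∷ w) body = forWord w body ++ body w

caseWord : Word → Word → (Bool → Word) → Word
caseWord []      u v = u
caseWord (b ∷ _) u v = v b

⟦_⟧ᴳ : ∀ {k} → Gen k → Vec Word k → Word
⟦ lit w ⟧ᴳ      ρ = w
⟦ var i ⟧ᴳ      ρ = lookup ρ i
⟦ g ⊹ h ⟧ᴳ      ρ = ⟦ g ⟧ᴳ ρ ++ ⟦ h ⟧ᴳ ρ
⟦ num g ⟧ᴳ      ρ = encodeℕ (length (⟦ g ⟧ᴳ ρ))
⟦ drop g h ⟧ᴳ   ρ = List.drop (length (⟦ g ⟧ᴳ ρ)) (⟦ h ⟧ᴳ ρ)
⟦ case g u v ⟧ᴳ ρ = caseWord (⟦ g ⟧ᴳ ρ) (⟦ u ⟧ᴳ ρ) (λ b → ⟦ v b ⟧ᴳ ρ)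
⟦ for g h ⟧ᴳ    ρ = forWord (⟦ g ⟧ᴳ ρ) (λ w → ⟦ h ⟧ᴳ (w ∷ ρ))

-- `X` bounds the lengths of all variables at once. A loop variable may be as long as the output of
-- `g`, hence the substitution of `X ⊕ sizeᴳ g` for `for`.
sizeᴳ : ∀ {k} → Gen k → Polynomial
sizeᴳ (lit w)      = con (length w)
sizeᴳ (var i)      = X
sizeᴳ (g ⊹ h)      = sizeᴳ g ⊕ sizeᴳ h
sizeᴳ (num g)      = con 1 ⊕ (con 2 ⊗ sizeᴳ g)
sizeᴳ (drop g h)   = sizeᴳ h
sizeᴳ (case g u v) = sizeᴳ u ⊕ (sizeᴳ (v false) ⊕ sizeᴳ (v true))
sizeᴳ (for g h)    = sizeᴳ g ⊗ (sizeᴳ h ∘ₚ (X ⊕ sizeᴳ g))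

costᴳ : ∀ {k} → Gen k → Polynomial
costᴳ (lit w)      = con (linear 2 (length w))
costᴳ (var i)      = (con 1 ⊕ (con 3 ⊗ X)) ⊕ (con 1 ⊕ (con 5 ⊗ X))
costᴳ (g ⊹ h)      = costᴳ h ⊕ costᴳ g
costᴳ (num g)      = costᴳ g ⊕ (binaryCost ∘ₚ sizeᴳ g)
costᴳ (drop g h)   = costᴳ g ⊕ (costᴳ h ⊕ ((con 1 ⊕ (con 3 ⊗ sizeᴳ g)) ⊕
                     ((con 1 ⊕ (con 3 ⊗ sizeᴳ h)) ⊕ (con 1 ⊕ (con 3 ⊗ sizeᴳ h)))))
costᴳ (case g u v) = costᴳ g ⊕ (con 1 ⊕ (costᴳ u ⊕ ((con 1 ⊕ (con 2 ⊗ sizeᴳ g)) ⊕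
                     (costᴳ (v false) ⊕ costᴳ (v true)))))
costᴳ (for g h)    = costᴳ g ⊕ (con 1 ⊕ (sizeᴳ g ⊗ (con 1 ⊕ (costᴳ h ∘ₚ (X ⊕ sizeᴳ g)))))

length-encodeℕ : ∀ n → length (encodeℕ n) ≤ 1 + 2 * n
length-encodeℕ n = subst (λ k → length (encodeℕ n) ≤ 1 + 2 * k) (ℕᵇ.toℕ-fromℕ n) (bound (fromℕ n))
  where
  open ≤-Reasoning
  bound : ∀ m → length (encodeℕᵇ m) ≤ 1 + 2 * toℕᵇ m
  bound 0ᵇ       = ≤-refl
  bound 2[1+ m ] = begin
    2 + length (encodeℕᵇ m)         ≤⟨ +-monoʳ-≤ 2 (bound m) ⟩
    2 + (1 + 2 * toℕᵇ m)            ≤⟨ m≤m+n _ (2 + 2 * toℕᵇ m) ⟩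
    2 + (1 + 2 * toℕᵇ m) + (2 + 2 * toℕᵇ m)  ≡⟨ eq (toℕᵇ m) ⟩
    1 + 2 * (2 * suc (toℕᵇ m))      ∎
    where
    eq : ∀ k → 2 + (1 + 2 * k) + (2 + 2 * k) ≡ 1 + 2 * (2 * suc k)
    eq = solve-∀
  bound 1+[2 m ] = begin
    2 + length (encodeℕᵇ m)         ≤⟨ +-monoʳ-≤ 2 (bound m) ⟩
    2 + (1 + 2 * toℕᵇ m)            ≤⟨ m≤m+n _ (2 * toℕᵇ m) ⟩
    2 + (1 + 2 * toℕᵇ m) + 2 * toℕᵇ m  ≡⟨ eq (toℕᵇ m) ⟩
    1 + 2 * suc (2 * toℕᵇ m)        ∎
    where
    eq : ∀ k → 2 + (1 + 2 * k) + 2 * k ≡ 1 + 2 * suc (2 * k)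
    eq = solve-∀

Bounded : ∀ {k} → ℕ → Vec Word k → Set
Bounded m ρ = ∀ i → length (lookup ρ i) ≤ m

Bounded-∷ : ∀ {k m n} {w : Word} {ρ : Vec Word k} → length w ≤ n → Bounded m ρ → Bounded (m + n) (w ∷ ρ)
Bounded-∷ {m = m} w≤n ρ≤m zero    = ≤-trans w≤n (m≤n+m _ m)
Bounded-∷ {m = m} w≤n ρ≤m (suc i) = ≤-trans (ρ≤m i) (m≤m+n m _)

length-caseWord : ∀ w {u v k l₀ l₁} → length u ≤ k → length (v false) ≤ l₀ → length (v true) ≤ l₁ →
  length (caseWord w u v) ≤ k + (l₀ + l₁)
length-caseWord []          u≤ v₀≤ v₁≤ = ≤-trans u≤ (m≤m+n _ _)
length-caseWord (false ∷ _) {k = k}      u≤ v₀≤ v₁≤ = ≤-trans (≤-trans v₀≤ (m≤m+n _ _)) (m≤n+m _ k)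
length-caseWord (true ∷ _)  {k = k} {l₀} u≤ v₀≤ v₁≤ = ≤-trans (≤-trans v₁≤ (m≤n+m _ l₀)) (m≤n+m _ k)

length-forWord : ∀ w {body l} → (∀ u → length u ≤ length w → length (body u) ≤ l) →
  length (forWord w body) ≤ length w * l
length-forWord []      h = z≤n
length-forWord (b ∷ w) {body} {l} h = begin
  length (forWord w body ++ body w)          ≡⟨ List.length-++ (forWord w body) ⟩
  length (forWord w body) + length (body w)  ≤⟨ +-mono-≤ (length-forWord w λ u u≤w → h u (m≤n⇒m≤1+n u≤w))
                                                  (h w (n≤1+n _)) ⟩
  length w * l + l                           ≡⟨ +-comm _ l ⟩
  l + length w * l                           ∎
  where open ≤-Reasoning

length-⟦⟧ᴳ : ∀ {k} (g : Gen k) {ρ m} → Bounded m ρ → length (⟦ g ⟧ᴳ ρ) ≤ ⟦ sizeᴳ g ⟧ m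
length-⟦⟧ᴳ (lit w)      ρ≤m = ≤-refl
length-⟦⟧ᴳ (var i)      ρ≤m = ρ≤m i
length-⟦⟧ᴳ (g ⊹ h) {ρ}  ρ≤m = ≤-trans (≤-reflexive (List.length-++ (⟦ g ⟧ᴳ ρ)))
                                (+-mono-≤ (length-⟦⟧ᴳ g ρ≤m) (length-⟦⟧ᴳ h ρ≤m))
length-⟦⟧ᴳ (num g) {ρ}  ρ≤m = ≤-trans (length-encodeℕ (length (⟦ g ⟧ᴳ ρ)))
                                (s≤s (*-monoʳ-≤ 2 (length-⟦⟧ᴳ g ρ≤m)))
length-⟦⟧ᴳ (drop g h) {ρ} ρ≤m = ≤-trans (≤-reflexive (List.length-drop (length (⟦ g ⟧ᴳ ρ)) (⟦ h ⟧ᴳ ρ)))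
                                  (≤-trans (m∸n≤m (length (⟦ h ⟧ᴳ ρ)) (length (⟦ g ⟧ᴳ ρ))) (length-⟦⟧ᴳ h ρ≤m))
length-⟦⟧ᴳ (case g u v) {ρ} ρ≤m =
  length-caseWord (⟦ g ⟧ᴳ ρ) (length-⟦⟧ᴳ u ρ≤m) (length-⟦⟧ᴳ (v false) ρ≤m) (length-⟦⟧ᴳ (v true) ρ≤m)
length-⟦⟧ᴳ (for g h) {ρ} {m} ρ≤m =
  ≤-trans (length-forWord (⟦ g ⟧ᴳ ρ) λ u u≤w →
             ≤-trans (length-⟦⟧ᴳ h (Bounded-∷ (≤-trans u≤w (length-⟦⟧ᴳ g ρ≤m)) ρ≤m))
                     (≤-reflexive (sym (⟦∘ₚ⟧ (sizeᴳ h) (X ⊕ sizeᴳ g) m))))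
          (*-monoˡ-≤ _ (length-⟦⟧ᴳ g ρ≤m))

-- genProg g vs t f puts ⟦ g ⟧ᴳ in front of register t. The variables are read
-- from the registers vs, and the registers from f onwards are work space.
genProg : ∀ {k} → Gen k → Vec ℕ k → ℕ → ℕ → Prog
genProg (lit w)      vs t f = pushes t w
genProg (var i)      vs t f = move (lookup vs i) f ⨾ move₂ f (lookup vs i) t
genProg (g ⊹ h)      vs t f = genProg h vs t f ⨾ genProg g vs t f
genProg (num g)      vs t f = genProg g vs f (1 + f) ⨾ toBinary f t
genProg (drop g h)   vs t f =
  genProg g vs f (2 + f) ⨾ genProg h vs (1 + f) (2 + f) ⨾
  discard f (1 + f) ⨾ move (1 + f) (2 + f) ⨾ move (2 + f) t
genProg (case g u v) vs t f =
  genProg g vs f (1 + f) ⨾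
  case f (genProg u vs t (1 + f)) (λ b → clear f ⨾ genProg (v b) vs t (1 + f))
genProg (for g h)    vs t f =
  genProg g vs f (1 + f) ⨾ loop f (λ _ → genProg h (f ∷ vs) t (1 + f))

record Layout {k} (vs : Vec ℕ k) (t f : ℕ) : Set where
  field
    vars<f : ∀ i → lookup vs i < f
    t<f    : t < f
    vars≢t : ∀ i → lookup vs i ≢ t

record Ready {k} (vs : Vec ℕ k) (ρ : Vec Word k) (f : ℕ) (σ : Store) : Set where
  field
    vars  : ∀ i → σ (lookup vs i) ≡ lookup ρ i
    fresh : ∀ r → f ≤ r → σ r ≡ []

open Layout
open Ready

layout-temp : ∀ {k} {vs : Vec ℕ k} {t f r f′} → Layout vs t f → f ≤ r → r < f′ → Layout vs r f′
layout-temp L f≤r r<f′ = record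
  { vars<f = λ i → <-trans (<-≤-trans (vars<f L i) f≤r) r<f′
  ; t<f    = r<f′
  ; vars≢t = λ i → <⇒≢ (<-≤-trans (vars<f L i) f≤r)
  }

layout-raise : ∀ {k} {vs : Vec ℕ k} {t f f′} → Layout vs t f → f ≤ f′ → Layout vs t f′
layout-raise L f≤f′ = record
  { vars<f = λ i → <-≤-trans (vars<f L i) f≤f′ ; t<f = <-≤-trans (t<f L) f≤f′ ; vars≢t = vars≢t L }

layout-bind : ∀ {k} {vs : Vec ℕ k} {t f} → Layout vs t f → Layout (f ∷ vs) t (1 + f)
layout-bind L = record
  { vars<f = λ { zero → ≤-refl ; (suc i) → m<n⇒m<1+n (vars<f L i) }
  ; t<f    = m<n⇒m<1+n (t<f L)
  ; vars≢t = λ { zero → <⇒≢ (t<f L) ∘ sym ; (suc i) → vars≢t L i }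
  }

ready-raise : ∀ {k} {vs : Vec ℕ k} {ρ f f′ σ} → f ≤ f′ → Ready vs ρ f σ → Ready vs ρ f′ σ
ready-raise f≤f′ R = record { vars = vars R ; fresh = λ r f′≤r → fresh R r (≤-trans f≤f′ f′≤r) }

ready-update : ∀ {k} {vs : Vec ℕ k} {ρ t f σ} w → Layout vs t f → Ready vs ρ f σ → Ready vs ρ f (σ [ t ↦ w ])
ready-update {σ = σ} w L R = record
  { vars  = λ i → trans (update-other σ (vars≢t L i)) (vars R i)
  ; fresh = λ r f≤r → trans (update-other σ (<⇒≢ (<-≤-trans (t<f L) f≤r) ∘ sym)) (fresh R r f≤r)
  }

ready-bind : ∀ {k} {vs : Vec ℕ k} {ρ f σ w} → σ f ≡ w → Ready vs ρ (1 + f) σ → Ready (f ∷ vs) (w ∷ ρ) (1 + f) σ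
ready-bind e R = record { vars = λ { zero → e ; (suc i) → vars R i } ; fresh = fresh R }

-- Only register `t` changes: the variables are restored and the work space is left empty. This
-- allows subterms to run one after the other in the same work space.
Exec-gen : ∀ {k} (g : Gen k) {vs ρ t f σ m v} → Layout vs t f → Ready vs ρ f σ → Bounded m ρ → σ t ≡ v →
  Exec (genProg g vs t f) σ (⟦ costᴳ g ⟧ m) (σ [ t ↦ ⟦ g ⟧ᴳ ρ ++ v ])

Exec-for : ∀ {k} (h : Gen (suc k)) {vs ρ t f m} → Layout vs t f → ∀ w {σ v} → Bounded m (w ∷ ρ) →
  Ready vs ρ (1 + f) σ → σ f ≡ w → σ t ≡ v →
  Exec (loop f λ _ → genProg h (f ∷ vs) t (1 + f)) σ (1 + length w * (1 + ⟦ costᴳ h ⟧ m))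
    (σ [ f ↦ [] ] [ t ↦ forWord w (λ u → ⟦ h ⟧ᴳ (u ∷ ρ)) ++ v ])
Exec-for h {t = t} {f} L [] {σ} {v} ρ≤m R ef et = loop[] ef same
  where
  same : σ ≗ σ [ f ↦ [] ] [ t ↦ v ]
  same s with s ≟ t | s ≟ f
  ... | yes refl | _        = et
  ... | no _     | yes refl = ef
  ... | no _     | no _     = refl
Exec-for h {vs} {ρ} {t} {f} {m} L (b ∷ w) {σ} {v} ρ≤m R ef et =
  weaken (≤-reflexive (cong suc (+-suc (⟦ costᴳ h ⟧ m) _)))
    (loop∷ b w ef
      (Exec-gen h (layout-bind L) (ready-bind (update-same σ f) R₁) w≤m
        (trans (update-other σ (<⇒≢ (t<f L))) et))
      (Exec-respʳ same (Exec-for h L w w≤m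
        (ready-update out (layout-raise L (n≤1+n f)) R₁)
        (trans (update-other σ₁ (<⇒≢ (t<f L) ∘ sym)) (update-same σ f)) (update-same σ₁ t))))
  where
  σ₁ = σ [ f ↦ w ]
  out = ⟦ h ⟧ᴳ (w ∷ ρ) ++ v
  R₁ : Ready vs ρ (1 + f) σ₁
  R₁ = ready-update w (layout-temp L ≤-refl ≤-refl) R
  w≤m : Bounded m (w ∷ ρ)
  w≤m zero    = ≤-trans (n≤1+n _) (ρ≤m zero)
  w≤m (suc i) = ρ≤m (suc i)
  loopOut = forWord w (λ u → ⟦ h ⟧ᴳ (u ∷ ρ))
  same : σ₁ [ t ↦ out ] [ f ↦ [] ] [ t ↦ loopOut ++ out ] ≗
         σ [ f ↦ [] ] [ t ↦ (loopOut ++ ⟦ h ⟧ᴳ (w ∷ ρ)) ++ v ]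
  same s with s ≟ t | s ≟ f
  ... | yes refl | _        = sym (List.++-assoc loopOut (⟦ h ⟧ᴳ (w ∷ ρ)) v)
  ... | no _     | yes refl = refl
  ... | no _     | no _     = refl

Exec-gen (lit w) L R ρ≤m et = Exec-pushes _ w et
Exec-gen (var i) {vs} {ρ} {t} {f} {σ} {m} {v} L R ρ≤m et =
  weaken (+-mono-≤ (s≤s (*-monoʳ-≤ 3 (ρ≤m i))) (s≤s (*-monoʳ-≤ 5 length-u)))
    -- The detour through `f` reverses the word; moving it on reverses it again, into `t` and the
    -- variable alike.
    (Exec-move x≢f w (vars R i) (fresh R f ≤-refl)
     ⨾ Exec-respʳ same (Exec-move₂ (x≢f ∘ sym) f≢t (vars≢t L i) u
         (update-same (σ [ x ↦ [] ]) f)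
         (trans (update-other (σ [ x ↦ [] ]) x≢f) (update-same σ x))
         (trans (update-other (σ [ x ↦ [] ]) (f≢t ∘ sym)) (trans (update-other σ (vars≢t L i ∘ sym)) et))))
  where
  x = lookup vs i
  w = lookup ρ i
  u = w ʳ++ []
  x≢f = <⇒≢ (vars<f L i)
  f≢t = <⇒≢ (t<f L) ∘ sym
  length-u : length u ≤ m
  length-u = ≤-trans (≤-reflexive (trans (List.length-ʳ++ w) (+-identityʳ _))) (ρ≤m i)
  same : σ [ x ↦ [] ] [ f ↦ u ] [ f ↦ [] ] [ x ↦ u ʳ++ [] ] [ t ↦ u ʳ++ v ] ≗ σ [ t ↦ w ++ v ]
  same s with s ≟ t | s ≟ x | s ≟ f
  ... | yes refl | _        | _        = List.ʳ++-ʳ++ w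
  ... | no _     | yes refl | _        = trans (List.ʳ++-ʳ++ w) (trans (List.++-identityʳ w) (sym (vars R i)))
  ... | no _     | no _     | yes refl = sym (fresh R f ≤-refl)
  ... | no _     | no _     | no _     = refl
Exec-gen (g ⊹ h) {vs} {ρ} {t} {f} {σ} {m} {v} L R ρ≤m et =
  Exec-gen h L R ρ≤m et ⨾
  Exec-respʳ same (Exec-gen g L (ready-update (⟦ h ⟧ᴳ ρ ++ v) L R) ρ≤m (update-same σ t))
  where
  same : σ [ t ↦ ⟦ h ⟧ᴳ ρ ++ v ] [ t ↦ ⟦ g ⟧ᴳ ρ ++ ⟦ h ⟧ᴳ ρ ++ v ] ≗ σ [ t ↦ (⟦ g ⟧ᴳ ρ ++ ⟦ h ⟧ᴳ ρ) ++ v ]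
  same s with s ≟ t
  ... | yes refl = sym (List.++-assoc (⟦ g ⟧ᴳ ρ) (⟦ h ⟧ᴳ ρ) v)
  ... | no _     = refl
Exec-gen (num g) {vs} {ρ} {t} {f} {σ} {m} {v} L R ρ≤m et =
  Exec-gen g (layout-temp L ≤-refl ≤-refl) (ready-raise (n≤1+n f) R) ρ≤m (fresh R f ≤-refl) ⨾
  Exec-respʳ same (weaken cost (Exec-toBinary (t<f L) w
    (trans (update-same σ f) (List.++-identityʳ w))
    (λ r f<r → trans (update-other σ (<⇒≢ f<r ∘ sym)) (fresh R r (<⇒≤ f<r)))
    (trans (update-other σ (<⇒≢ (t<f L))) et)))
  where
  w = ⟦ g ⟧ᴳ ρ
  cost : ⟦ binaryCost ⟧ (length w) ≤ ⟦ binaryCost ∘ₚ sizeᴳ g ⟧ m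
  cost = ≤-trans (⟦⟧-mono binaryCost (length-⟦⟧ᴳ g ρ≤m)) (≤-reflexive (sym (⟦∘ₚ⟧ binaryCost (sizeᴳ g) m)))
  same : σ [ f ↦ w ++ [] ] [ f ↦ [] ] [ t ↦ encodeℕ (length w) ++ v ] ≗ σ [ t ↦ encodeℕ (length w) ++ v ]
  same s with s ≟ t | s ≟ f
  ... | yes refl | _        = refl
  ... | no _     | yes refl = sym (fresh R f ≤-refl)
  ... | no _     | no _     = refl
Exec-gen (drop g h) {vs} {ρ} {t} {f} {σ} {m} {v} L R ρ≤m et =
  Exec-gen g L₀ R₀ ρ≤m (fresh R f ≤-refl) ⨾
  Exec-gen h L₁ (ready-update (w ++ []) L₀ R₀) ρ≤m
    (trans (update-other σ (1≢0 ∘ sym)) (fresh R (1 + f) (n≤1+n f))) ⨾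
  weaken (s≤s (*-monoʳ-≤ 3 (length-⟦⟧ᴳ g ρ≤m)))
    (Exec-discard 1≢0 w u
      (trans (update-other σ₁ 1≢0) (trans (update-same σ f) (List.++-identityʳ w)))
      (trans (update-same σ₁ (1 + f)) (List.++-identityʳ u))) ⨾
  weaken (s≤s (*-monoʳ-≤ 3 (length-⟦⟧ᴳ (drop g h) ρ≤m)))
    (Exec-move 1≢2 d (update-same (σ₂ [ f ↦ [] ]) (1 + f))
      (trans (update-other (σ₂ [ f ↦ [] ]) (1≢2 ∘ sym)) (trans (update-other σ₂ (0≢2 ∘ sym))
        (trans (update-other σ₁ (1≢2 ∘ sym)) (trans (update-other σ (0≢2 ∘ sym))
          (fresh R (2 + f) (m≤n+m f 2))))))) ⨾
  weaken (s≤s (*-monoʳ-≤ 3 length-d))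
    (Exec-respʳ same (Exec-move (t≢2 ∘ sym) (d ʳ++ []) (update-same (σ₃ [ 1 + f ↦ [] ]) (2 + f))
      (trans (update-other (σ₃ [ 1 + f ↦ [] ]) t≢2) (trans (update-other σ₃ t≢1)
        (trans (update-other (σ₂ [ f ↦ [] ]) t≢1) (trans (update-other σ₂ t≢0)
          (trans (update-other σ₁ t≢1) (trans (update-other σ t≢0) et))))))))
  where
  w = ⟦ g ⟧ᴳ ρ
  u = ⟦ h ⟧ᴳ ρ
  d = List.drop (length w) u
  1≢0 : f ≢ 1 + f
  1≢0 = <⇒≢ ≤-refl
  1≢2 : 1 + f ≢ 2 + f
  1≢2 = <⇒≢ ≤-refl
  0≢2 : f ≢ 2 + f
  0≢2 = <⇒≢ (m<n+m f z<s)
  t≢0 : t ≢ f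
  t≢0 = <⇒≢ (t<f L)
  t≢1 : t ≢ 1 + f
  t≢1 = <⇒≢ (m<n⇒m<1+n (t<f L))
  t≢2 : t ≢ 2 + f
  t≢2 = <⇒≢ (m<n⇒m<1+n (m<n⇒m<1+n (t<f L)))
  L₀ : Layout vs f (2 + f)
  L₀ = layout-temp L ≤-refl (m<n+m f z<s)
  L₁ : Layout vs (1 + f) (2 + f)
  L₁ = layout-temp L (n≤1+n f) ≤-refl
  R₀ : Ready vs ρ (2 + f) σ
  R₀ = ready-raise (m≤n+m f 2) R
  σ₁ = σ [ f ↦ w ++ [] ]
  σ₂ = σ₁ [ 1 + f ↦ u ++ [] ]
  σ₃ = σ₂ [ f ↦ [] ] [ 1 + f ↦ d ]
  length-d : length (d ʳ++ []) ≤ ⟦ sizeᴳ h ⟧ m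
  length-d = ≤-trans (≤-reflexive (trans (List.length-ʳ++ d) (+-identityʳ _))) (length-⟦⟧ᴳ (drop g h) ρ≤m)
  same : σ₃ [ 1 + f ↦ [] ] [ 2 + f ↦ d ʳ++ [] ] [ 2 + f ↦ [] ] [ t ↦ (d ʳ++ []) ʳ++ v ] ≗ σ [ t ↦ d ++ v ]
  same s with s ≟ t | s ≟ (2 + f) | s ≟ (1 + f) | s ≟ f
  ... | yes refl | _        | _        | _        = List.ʳ++-ʳ++ d
  ... | no _     | yes refl | _        | _        = sym (fresh R (2 + f) (m≤n+m f 2))
  ... | no _     | no _     | yes refl | _        = sym (fresh R (1 + f) (n≤1+n f))
  ... | no _     | no _     | no _     | yes refl = sym (fresh R f ≤-refl)
  ... | no _     | no _     | no _     | no _     = refl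
Exec-gen (case g u v) {vs} {ρ} {t} {f} {σ} {m} {o} L R ρ≤m et =
  Exec-gen g L₀ R₀ ρ≤m (fresh R f ≤-refl) ⨾ select (⟦ g ⟧ᴳ ρ) (length-⟦⟧ᴳ g ρ≤m)
  where
  L₀ : Layout vs f (1 + f)
  L₀ = layout-temp L ≤-refl ≤-refl
  L₁ : Layout vs t (1 + f)
  L₁ = layout-raise L (n≤1+n f)
  R₀ : Ready vs ρ (1 + f) σ
  R₀ = ready-raise (n≤1+n f) R
  t≢f : t ≢ f
  t≢f = <⇒≢ (t<f L)

  same : ∀ w w′ x → σ [ f ↦ w ] [ f ↦ w′ ] [ f ↦ [] ] [ t ↦ x ] ≗ σ [ t ↦ x ]
  same w w′ x s with s ≟ t | s ≟ f
  ... | yes refl | _        = refl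
  ... | no _     | yes refl = sym (fresh R f ≤-refl)
  ... | no _     | no _     = refl

  same[] : ∀ x → σ [ f ↦ [] ] [ t ↦ x ] ≗ σ [ t ↦ x ]
  same[] x s with s ≟ t | s ≟ f
  ... | yes refl | _        = refl
  ... | no _     | yes refl = sym (fresh R f ≤-refl)
  ... | no _     | no _     = refl

  bit≤cost : ∀ b → ⟦ costᴳ (v b) ⟧ m ≤ ⟦ costᴳ (v false) ⟧ m + ⟦ costᴳ (v true) ⟧ m
  bit≤cost false = m≤m+n _ _
  bit≤cost true  = m≤n+m _ (⟦ costᴳ (v false) ⟧ m)

  select : ∀ w → length w ≤ ⟦ sizeᴳ g ⟧ m →
    Exec (case f (genProg u vs t (1 + f)) (λ b → clear f ⨾ genProg (v b) vs t (1 + f)))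
         (σ [ f ↦ w ++ [] ])
         (1 + (⟦ costᴳ u ⟧ m + ((1 + 2 * ⟦ sizeᴳ g ⟧ m) + (⟦ costᴳ (v false) ⟧ m + ⟦ costᴳ (v true) ⟧ m))))
         (σ [ t ↦ caseWord w (⟦ u ⟧ᴳ ρ) (λ b → ⟦ v b ⟧ᴳ ρ) ++ o ])
  select [] _ = weaken (s≤s (m≤m+n _ _))
    (case[] (update-same σ f)
      (Exec-respʳ (same[] (⟦ u ⟧ᴳ ρ ++ o))
        (Exec-gen u L₁ (ready-update [] L₀ R₀) ρ≤m (trans (update-other σ t≢f) et))))
  select (b ∷ w) w≤ = weaken
    (s≤s (≤-trans (+-mono-≤ (s≤s (*-monoʳ-≤ 2
      (≤-trans (≤-reflexive (cong length (List.++-identityʳ w))) (≤-trans (n≤1+n _) w≤))))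
                            (bit≤cost b))
                  (m≤n+m _ (⟦ costᴳ u ⟧ m))))
    (case∷ b (w ++ []) (update-same σ f)
      (Exec-clear f (w ++ []) (update-same (σ [ f ↦ b ∷ w ++ [] ]) f) ⨾
       Exec-respʳ (same (b ∷ w ++ []) (w ++ []) (⟦ v b ⟧ᴳ ρ ++ o))
         (Exec-gen (v b) L₁
           (ready-update [] L₀ (ready-update (w ++ []) L₀ (ready-update (b ∷ w ++ []) L₀ R₀))) ρ≤m
           (trans (update-other (σ [ f ↦ b ∷ w ++ [] ] [ f ↦ w ++ [] ]) t≢f)
             (trans (update-other (σ [ f ↦ b ∷ w ++ [] ]) t≢f) (trans (update-other σ t≢f) et))))))
Exec-gen (for g h) {vs} {ρ} {t} {f} {σ} {m} {v} L R ρ≤m et =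
  Exec-gen g L₀ R₀ ρ≤m (fresh R f ≤-refl) ⨾
  weaken (s≤s (*-mono-≤ (length-⟦⟧ᴳ g ρ≤m) (s≤s (≤-reflexive (sym (⟦∘ₚ⟧ (costᴳ h) (X ⊕ sizeᴳ g) m))))))
    (Exec-respʳ same (Exec-for h L w (Bounded-∷ (length-⟦⟧ᴳ g ρ≤m) ρ≤m) (ready-update (w ++ []) L₀ R₀)
      (trans (update-same σ f) (List.++-identityʳ w)) (trans (update-other σ (<⇒≢ (t<f L))) et)))
  where
  w = ⟦ g ⟧ᴳ ρ
  L₀ : Layout vs f (1 + f)
  L₀ = layout-temp L ≤-refl ≤-refl
  R₀ : Ready vs ρ (1 + f) σ
  R₀ = ready-raise (n≤1+n f) R
  out = forWord w (λ u → ⟦ h ⟧ᴳ (u ∷ ρ)) ++ v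
  same : σ [ f ↦ w ++ [] ] [ f ↦ [] ] [ t ↦ out ] ≗ σ [ t ↦ out ]
  same s with s ≟ t | s ≟ f
  ... | yes refl | _        = refl
  ... | no _     | yes refl = sym (fresh R f ≤-refl)
  ... | no _     | no _     = refl

-- Register 0 is both input and output, so the input is first moved to register 1, by way of
-- register 2 to keep its direction.
gen-polyTime : (g : Gen 1) → PolyTime λ x → ⟦ g ⟧ᴳ (x ∷ [])
gen-polyTime g = compile prog , cost , λ x →
  subst (Computes (compile prog) x [] (⟦ cost ⟧ (length x))) (result x) (Exec-computes prog x (run x))
  where
  prog : Prog
  prog = move 0 2 ⨾ move 2 1 ⨾ genProg g (1 ∷ []) 0 2

  cost : Polynomial
  cost = (con 1 ⊕ (con 3 ⊗ X)) ⊕ ((con 1 ⊕ (con 3 ⊗ X)) ⊕ costᴳ g)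

  copied : Word → Store
  copied x = initialStore x [ 0 ↦ [] ] [ 2 ↦ x ʳ++ [] ] [ 2 ↦ [] ] [ 1 ↦ (x ʳ++ []) ʳ++ [] ]

  result : ∀ x → (copied x [ 0 ↦ ⟦ g ⟧ᴳ (x ∷ []) ++ [] ]) 0 ≡ ⟦ g ⟧ᴳ (x ∷ [])
  result x = List.++-identityʳ _

  layout : Layout (1 ∷ []) 0 2
  layout = record { vars<f = λ { zero → ≤-refl } ; t<f = z<s ; vars≢t = λ { zero () } }

  ready : ∀ x → Ready (1 ∷ []) (x ∷ []) 2 (copied x)
  ready x = record
    { vars  = λ { zero → trans (List.ʳ++-ʳ++ x) (List.++-identityʳ x) }
    ; fresh = λ { (suc zero) (s≤s ()) ; (suc (suc zero)) _ → refl ; (suc (suc (suc r))) _ → refl }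
    }

  run : ∀ x → Exec prog (initialStore x) (⟦ cost ⟧ (length x)) (copied x [ 0 ↦ ⟦ g ⟧ᴳ (x ∷ []) ++ [] ])
  run x =
    Exec-move (λ ()) x refl refl ⨾
    weaken (s≤s (*-monoʳ-≤ 3 (≤-reflexive (trans (List.length-ʳ++ x) (+-identityʳ _)))))
      (Exec-move (λ ()) (x ʳ++ []) refl refl) ⨾
    Exec-gen g layout (ready x) (λ { zero → ≤-refl }) refl

-- Charging and exact covers

module ℚ-+ = CommutativeSemigroupProperties (CommutativeMonoid.commutativeSemigroup ℚ.+-0-commutativeMonoid)



-- Termwise equality, finer than equality of real numbers. Finite sums are formed termwise, so
-- rearranging them stays within it.
_≈ℝ_ : ℝ → ℝ → Set
x ≈ℝ y = ∀ n → seq x n ≡ seq y n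

≈ℝ⇒≤ℝ : ∀ {x y} → x ≈ℝ y → x ≤ℝ y
≈ℝ⇒≤ℝ {x} {y} e ε 0<ε = 0 , λ n _ → ℚ.≤-trans (ℚ.≤-reflexive (trans (e n) (sym (ℚ.+-identityʳ (seq y n)))))
                                         (ℚ.+-monoʳ-≤ (seq y n) (ℚ.<⇒≤ 0<ε))

half-positive : ∀ {ε} → 0ℚ ℚ.< ε → 0ℚ ℚ.< ½ ℚ.* ε
half-positive {ε} 0<ε = subst (ℚ._< ½ ℚ.* ε) (ℚ.*-zeroʳ ½) (ℚ.*-monoʳ-<-pos ½ 0<ε)

halves : ∀ ε → ½ ℚ.* ε ℚ.+ ½ ℚ.* ε ≡ ε
halves ε = trans (sym (ℚ.*-distribʳ-+ ε ½ ½)) (ℚ.*-identityˡ ε)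

≤ℝ-trans : ∀ {x y z} → x ≤ℝ y → y ≤ℝ z → x ≤ℝ z
≤ℝ-trans {x} {y} {z} x≤y y≤z ε 0<ε
  with M , xy ← x≤y (½ ℚ.* ε) (half-positive 0<ε) | N , yz ← y≤z (½ ℚ.* ε) (half-positive 0<ε)
  = M ⊔ N , λ n M⊔N≤n → begin
    seq x n                              ≤⟨ xy n (≤-trans (m≤m⊔n M N) M⊔N≤n) ⟩
    seq y n ℚ.+ ½ ℚ.* ε                  ≤⟨ ℚ.+-monoˡ-≤ (½ ℚ.* ε) (yz n (≤-trans (m≤n⊔m M N) M⊔N≤n)) ⟩
    seq z n ℚ.+ ½ ℚ.* ε ℚ.+ ½ ℚ.* ε      ≡⟨ ℚ.+-assoc (seq z n) (½ ℚ.* ε) (½ ℚ.* ε) ⟩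
    seq z n ℚ.+ (½ ℚ.* ε ℚ.+ ½ ℚ.* ε)    ≡⟨ cong (seq z n ℚ.+_) (halves ε) ⟩
    seq z n ℚ.+ ε                        ∎
  where open ℚ.≤-Reasoning

+ℝ-mono-≤ℝ : ∀ {x y u v} → x ≤ℝ y → u ≤ℝ v → x +ℝ u ≤ℝ y +ℝ v
+ℝ-mono-≤ℝ {x} {y} {u} {v} x≤y u≤v ε 0<ε
  with M , xy ← x≤y (½ ℚ.* ε) (half-positive 0<ε) | N , uv ← u≤v (½ ℚ.* ε) (half-positive 0<ε)
  = M ⊔ N , λ n M⊔N≤n → begin
    seq x n ℚ.+ seq u n
      ≤⟨ ℚ.+-mono-≤ (xy n (≤-trans (m≤m⊔n M N) M⊔N≤n)) (uv n (≤-trans (m≤n⊔m M N) M⊔N≤n)) ⟩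
    (seq y n ℚ.+ ½ ℚ.* ε) ℚ.+ (seq v n ℚ.+ ½ ℚ.* ε)
      ≡⟨ ℚ-+.interchange (seq y n) (½ ℚ.* ε) (seq v n) (½ ℚ.* ε) ⟩
    (seq y n ℚ.+ seq v n) ℚ.+ (½ ℚ.* ε ℚ.+ ½ ℚ.* ε)
      ≡⟨ cong (seq y n ℚ.+ seq v n ℚ.+_) (halves ε) ⟩
    (seq y n ℚ.+ seq v n) ℚ.+ ε ∎
  where open ℚ.≤-Reasoning

natℚ : ℕ → ℚ
natℚ n = ℤ.+ n ℚ./ 1

natℚ-+ : ∀ m n → natℚ m ℚ.+ natℚ n ≡ natℚ (m + n)
natℚ-+ m n = ℚ.toℚᵘ-injective (ℚᵘ.≃-trans (ℚ.toℚᵘ-homo-+ (natℚ m) (natℚ n))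
  (ℚᵘ.≃-trans (ℚᵘ.+-cong (ℚ.toℚᵘ-fromℚᵘ (mkℚᵘ (ℤ.+ m) 0)) (ℚ.toℚᵘ-fromℚᵘ (mkℚᵘ (ℤ.+ n) 0)))
    (ℚᵘ.≃-trans (*≡* (cong (ℤ._* ℤ.+ 1) (cong₂ ℤ._+_ (ℤ.*-identityʳ (ℤ.+ m)) (ℤ.*-identityʳ (ℤ.+ n)))))
      (ℚᵘ.≃-sym (ℚ.toℚᵘ-fromℚᵘ (mkℚᵘ (ℤ.+ (m + n)) 0))))))

natℚ-mono-≤ : ∀ {m n} → m ≤ n → natℚ m ℚ.≤ natℚ n
natℚ-mono-≤ {m} {n} m≤n = ℚ.toℚᵘ-cancel-≤ (ℚᵘ.≤-respˡ-≃ (ℚᵘ.≃-sym (ℚ.toℚᵘ-fromℚᵘ (mkℚᵘ (ℤ.+ m) 0)))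
  (ℚᵘ.≤-respʳ-≃ (ℚᵘ.≃-sym (ℚ.toℚᵘ-fromℚᵘ (mkℚᵘ (ℤ.+ n) 0)))
    (*≤* (ℤ.*-monoʳ-≤-nonNeg (ℤ.+ 1) (ℤ.+≤+ m≤n)))))

natℝ-mono-≤ : ∀ {m n} → m ≤ n → natℝ m ≤ℝ natℝ n
natℝ-mono-≤ {m} {n} m≤n ε 0<ε = 0 , λ _ _ →
  ℚ.≤-trans (natℚ-mono-≤ m≤n) (ℚ.≤-trans (ℚ.≤-reflexive (sym (ℚ.+-identityʳ (natℚ n))))
    (ℚ.+-monoʳ-≤ (natℚ n) (ℚ.<⇒≤ 0<ε)))

-- Here real inequalities turn into integral ones. If `n < m`, then `n + ½ < n + 1 ≤ m`, against the
-- bound for `ε = ½`.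
natℝ-cancel-≤ : ∀ {m n} → natℝ m ≤ℝ natℝ n → m ≤ n
natℝ-cancel-≤ {m} {n} le with N , h ← le ½ (ℚ.positive⁻¹ ½) = ≮⇒≥ λ n<m →
  ℚ.<-irrefl refl (ℚ.<-≤-trans (ℚ.+-monoʳ-< (natℚ n) {½} {natℚ 1} (ℚ.*<* (ℤ.+<+ ≤-refl)))
    (ℚ.≤-trans (ℚ.≤-reflexive (trans (natℚ-+ n 1) (cong natℚ (+-comm n 1))))
      (ℚ.≤-trans (natℚ-mono-≤ n<m) (h N ≤-refl))))

-- Cumulative charge and summation by parts

cum : ∀ {T} → Vector ℕ T → Vector ℕ T
cum f zero    = f zero
cum f (suc t) = f zero + cum (f ∘ suc) t

cumulative-natℝ : ∀ {T} (f : Vector ℕ T) t → cumulative (natℝ ∘ f) t ≈ℝ natℝ (cum f t)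
cumulative-natℝ f zero    n = refl
cumulative-natℝ f (suc t) n =
  trans (cong (natℚ (f zero) ℚ.+_) (cumulative-natℝ (f ∘ suc) t n)) (natℚ-+ (f zero) (cum (f ∘ suc) t))

sumℝ-natℝ : ∀ {n} (f : Vector ℕ n) → sumℝ (natℝ ∘ f) ≈ℝ natℝ (sum f)
sumℝ-natℝ {zero}  f n = refl
sumℝ-natℝ {suc k} f n =
  trans (cong (natℚ (f zero) ℚ.+_) (sumℝ-natℝ (f ∘ suc) n)) (natℚ-+ (f zero) (sum (f ∘ suc)))

≤ℝ-refl : ∀ {x} → x ≤ℝ x
≤ℝ-refl {x} = ≈ℝ⇒≤ℝ {x} {x} λ _ → refl

sumℝ-mono-≤ℝ : ∀ {n} {f g : Vector ℝ n} → (∀ i → f i ≤ℝ g i) → sumℝ f ≤ℝ sumℝ g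
sumℝ-mono-≤ℝ {zero}          f≤g = ≤ℝ-refl {natℝ 0}
sumℝ-mono-≤ℝ {suc n} {f} {g} f≤g =
  +ℝ-mono-≤ℝ {f zero} {g zero} {sumℝ (f ∘ suc)} {sumℝ (g ∘ suc)} (f≤g zero) (sumℝ-mono-≤ℝ (f≤g ∘ suc))

cumulative-mono-≤ℝ : ∀ {T} {f g : Vector ℝ T} → (∀ t → f t ≤ℝ g t) → ∀ t → cumulative f t ≤ℝ cumulative g t
cumulative-mono-≤ℝ f≤g zero = f≤g zero
cumulative-mono-≤ℝ {f = f} {g} f≤g (suc t) =
  +ℝ-mono-≤ℝ {f zero} {g zero} {cumulative (f ∘ suc) t} {cumulative (g ∘ suc) t}
    (f≤g zero) (cumulative-mono-≤ℝ (f≤g ∘ suc) t)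

sumℝ-+ℝ : ∀ {n} (f g : Vector ℝ n) → sumℝ (λ i → f i +ℝ g i) ≈ℝ (sumℝ f +ℝ sumℝ g)
sumℝ-+ℝ {zero}  f g n = refl
sumℝ-+ℝ {suc k} f g n =
  trans (cong (seq (f zero) n ℚ.+ seq (g zero) n ℚ.+_) (sumℝ-+ℝ (f ∘ suc) (g ∘ suc) n))
        (ℚ-+.interchange (seq (f zero) n) (seq (g zero) n) _ _)

sumℝ-cumulative : ∀ {n T} (a : Fin n → Vector ℝ T) t →
  sumℝ (λ i → cumulative (a i) t) ≈ℝ cumulative (λ t → sumℝ λ i → a i t) t
sumℝ-cumulative a zero    n = refl
sumℝ-cumulative a (suc t) n =
  trans (sumℝ-+ℝ (λ i → a i zero) (λ i → cumulative (a i ∘ suc) t) n)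
        (cong (seq (sumℝ λ i → a i zero) n ℚ.+_) (sumℝ-cumulative (λ i → a i ∘ suc) t n))

0≤cumulative : ∀ {T} {a : Vector ℝ T} → (∀ t → natℝ 0 ≤ℝ a t) → ∀ t → natℝ 0 ≤ℝ cumulative a t
0≤cumulative 0≤a zero = 0≤a zero
0≤cumulative {a = a} 0≤a (suc t) =
  +ℝ-mono-≤ℝ {natℝ 0} {a zero} {natℝ 0} {cumulative (a ∘ suc) t} (0≤a zero) (0≤cumulative (0≤a ∘ suc) t)

cumulative-monotone : ∀ {T} {a : Vector ℝ T} → (∀ t → natℝ 0 ≤ℝ a t) →
  ∀ {s t} → toℕ s ≤ toℕ t → cumulative a s ≤ℝ cumulative a t
cumulative-monotone {a = a} 0≤a {zero}  {zero}  _ = ≤ℝ-refl {a zero}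
cumulative-monotone {a = a} 0≤a {zero}  {suc t} _ =
  ≤ℝ-trans {a zero} {a zero +ℝ natℝ 0} {cumulative a (suc t)}
    (≈ℝ⇒≤ℝ {a zero} {a zero +ℝ natℝ 0} λ n → sym (ℚ.+-identityʳ (seq (a zero) n)))
    (+ℝ-mono-≤ℝ {a zero} {a zero} {natℝ 0} {cumulative (a ∘ suc) t} (≤ℝ-refl {a zero}) (0≤cumulative (0≤a ∘ suc) t))
cumulative-monotone {a = a} 0≤a {suc s} {suc t} (s≤s s≤t) =
  +ℝ-mono-≤ℝ {a zero} {a zero} {cumulative (a ∘ suc) s} {cumulative (a ∘ suc) t}
    (≤ℝ-refl {a zero}) (cumulative-monotone (0≤a ∘ suc) s≤t)

-- One unit of charge at period t is worth price t. Since prices decrease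
-- strictly, a value of worth m forces the supply m to be used up exactly.
price : ∀ {T} → Fin T → ℕ
price {T} t = 2 + (T ∸ toℕ t)

worth : ∀ {T} → Vector ℕ T → ℕ
worth f = sum λ t → price t * f t

-- One step of Abel summation. The charge `c` carried over from earlier periods is priced like
-- charge of the first period. Passing to the next period lowers the price of everything so far by
-- 1, which splits off the cumulative charge `c + f zero`.
worth-suc : ∀ {T} c (f : Vector ℕ (suc T)) →
  (2 + suc T) * c + worth f ≡ (c + f zero) + ((2 + T) * (c + f zero) + worth (f ∘ suc))
worth-suc {T} c f = rearrange T c (f zero) (worth (f ∘ suc))
  where
  rearrange : ∀ T c x w → (3 + T) * c + ((3 + T) * x + w) ≡ (c + x) + ((2 + T) * (c + x) + w)
  rearrange = solve-∀

module _ where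
  open ≤-Reasoning

  -- By `worth-suc`, each side is the sum of its cumulative charges, with the last of them counted
  -- twice more.
  worth-mono : ∀ {T c d} {f g : Vector ℕ T} → c ≤ d → (∀ t → c + cum f t ≤ d + cum g t) →
    (2 + T) * c + worth f ≤ (2 + T) * d + worth g
  worth-mono {zero}  {c} {d} c≤d _ = +-monoˡ-≤ 0 (*-monoʳ-≤ 2 c≤d)
  worth-mono {suc T} {c} {d} {f} {g} c≤d le = begin
    (3 + T) * c + worth f                                 ≡⟨ worth-suc c f ⟩
    (c + f zero) + ((2 + T) * (c + f zero) + worth (f ∘ suc))
      ≤⟨ +-mono-≤ (le zero) (worth-mono (le zero) λ t → subst₂ _≤_ (sym (+-assoc c _ _)) (sym (+-assoc d _ _))
        (le (suc t))) ⟩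
    (d + g zero) + ((2 + T) * (d + g zero) + worth (g ∘ suc))  ≡⟨ worth-suc d g ⟨
    (3 + T) * d + worth g                                 ∎

+-tight : ∀ {a b c d} → a ≤ b → c ≤ d → b + d ≤ a + c → a ≡ b × c ≡ d
+-tight {a} {b} {c} {d} a≤b c≤d le =
  ≤-antisym a≤b (+-cancelʳ-≤ d b a (≤-trans le (+-monoʳ-≤ a c≤d))) ,
  ≤-antisym c≤d (+-cancelˡ-≤ b d c (≤-trans le (+-monoˡ-≤ c a≤b)))

-- Equality of the two sums of cumulative charges forces equality of all summands, and these
-- determine the charges.
worth-tight : ∀ {T} c {f g : Vector ℕ T} → (∀ t → c + cum f t ≤ c + cum g t) →
  (2 + T) * c + worth g ≤ (2 + T) * c + worth f → f ≗ g
worth-tight {suc T} c {f} {g} le ge = λ { zero → f₀≡g₀ ; (suc t) → rest t }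
  where
  le′ : ∀ t → (c + f zero) + cum (f ∘ suc) t ≤ (c + g zero) + cum (g ∘ suc) t
  le′ t = subst₂ _≤_ (sym (+-assoc c _ _)) (sym (+-assoc c _ _)) (le (suc t))
  tight = +-tight (le zero) (worth-mono (le zero) le′) (subst₂ _≤_ (worth-suc c g) (worth-suc c f) ge)
  f₀≡g₀ : f zero ≡ g zero
  f₀≡g₀ = +-cancelˡ-≡ c _ _ (proj₁ tight)
  rest : f ∘ suc ≗ g ∘ suc
  rest = worth-tight (c + f zero)
    (λ t → subst (λ k → (c + f zero) + cum (f ∘ suc) t ≤ k + cum (g ∘ suc) t) (sym (proj₁ tight)) (le′ t))
    (≤-reflexive (trans (cong (λ k → (2 + T) * k + worth (g ∘ suc)) (proj₁ tight)) (sym (proj₂ tight))))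

sum-mono-≤ : ∀ {n} {f g : Vector ℕ n} → (∀ i → f i ≤ g i) → sum f ≤ sum g
sum-mono-≤ {zero}  f≤g = z≤n
sum-mono-≤ {suc n} f≤g = +-mono-≤ (f≤g zero) (sum-mono-≤ (f≤g ∘ suc))

sum-tight : ∀ {n} {f g : Vector ℕ n} → (∀ i → f i ≤ g i) → sum g ≤ sum f → f ≗ g
sum-tight {suc n} f≤g le i with +-tight (f≤g zero) (sum-mono-≤ (f≤g ∘ suc)) le
sum-tight f≤g le zero    | e , _  = e
sum-tight f≤g le (suc i) | _ , es = sum-tight (f≤g ∘ suc) (≤-reflexive (sym es)) i

cum-cong : ∀ {T} {f g : Vector ℕ T} → f ≗ g → cum f ≗ cum g
cum-cong e zero    = e zero
cum-cong e (suc t) = cong₂ _+_ (e zero) (cum-cong (e ∘ suc) t)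

cum-+ : ∀ {T} (f g : Vector ℕ T) t → cum (λ t → f t + g t) t ≡ cum f t + cum g t
cum-+ f g zero    = refl
cum-+ f g (suc t) = trans (cong ((f zero + g zero) +_) (cum-+ (f ∘ suc) (g ∘ suc) t)) (shuffle (f zero) (g zero) _ _)
  where
  shuffle : ∀ a b c d → (a + b) + (c + d) ≡ (a + c) + (b + d)
  shuffle = solve-∀

cum-0 : ∀ {T} (t : Fin T) → cum (λ _ → 0) t ≡ 0
cum-0 zero    = refl
cum-0 (suc t) = cum-0 t

cum-sum : ∀ {n T} (f : Fin n → Vector ℕ T) t → cum (λ t → sum λ i → f i t) t ≡ sum λ i → cum (f i) t
cum-sum {zero}  f t = cum-0 t
cum-sum {suc n} f t =
  trans (cum-+ (f zero) (λ t → sum λ i → f (suc i) t) t) (cong (cum (f zero) t +_) (cum-sum (f ∘ suc) t))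

worth-+ : ∀ {T} (f g : Vector ℕ T) → worth (λ t → f t + g t) ≡ worth f + worth g
worth-+ f g = trans (sum-cong-≗ λ t → *-distribˡ-+ (price t) (f t) (g t))
  (∑-distrib-+ (λ t → price t * f t) (λ t → price t * g t))

worth-cong : ∀ {T} {f g : Vector ℕ T} → f ≗ g → worth f ≡ worth g
worth-cong e = sum-cong-≗ λ t → cong (price t *_) (e t)

worth-0 : ∀ T → worth {T} (λ _ → 0) ≡ 0
worth-0 T = trans (sum-cong-≗ λ (t : Fin T) → *-zeroʳ (price t)) (sum-replicate-zero T)

worth-sum : ∀ {n T} (f : Fin n → Vector ℕ T) → worth (λ t → sum λ i → f i t) ≡ sum λ i → worth (f i)
worth-sum {zero}  {T} f = worth-0 T
worth-sum {suc n} f =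
  trans (worth-+ (f zero) (λ t → sum λ i → f (suc i) t)) (cong (worth (f zero) +_) (worth-sum (f ∘ suc)))

worth-* : ∀ {T} c (f : Vector ℕ T) → worth (λ t → c * f t) ≡ c * worth f
worth-* {T} zero f = worth-0 T
worth-* (suc c) f = trans (worth-+ f (λ t → c * f t)) (cong (worth f +_) (worth-* c f))

δ : ∀ {T} → Fin T → Vector ℕ T
δ zero    zero    = 1
δ zero    (suc _) = 0
δ (suc _) zero    = 0
δ (suc d) (suc t) = δ d t

sum-δ : ∀ {T} (f : Vector ℕ T) d → sum (λ t → f t * δ d t) ≡ f d
sum-δ {suc T} f zero    = trans (cong₂ _+_ (*-identityʳ (f zero))
                            (trans (sum-cong-≗ λ t → *-zeroʳ (f (suc t))) (sum-replicate-zero T))) (+-identityʳ (f zero))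
sum-δ f (suc d) = trans (cong (_+ sum (λ t → f (suc t) * δ d t)) (*-zeroʳ (f zero))) (sum-δ (f ∘ suc) d)

cum-δ : ∀ {T} (d t : Fin T) → toℕ d ≤ toℕ t → cum (δ d) t ≡ 1
cum-δ zero    zero    _       = refl
cum-δ zero    (suc t) _       = cong suc (cum-0 t)
cum-δ (suc d) (suc t) (s≤s l) = cum-δ d t l

cum-δ-cases : ∀ {T} (d t : Fin T) → cum (δ d) t ≡ 0 ⊎ (toℕ d ≤ toℕ t × cum (δ d) t ≡ 1)
cum-δ-cases zero    t       = inj₂ (z≤n , cum-δ zero t z≤n)
cum-δ-cases (suc d) zero    = inj₁ refl
cum-δ-cases (suc d) (suc t) with cum-δ-cases d t
... | inj₁ e       = inj₁ e
... | inj₂ (l , e) = inj₂ (s≤s l , e)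

load : ∀ {T} → List (Fin T) → Vector ℕ T
load []       t = 0
load (d ∷ ds) t = δ d t + load ds t

worth-load : ∀ {T} (ds : List (Fin T)) → worth (load ds) ≡ foldr (λ d s → price d + s) 0 ds
worth-load {T} []   = worth-0 T
worth-load (d ∷ ds) = trans (worth-+ (δ d) (load ds)) (cong₂ _+_ (sum-δ price d) (worth-load ds))

-- Backed a k ds: the j-th entry of ds is a period by which a has delivered
-- k + j units.
Backed : ∀ {T} → Vector ℝ T → ℕ → List (Fin T) → Set
Backed a k []       = ⊤
Backed a k (d ∷ ds) = natℝ (suc k) ≤ℝ cumulative a d × Backed a (suc k) ds

-- Take the last entry of `ds` that counts at `t`: as the `j`-th entry it backs `k + j` units, and
-- at most `j` entries count. If none counts, nothing is known about the `k` earlier units, hence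
-- the first alternative.
backed-≤ : ∀ {T} {a : Vector ℝ T} → (∀ t → natℝ 0 ≤ℝ a t) → ∀ k ds → Backed a k ds → ∀ t →
  cum (load ds) t ≡ 0 ⊎ natℝ (k + cum (load ds) t) ≤ℝ cumulative a t
backed-≤ 0≤a k [] _ t = inj₁ (cum-0 t)
backed-≤ {a = a} 0≤a k (d ∷ ds) (b , bs) t with backed-≤ 0≤a (suc k) ds bs t | cum-δ-cases d t
... | inj₂ le | cases = inj₂ (≤ℝ-trans {natℝ (k + cum (load (d ∷ ds)) t)} {natℝ (suc k + cum (load ds) t)} {cumulative a t}
  (natℝ-mono-≤ (subst₂ _≤_ (cong (k +_) (sym (cum-+ (δ d) (load ds) t))) (+-suc k _)
    (+-monoʳ-≤ k (+-monoˡ-≤ (cum (load ds) t) (δ≤1 cases))))) le)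
  where
  δ≤1 : cum (δ d) t ≡ 0 ⊎ (toℕ d ≤ toℕ t × cum (δ d) t ≡ 1) → cum (δ d) t ≤ 1
  δ≤1 (inj₁ e)       = ≤-trans (≤-reflexive e) z≤n
  δ≤1 (inj₂ (_ , e)) = ≤-reflexive e
... | inj₁ e | inj₁ e′ = inj₁ (trans (cum-+ (δ d) (load ds) t) (cong₂ _+_ e′ e))
... | inj₁ e | inj₂ (d≤t , e′) = inj₂ (≤ℝ-trans {natℝ (k + cum (load (d ∷ ds)) t)} {natℝ (suc k)} {cumulative a t}
  (natℝ-mono-≤ (≤-reflexive (trans (cong (k +_) (trans (cum-+ (δ d) (load ds) t) (cong₂ _+_ e′ e))) (+-comm k 1))))
  (≤ℝ-trans {natℝ (suc k)} {cumulative a d} {cumulative a t} b (cumulative-monotone 0≤a d≤t)))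

load-≤ : ∀ {T} {a : Vector ℝ T} → (∀ t → natℝ 0 ≤ℝ a t) → ∀ ds → Backed a 0 ds → ∀ t →
  natℝ (cum (load ds) t) ≤ℝ cumulative a t
load-≤ {a = a} 0≤a ds bs t with backed-≤ 0≤a 0 ds bs t
... | inj₂ le = le
... | inj₁ e  = ≤ℝ-trans {natℝ (cum (load ds) t)} {natℝ 0} {cumulative a t}
                  (natℝ-mono-≤ (≤-reflexive e)) (0≤cumulative 0≤a t)

-- Triples of periods as agents

record Triple (T : ℕ) : Set where
  constructor triple
  field
    d₁ d₂ d₃ : Fin T
    d₁≤d₂    : toℕ d₁ ≤ toℕ d₂
    d₂≤d₃    : toℕ d₂ ≤ toℕ d₃

  members : List (Fin T)
  members = d₁ ∷ d₂ ∷ d₃ ∷ []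

-- The values are chosen such that meeting some but not all of the requests is
-- worth less than the cheapest charge doing so, and meeting all of them is
-- worth exactly one unit at each of d₁, d₂ and d₃.
agentOf : ∀ {T} → Triple T → Agent T
agentOf {T} (triple d₁ d₂ d₃ _ _) =
  request (suc (T ∸ toℕ d₁)) d₁ 1 ∷ request (suc (T ∸ toℕ d₂)) d₂ 2 ∷ request (4 + (T ∸ toℕ d₃)) d₃ 3 ∷ []

𝟙 : Bool → ℕ
𝟙 true  = 1
𝟙 false = 0

-- An integral stand-in for the real charge of an agent: `usage` stays below it cumulatively, and
-- yet its worth covers the value. To break even is to have a value equal to this worth.
record Analysis {T} (a : Vector ℝ T) (τ : Triple T) (v : ℕ) : Set where
  field
    selected : Bool
    usage    : Vector ℕ T
    usage≤   : ∀ t → natℝ (cum usage t) ≤ℝ cumulative a t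
    value≤   : v ≤ worth usage
    tight    : v ≡ worth usage → ∀ t → usage t ≡ 𝟙 selected * load (Triple.members τ) t

module _ {T} {a : Vector ℝ T} {τ : Triple T} (0≤a : ∀ t → natℝ 0 ≤ℝ a t) where

  open Triple τ

  private
    -- `ds` assigns to each unit that the met requests call for the earliest met deadline calling
    -- for it, so its worth is the least cost of meeting them. `k` is the loss beyond the one unit
    -- that strictness takes.
    partial : ∀ {v} ds k → Backed a 0 ds → suc v + k ≡ foldr (λ d s → price d + s) 0 ds → Analysis a τ v
    partial {v} ds k b e = record
      { selected = false
      ; usage    = load ds
      ; usage≤   = load-≤ 0≤a ds b
      ; value≤   = <⇒≤ v<worth
      ; tight    = λ eq → contradiction eq (<⇒≢ v<worth)
      }
      where
      v<worth : v < worth (load ds)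
      v<worth = ≤-trans (m≤m+n (suc v) k) (≤-reflexive (trans e (sym (worth-load ds))))

    fewer : ∀ {k l d} → k ≤ l → natℝ l ≤ℝ cumulative a d → natℝ k ≤ℝ cumulative a d
    fewer {k} {l} {d} k≤l = ≤ℝ-trans {natℝ k} {natℝ l} {cumulative a d} (natℝ-mono-≤ k≤l)

    x y z : ℕ
    x = T ∸ toℕ d₁
    y = T ∸ toℕ d₂
    z = T ∸ toℕ d₃

  analyse : ∀ {v} → HasValue a (agentOf τ) v → Analysis a τ v
  analyse (met p (met q (met r []))) = record
    { selected = true
    ; usage    = load members
    ; usage≤   = load-≤ 0≤a members (p , q , r , tt)
    ; value≤   = ≤-reflexive (trans (sums x y z) (sym (worth-load members)))
    ; tight    = λ _ t → sym (*-identityˡ (load members t))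
    }
    where
    sums : ∀ x y z → suc x + (suc y + ((4 + z) + 0)) ≡ (2 + x) + ((2 + y) + ((2 + z) + 0))
    sums = solve-∀
  analyse (unmet _ (unmet _ (unmet _ []))) = record
    { selected = false
    ; usage    = load []
    ; usage≤   = load-≤ 0≤a [] tt
    ; value≤   = z≤n
    ; tight    = λ _ _ → refl
    }
  analyse (met p (unmet _ (unmet _ []))) = partial (d₁ ∷ []) 0 (p , tt) (sums x)
    where
    sums : ∀ x → suc (suc x + 0) + 0 ≡ (2 + x) + 0
    sums = solve-∀
  analyse (unmet _ (met q (unmet _ []))) =
    partial (d₂ ∷ d₂ ∷ []) (2 + y) (fewer {1} {2} {d₂} (s≤s z≤n) q , q , tt) (sums y)
    where
    sums : ∀ y → suc (suc y + 0) + (2 + y) ≡ (2 + y) + ((2 + y) + 0)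
    sums = solve-∀
  analyse (unmet _ (unmet _ (met r []))) =
    partial (d₃ ∷ d₃ ∷ d₃ ∷ []) (1 + z + z)
      (fewer {1} {3} {d₃} (s≤s z≤n) r , fewer {2} {3} {d₃} (s≤s (s≤s z≤n)) r , r , tt) (sums z)
    where
    sums : ∀ z → suc ((4 + z) + 0) + (1 + z + z) ≡ (2 + z) + ((2 + z) + ((2 + z) + 0))
    sums = solve-∀
  analyse (met p (met q (unmet _ []))) = partial (d₁ ∷ d₂ ∷ []) 1 (p , q , tt) (sums x y)
    where
    sums : ∀ x y → suc (suc x + (suc y + 0)) + 1 ≡ (2 + x) + ((2 + y) + 0)
    sums = solve-∀
  analyse (met p (unmet _ (met r []))) =
    partial (d₁ ∷ d₃ ∷ d₃ ∷ []) z (p , fewer {2} {3} {d₃} (s≤s (s≤s z≤n)) r , r , tt) (sums x z)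
    where
    sums : ∀ x z → suc (suc x + ((4 + z) + 0)) + z ≡ (2 + x) + ((2 + z) + ((2 + z) + 0))
    sums = solve-∀
  analyse (unmet _ (met q (met r []))) =
    partial (d₂ ∷ d₂ ∷ d₃ ∷ []) y (fewer {1} {2} {d₂} (s≤s z≤n) q , q , r , tt) (sums y z)
    where
    sums : ∀ y z → suc (suc y + ((4 + z) + 0)) + y ≡ (2 + y) + ((2 + y) + ((2 + z) + 0))
    sums = solve-∀

module _ {T n : ℕ} .{{_ : NonZero T}} (τ : Fin n → Triple T) (m : Vector ℕ T) where

  coverInstance : ChargeInstance
  coverInstance = mkInstance T (tabulate m) n (tabulate (agentOf ∘ τ)) (ℤ.+ worth m)

  Covers : (Fin n → Bool) → Set
  Covers z = ∀ t → sum (λ k → 𝟙 (z k) * load (Triple.members (τ k)) t) ≡ m t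

  -- The chain `worth m ≤ sum v ≤ worth total ≤ worth m` closes, through the target, the analyses
  -- and the supplies. Equality in its last link gives `total ≗ m`, and in its middle link that each
  -- agent breaks even.
  achievable⇒cover : Achievable coverInstance → ∃ Covers
  achievable⇒cover (a , (0≤a , ≤supply) , v , hasValue , target≤) = selected , covers
    where
    analysis : ∀ k → Analysis (a k) (τ k) (v k)
    analysis k = analyse (0≤a k) (subst (λ rs → HasValue (a k) rs (v k)) (Vec.lookup∘tabulate (agentOf ∘ τ) k) (hasValue k))

    selected : Fin n → Bool
    selected k = Analysis.selected (analysis k)

    u : Fin n → Vector ℕ T
    u k = Analysis.usage (analysis k)

    total : Vector ℕ T
    total t = sum λ k → u k t

    -- Both ends are integers, so the real allocation in between drops out.
    cum-total≤ : ∀ t → cum total t ≤ cum m t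
    cum-total≤ t = subst (_≤ cum m t) (sym (cum-sum u t)) (natℝ-cancel-≤
      (≤ℝ-trans {natℝ (sum λ k → cum (u k) t)} {sumℝ λ k → natℝ (cum (u k) t)} {natℝ (cum m t)}
        (≈ℝ⇒≤ℝ {natℝ (sum λ k → cum (u k) t)} {sumℝ λ k → natℝ (cum (u k) t)} λ i → sym (sumℝ-natℝ (λ k → cum (u k) t) i))
        (≤ℝ-trans {sumℝ λ k → natℝ (cum (u k) t)} {sumℝ λ k → cumulative (a k) t} {natℝ (cum m t)}
          (sumℝ-mono-≤ℝ {f = λ k → natℝ (cum (u k) t)} {λ k → cumulative (a k) t} λ k → Analysis.usage≤ (analysis k) t)
          (≤ℝ-trans {sumℝ λ k → cumulative (a k) t} {cumulative (λ t → sumℝ λ k → a k t) t} {natℝ (cum m t)}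
            (≈ℝ⇒≤ℝ {sumℝ λ k → cumulative (a k) t} {cumulative (λ t → sumℝ λ k → a k t) t} (sumℝ-cumulative a t))
            (≤ℝ-trans {cumulative (λ t → sumℝ λ k → a k t) t} {cumulative (natℝ ∘ m) t} {natℝ (cum m t)}
              (cumulative-mono-≤ℝ {f = λ t → sumℝ λ k → a k t} {natℝ ∘ m}
                 (λ s → subst (λ x → sumℝ (λ k → a k s) ≤ℝ natℝ x) (Vec.lookup∘tabulate m s) (≤supply s)) t)
              (≈ℝ⇒≤ℝ {cumulative (natℝ ∘ m) t} {natℝ (cum m t)} (cumulative-natℝ m t)))))))

    v≤worth : ∀ k → v k ≤ worth (u k)
    v≤worth k = Analysis.value≤ (analysis k)

    m≤v : worth m ≤ sum v
    m≤v = ℤ.drop‿+≤+ target≤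

    m≤total : worth m ≤ worth total
    m≤total = ≤-trans m≤v (≤-trans (sum-mono-≤ v≤worth) (≤-reflexive (sym (worth-sum u))))

    worth-total≤ : worth total ≤ worth m
    worth-total≤ = subst₂ _≤_ (cong (_+ worth total) (*-zeroʳ T)) (cong (_+ worth m) (*-zeroʳ T))
      (worth-mono {c = 0} {d = 0} z≤n cum-total≤)

    total≡m : total ≗ m
    total≡m = worth-tight 0 cum-total≤ (+-monoʳ-≤ ((2 + T) * 0) m≤total)

    tight : ∀ k → v k ≡ worth (u k)
    tight = sum-tight v≤worth (≤-trans (≤-reflexive (sym (worth-sum u))) (≤-trans worth-total≤ m≤v))

    covers : Covers selected
    covers t = trans (sum-cong-≗ λ k → sym (Analysis.tight (analysis k) (tight k) t)) (total≡m t)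

  cover⇒achievable : ∃ Covers → Achievable coverInstance
  cover⇒achievable (z , covers) = a , (nonneg , feasible) , v , hasValue , ℤ.+≤+ (≤-reflexive worth≡)
    where
    u : Fin n → Vector ℕ T
    u k t = 𝟙 (z k) * load (Triple.members (τ k)) t

    a : Fin n → Vector ℝ T
    a k t = natℝ (u k t)

    nonneg : ∀ k t → natℝ 0 ≤ℝ a k t
    nonneg k t = natℝ-mono-≤ {0} {u k t} z≤n

    feasible : ∀ t → sumℝ (λ k → a k t) ≤ℝ natℝ (lookup (tabulate m) t)
    feasible t = ≈ℝ⇒≤ℝ {sumℝ λ k → a k t} {natℝ (lookup (tabulate m) t)} λ i →
      trans (sumℝ-natℝ (λ k → u k t) i) (cong natℚ (trans (covers t) (sym (Vec.lookup∘tabulate m t))))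

    v : Vector ℕ n
    v k = 𝟙 (z k) * worth (load (Triple.members (τ k)))

    worth≡ : worth m ≡ sum v
    worth≡ = trans (worth-cong λ t → sym (covers t)) (trans (worth-sum u)
      (sum-cong-≗ λ k → worth-* (𝟙 (z k)) (load (Triple.members (τ k)))))

    hasValue : ∀ k → HasValue (a k) (lookup (tabulate (agentOf ∘ τ)) k) (v k)
    hasValue k = subst (λ rs → HasValue (a k) rs (v k)) (sym (Vec.lookup∘tabulate (agentOf ∘ τ) k)) (own (z k) refl)
      where
      open Triple (τ k)
      own : ∀ b → z k ≡ b → HasValue (a k) (agentOf (τ k)) (v k)
      own b z≡b = subst (λ b → HasValue (λ t → natℝ (𝟙 b * load members t)) (agentOf (τ k)) (𝟙 b * worth (load members)))
                    (sym z≡b) (valued b)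
        where
        cum-members : ∀ t → cum (load members) t ≡ cum (δ d₁) t + (cum (δ d₂) t + (cum (δ d₃) t + 0))
        cum-members t = trans (cum-+ (δ d₁) (load (d₂ ∷ d₃ ∷ [])) t) (cong (cum (δ d₁) t +_)
          (trans (cum-+ (δ d₂) (load (d₃ ∷ [])) t) (cong (cum (δ d₂) t +_)
            (trans (cum-+ (δ d₃) (load []) t) (cong (cum (δ d₃) t +_) (cum-0 t))))))

        meets : ∀ w t → w ≤ cum (load members) t → natℝ w ≤ℝ cumulative (λ t → natℝ (𝟙 true * load members t)) t
        meets w t le =
          ≤ℝ-trans {natℝ w} {natℝ (cum (λ t → 1 * load members t) t)} {cumulative (λ t → natℝ (1 * load members t)) t}
          (natℝ-mono-≤ (≤-trans le (≤-reflexive (cum-cong (λ t → sym (*-identityˡ (load members t))) t))))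
          (≈ℝ⇒≤ℝ {natℝ (cum (λ t → 1 * load members t) t)} {cumulative (λ t → natℝ (1 * load members t)) t}
            λ i → sym (cumulative-natℝ (λ t → 1 * load members t) t i))

        misses : ∀ w t → ¬ natℝ (suc w) ≤ℝ cumulative (λ t → natℝ (𝟙 false * load members t)) t
        misses w t le with () ← subst (suc w ≤_) (cum-0 t) (natℝ-cancel-≤
          (≤ℝ-trans {natℝ (suc w)} {cumulative (λ _ → natℝ 0) t} {natℝ (cum (λ _ → 0) t)} le
            (≈ℝ⇒≤ℝ {cumulative (λ _ → natℝ 0) t} {natℝ (cum (λ _ → 0) t)} (cumulative-natℝ (λ _ → 0) t))))

        sums : ∀ x y z → suc x + (suc y + ((4 + z) + 0)) ≡ (2 + x) + ((2 + y) + ((2 + z) + 0))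
        sums = solve-∀

        one : ∀ d t → toℕ d ≤ toℕ t → 1 ≤ cum (δ d) t
        one d t d≤t = ≤-reflexive (sym (cum-δ d t d≤t))

        valued : ∀ b → HasValue (λ t → natℝ (𝟙 b * load members t)) (agentOf (τ k)) (𝟙 b * worth (load members))
        valued false = unmet (misses 0 d₁) (unmet (misses 1 d₂) (unmet (misses 2 d₃) []))
        valued true  = subst (HasValue _ (agentOf (τ k)))
          (trans (sums (T ∸ toℕ d₁) (T ∸ toℕ d₂) (T ∸ toℕ d₃))
            (trans (sym (worth-load members)) (sym (*-identityˡ (worth (load members))))))
          (met (meets 1 d₁ (subst (1 ≤_) (sym (cum-members d₁)) (≤-trans (one d₁ d₁ ≤-refl) (m≤m+n _ _))))
          (met (meets 2 d₂ (subst (2 ≤_) (sym (cum-members d₂))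
            (+-mono-≤ (one d₁ d₂ d₁≤d₂) (≤-trans (one d₂ d₂ ≤-refl) (m≤m+n _ _)))))
          (met (meets 3 d₃ (subst (3 ≤_) (sym (cum-members d₃))
                 (+-mono-≤ (one d₁ d₃ (≤-trans d₁≤d₂ d₂≤d₃))
                   (+-mono-≤ (one d₂ d₃ d₂≤d₃) (≤-trans (one d₃ d₃ ≤-refl) (m≤m+n _ _))))))
          [])))

-- Tilings of a strip and exact covers

δℕ : ℕ → ℕ → ℕ
δℕ zero    zero    = 1
δℕ zero    (suc _) = 0
δℕ (suc _) zero    = 0
δℕ (suc m) (suc n) = δℕ m n

δ-toℕ : ∀ {n} (i j : Fin n) → δ i j ≡ δℕ (toℕ i) (toℕ j)
δ-toℕ zero    zero    = refl
δ-toℕ zero    (suc _) = refl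
δ-toℕ (suc _) zero    = refl
δ-toℕ (suc i) (suc j) = δ-toℕ i j

δ-refl : ∀ {n} (i : Fin n) → δ i i ≡ 1
δ-refl zero    = refl
δ-refl (suc i) = δ-refl i

δ-≢ : ∀ {n} {i j : Fin n} → i ≢ j → δ i j ≡ 0
δ-≢ {i = zero}  {zero}  i≢j = contradiction refl i≢j
δ-≢ {i = zero}  {suc _} i≢j = refl
δ-≢ {i = suc _} {zero}  i≢j = refl
δ-≢ {i = suc i} {suc j} i≢j = δ-≢ (i≢j ∘ cong suc)

δ≡1 : ∀ {n} {i j : Fin n} → δ i j ≡ 1 → i ≡ j
δ≡1 {i = zero}  {zero}  _ = refl
δ≡1 {i = suc i} {suc j} e = cong suc (δ≡1 e)

δ-≗ : ∀ {n} {i j : Fin n} → δ i ≗ δ j → i ≡ j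
δ-≗ {j = j} e = δ≡1 (trans (e j) (δ-refl j))

δ-injective : ∀ {m n} {f : Fin m → Fin n} → (∀ {i j} → f i ≡ f j → i ≡ j) → ∀ i j → δ (f i) (f j) ≡ δ i j
δ-injective {f = f} inj i j with i Fin.≟ j
... | yes refl = trans (δ-refl (f i)) (sym (δ-refl i))
... | no i≢j   = trans (δ-≢ (i≢j ∘ inj)) (sym (δ-≢ i≢j))

δ-combine : ∀ {m n} (i i′ : Fin m) (j j′ : Fin n) → δ (combine i j) (combine i′ j′) ≡ δ i i′ * δ j j′
δ-combine i i′ j j′ with i Fin.≟ i′ | j Fin.≟ j′
... | yes refl | yes refl = trans (δ-refl (combine i j)) (sym (cong₂ _*_ (δ-refl i) (δ-refl j)))
... | no i≢    | _        = trans (δ-≢ (i≢ ∘ Fin.combine-injectiveˡ i j i′ j′)) (sym (cong (_* δ j j′) (δ-≢ i≢)))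
... | yes refl | no j≢    = trans (δ-≢ (j≢ ∘ Fin.combine-injectiveʳ i j i j′))
                              (sym (trans (cong (δ i i *_) (δ-≢ j≢)) (*-zeroʳ (δ i i))))

δ-↑ˡ : ∀ {m} n (i j : Fin m) → δ (i ↑ˡ n) (j ↑ˡ n) ≡ δ i j
δ-↑ˡ n = δ-injective λ {i} {j} → Fin.↑ˡ-injective n i j

δ-↑ʳ : ∀ m {n} (i j : Fin n) → δ (m ↑ʳ i) (m ↑ʳ j) ≡ δ i j
δ-↑ʳ m = δ-injective λ {i} {j} → Fin.↑ʳ-injective m i j

δ-↑ˡ-↑ʳ : ∀ {m n} (i : Fin m) (j : Fin n) → δ (i ↑ˡ n) (m ↑ʳ j) ≡ 0
δ-↑ˡ-↑ʳ zero    j = refl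
δ-↑ˡ-↑ʳ (suc i) j = δ-↑ˡ-↑ʳ i j

δ-↑ʳ-↑ˡ : ∀ {m n} (i : Fin m) (j : Fin n) → δ (m ↑ʳ j) (i ↑ˡ n) ≡ 0
δ-↑ʳ-↑ˡ zero    j = refl
δ-↑ʳ-↑ˡ (suc i) j = δ-↑ʳ-↑ˡ i j

sum-δˡ : ∀ {n} (f : Vector ℕ n) d → sum (λ t → δ d t * f t) ≡ f d
sum-δˡ f d = trans (sum-cong-≗ λ t → *-comm (δ d t) (f t)) (sum-δ f d)

-- By `sum-shift`, the amount that arrives at block `k` when each cell `i` sends `f i` to block
-- `s + i`.
shift : ∀ {n} → ℕ → (Fin n → ℕ) → ℕ → ℕ
shift         (suc s) f zero    = 0
shift         (suc s) f (suc k) = shift s f k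
shift {zero}  zero    f k       = 0
shift {suc n} zero    f zero    = f zero
shift {suc n} zero    f (suc k) = shift zero (f ∘ suc) k

sum-shift : ∀ {n} s (f : Fin n → ℕ) k → sum (λ i → f i * δℕ (s + toℕ i) k) ≡ shift s f k
sum-shift {zero}  zero    f k       = refl
sum-shift {suc n} zero    f zero    = trans (cong₂ _+_ (*-identityʳ (f zero))
  (trans (sum-cong-≗ λ i → *-zeroʳ (f (suc i))) (sum-replicate-zero n))) (+-identityʳ (f zero))
sum-shift {suc n} zero    f (suc k) =
  trans (cong (_+ sum (λ i → f (suc i) * δℕ (toℕ i) k)) (*-zeroʳ (f zero))) (sum-shift zero (f ∘ suc) k)
sum-shift {n}     (suc s) f zero    = trans (sum-cong-≗ λ i → *-zeroʳ (f i)) (sum-replicate-zero n)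
sum-shift         (suc s) f (suc k) = sum-shift s f k

shift-inside : ∀ {n} s (f : Fin n → ℕ) i → shift s f (s + toℕ i) ≡ f i
shift-inside zero    f zero    = refl
shift-inside zero    f (suc i) = shift-inside zero (f ∘ suc) i
shift-inside (suc s) f i       = shift-inside s f i

shift-before : ∀ {n} s (f : Fin n → ℕ) {k} → k < s → shift s f k ≡ 0
shift-before (suc s) f {zero}  _         = refl
shift-before (suc s) f {suc k} (s≤s k<s) = shift-before s f k<s

shift-after : ∀ {n} s (f : Fin n → ℕ) {k} → s + n ≤ k → shift s f k ≡ 0
shift-after {zero}  zero    f _         = refl
shift-after {suc n} zero    f (s≤s n≤k) = shift-after zero (f ∘ suc) n≤k
shift-after         (suc s) f (s≤s le)  = shift-after s f le

sum-+-split : ∀ m {n} (f : Fin (m + n) → ℕ) → sum f ≡ sum (λ i → f (i ↑ˡ n)) + sum (λ j → f (m ↑ʳ j))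
sum-+-split zero    f = refl
sum-+-split (suc m) f = trans (cong (f zero +_) (sum-+-split m (f ∘ suc))) (sym (+-assoc (f zero) _ _))

sum-combine : ∀ m {n} (f : Fin (m * n) → ℕ) → sum f ≡ sum λ (i : Fin m) → sum λ (j : Fin n) → f (combine i j)
sum-combine zero        f = refl
sum-combine (suc m) {n} f =
  trans (sum-+-split n f) (cong (sum (λ j → f (j ↑ˡ (m * n))) +_) (sum-combine m (λ i → f (n ↑ʳ i))))

sum≡0 : ∀ {n} (f : Fin n → ℕ) → sum f ≡ 0 → ∀ i → f i ≡ 0
sum≡0 f e zero    = m+n≡0⇒m≡0 (f zero) e
sum≡0 f e (suc i) = sum≡0 (f ∘ suc) (m+n≡0⇒n≡0 (f zero) e) i

sum≡1 : ∀ {n} (f : Fin n → ℕ) → sum f ≡ 1 → ∃ λ i → f ≗ δ i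
sum≡1 {suc n} f e with f zero in e₀
... | zero  with i , h ← sum≡1 (f ∘ suc) e = suc i , λ { zero → e₀ ; (suc j) → h j }
... | suc zero = zero , λ { zero → e₀ ; (suc j) → sum≡0 (f ∘ suc) (suc-injective e) j }

≤-sum : ∀ {n} (f : Fin n → ℕ) i → f i ≤ sum f
≤-sum f zero    = m≤m+n _ _
≤-sum f (suc i) = ≤-trans (≤-sum (f ∘ suc) i) (m≤n+m _ (f zero))

-- At `c = h` the total is 1, so one tile of colour `h` counts, and counts once. A tile of any other
-- colour is ruled out at its own colour, where the total is 0.
one-hot : ∀ {m n} (a : Fin m → ℕ) (f : Fin m → Fin n) h → (∀ c → sum (λ g → a g * δ (f g) c) ≡ δ h c) →
  ∃ λ g → a ≗ δ g
one-hot a f h e with g , hot ← sum≡1 (λ g → a g * δ (f g) h) (trans (e h) (δ-refl h)) = g , λ g′ → at g′ (g Fin.≟ g′)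
  where
  at-h : ∀ g′ → f g′ ≡ h → a g′ ≡ δ g g′
  at-h g′ e′ = trans (sym (trans (cong (λ c → a g′ * δ c h) e′)
    (trans (cong (a g′ *_) (δ-refl h)) (*-identityʳ (a g′))))) (hot g′)
  fg≡h : f g ≡ h
  fg≡h = δ≡1 (m*n≡1⇒n≡1 (a g) (δ (f g) h) (trans (hot g) (δ-refl g)))
  at : ∀ g′ → Dec (g ≡ g′) → a g′ ≡ δ g g′
  at g′ (yes refl) = at-h g fg≡h
  at g′ (no g≢g′) with f g′ Fin.≟ h
  ... | yes e′ = at-h g′ e′
  ... | no fg′≢h = trans (sym (trans (cong (a g′ *_) (δ-refl (f g′))) (*-identityʳ (a g′))))
    (trans (sum≡0 (λ g → a g * δ (f g) (f g′)) (trans (e (f g′)) (δ-≢ (fg′≢h ∘ sym))) g′) (sym (δ-≢ g≢g′)))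

-- Wang tiles on a strip of N cells, cell i being to the left of cell 1 + i and
-- below cell C + i: a grid of width C whose rows are joined end to end.
record Tiles : Set where
  field
    G H W       : ℕ
    west east   : Fin G → Fin H
    south north : Fin G → Fin W
    edge        : Fin H
    top         : Fin W

module Strip (𝒯 : Tiles) (N C : ℕ) (bottom : ℕ → Fin (Tiles.W 𝒯)) where

  open Tiles 𝒯

  record Tiling : Set where
    field
      tile   : ℕ → Fin G
      first  : west (tile 0) ≡ edge
      horiz  : ∀ i → suc i < N → east (tile i) ≡ west (tile (suc i))
      last   : ∀ i → suc i ≡ N → east (tile i) ≡ edge
      lowest : ∀ i → i < C → south (tile i) ≡ bottom i
      vert   : ∀ i → C + i < N → north (tile i) ≡ south (tile (C + i))
      utmost : ∀ i → i < N → N ≤ C + i → north (tile i) ≡ top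

  -- The bins of a cell are its western colours, its southern colours and its
  -- tiles. Choosing tile g in cell i, as opposed to not choosing it, puts its
  -- eastern and northern colours into the neighbouring cells instead of its
  -- western and southern colours into cell i. With as many places for a colour
  -- as there are tiles with it, neighbours then have to agree.
  B : ℕ
  B = H + (W + G)

  Block : Set
  Block = Fin (N + C)

  Period : Set
  Period = Fin ((N + C) * B)

  westBin : Block → Fin H → Period
  westBin j c = combine j (c ↑ˡ (W + G))

  southBin : Block → Fin W → Period
  southBin j c = combine j (H ↑ʳ (c ↑ˡ G))

  tileBin : Block → Fin G → Period
  tileBin j g = combine j (H ↑ʳ (W ↑ʳ g))

  count : ∀ {n} → (Fin G → Fin n) → Fin n → ℕ
  count f c = sum λ g → δ (f g) c

  -- Cell 0 has no left neighbour that could bring in `edge`, so the place for it is withheld; block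
  -- `N`, behind the last cell, takes only the eastern colour of that cell. In the second clause,
  -- `j <ᵇ N` after the failure of `suc j <ᵇ N` singles out `suc j = N`.
  westCap : ℕ → Fin H → ℕ
  westCap zero    c = count west c ∸ δ edge c
  westCap (suc j) c = if suc j <ᵇ N then count west c else if j <ᵇ N then δ edge c else 0

  -- The first `C` cells have no lower neighbours; the last `C` blocks, from `N` on, take the
  -- northern colours of the top row.
  southCap : ℕ → Fin W → ℕ
  southCap j c = if j <ᵇ C then count south c ∸ δ (bottom j) c else if j <ᵇ N then count south c else δ top c

  tileCap : ℕ → Fin G → ℕ
  tileCap j g = if j <ᵇ N then 1 else 0

  capacity : ℕ → Fin B → ℕ
  capacity j o = [ westCap j , (λ o → [ southCap j , tileCap j ]′ (splitAt W o)) ]′ (splitAt H o)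

  supplyAt : Vector ℕ ((N + C) * B)
  supplyAt t = uncurry (capacity ∘ toℕ) (remQuot {N + C} B t)

  module _ (0<C : 0 < C) where

    own ahead above : Fin N → Block
    own i   = i ↑ˡ C
    ahead i  = fromℕ< (≤-trans (s≤s (Fin.toℕ<n i)) (≤-trans (≤-reflexive (+-comm 1 N)) (+-monoʳ-≤ N 0<C)))
    above i = C+i
      where C+i = fromℕ< (<-≤-trans (+-monoʳ-< C (Fin.toℕ<n i)) (≤-reflexive (+-comm C N)))

    toℕ-ahead : ∀ i → toℕ (ahead i) ≡ suc (toℕ i)
    toℕ-ahead i = Fin.toℕ-fromℕ< _

    toℕ-above : ∀ i → toℕ (above i) ≡ C + toℕ i
    toℕ-above i = Fin.toℕ-fromℕ< _

    private
      in-order : ∀ {m n} (i i′ : Fin m) (o o′ : Fin n) → toℕ i ≤ toℕ i′ → toℕ o ≤ toℕ o′ →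
        toℕ (combine i o) ≤ toℕ (combine i′ o′)
      in-order {n = n} i i′ o o′ i≤i′ o≤o′ =
        subst₂ _≤_ (sym (Fin.toℕ-combine i o)) (sym (Fin.toℕ-combine i′ o′)) (+-mono-≤ (*-monoʳ-≤ n i≤i′) o≤o′)

      west≤south : ∀ (c : Fin H) (c′ : Fin W) → toℕ (c ↑ˡ (W + G)) ≤ toℕ (H ↑ʳ (c′ ↑ˡ G))
      west≤south c c′ rewrite Fin.toℕ-↑ˡ c (W + G) | Fin.toℕ-↑ʳ H (c′ ↑ˡ G) =
        ≤-trans (<⇒≤ (Fin.toℕ<n c)) (m≤m+n H _)

      south≤tile : ∀ (c : Fin W) (g : Fin G) → toℕ (H ↑ʳ (c ↑ˡ G)) ≤ toℕ (H ↑ʳ (W ↑ʳ g))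
      south≤tile c g rewrite Fin.toℕ-↑ʳ H (c ↑ˡ G) | Fin.toℕ-↑ʳ H (W ↑ʳ g) | Fin.toℕ-↑ˡ c G | Fin.toℕ-↑ʳ W g =
        +-monoʳ-≤ H (≤-trans (<⇒≤ (Fin.toℕ<n c)) (m≤m+n W _))

    chosen : Fin N → Fin G → Triple ((N + C) * B)
    chosen i g = triple (tileBin (own i) g) (westBin (ahead i) (east g)) (southBin (above i) (north g))
      (<⇒≤ (Fin.combine-monoˡ-< _ _ (subst₂ _<_ (sym (Fin.toℕ-↑ˡ i C)) (sym (toℕ-ahead i)) ≤-refl)))
      -- For `C = 1` both bins are in the same block, where the western ones come first.
      (in-order (ahead i) (above i) _ _ (subst₂ _≤_ (sym (toℕ-ahead i)) (sym (toℕ-above i)) (+-monoˡ-≤ (toℕ i) 0<C))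
        (west≤south (east g) (north g)))

    unchosen : Fin N → Fin G → Triple ((N + C) * B)
    unchosen i g = triple (westBin (own i) (west g)) (southBin (own i) (south g)) (tileBin (own i) g)
      (in-order (own i) (own i) _ _ ≤-refl (west≤south (west g) (south g)))
      (in-order (own i) (own i) _ _ ≤-refl (south≤tile (south g) g))

    option : Fin N → Fin (G + G) → Triple ((N + C) * B)
    option i o = [ chosen i , unchosen i ]′ (splitAt G o)

    triples : Fin (N * (G + G)) → Triple ((N + C) * B)
    triples k = uncurry option (remQuot {N} (G + G) k)

    triples-chosen : ∀ i g → triples (combine i (g ↑ˡ G)) ≡ chosen i g
    triples-chosen i g = trans (cong (uncurry option) (Fin.remQuot-combine i (g ↑ˡ G)))
      (cong [ chosen i , unchosen i ]′ (Fin.splitAt-↑ˡ G g G))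

    triples-unchosen : ∀ i g → triples (combine i (G ↑ʳ g)) ≡ unchosen i g
    triples-unchosen i g = trans (cong (uncurry option) (Fin.remQuot-combine {n = N} i (G ↑ʳ g)))
      (cong [ chosen i , unchosen i ]′ (Fin.splitAt-↑ʳ G G g))

    Cover : (Fin (N * (G + G)) → Bool) → Set
    Cover z = ∀ t → sum (λ k → 𝟙 (z k) * load (Triple.members (triples k)) t) ≡ supplyAt t

    module Usage (z : Fin (N * (G + G)) → Bool) where

      a b : Fin N → Fin G → ℕ
      a i g = 𝟙 (z (combine i (g ↑ˡ G)))
      b i g = 𝟙 (z (combine i (G ↑ʳ g)))

      via : ∀ {n} → (Fin N → Fin G → ℕ) → (Fin G → Fin n) → Fin n → Fin N → ℕ
      via x f c i = sum λ g → x i g * δ (f g) c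

      usage : Period → ℕ
      usage t = sum λ k → 𝟙 (z k) * load (Triple.members (triples k)) t

      usage-options : ∀ t → usage t ≡ sum λ i →
        sum (λ g → a i g * load (Triple.members (chosen i g)) t) + sum
          (λ g → b i g * load (Triple.members (unchosen i g)) t)
      usage-options t = trans (sum-combine N _) (sum-cong-≗ λ i → trans (sum-+-split G _)
        (cong₂ _+_
          (sum-cong-≗ λ g → cong (λ τ → a i g * load (Triple.members τ) t) (triples-chosen i g))
          (sum-cong-≗ λ g → cong (λ τ → b i g * load (Triple.members τ) t) (triples-unchosen i g))))

      at-block : ∀ s (φ : Fin N → Block) → (∀ i → toℕ (φ i) ≡ s + toℕ i) → ∀ (f : Fin N → ℕ) j →
        sum (λ i → f i * δ (φ i) j) ≡ shift s f (toℕ j)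
      at-block s φ e f j = trans
        (sum-cong-≗ λ i → cong (f i *_) (trans (δ-toℕ (φ i) j) (cong (λ k → δℕ k (toℕ j)) (e i))))
        (sum-shift s f (toℕ j))

      factor : ∀ (x : Fin G → ℕ) d (y : Fin G → ℕ) (l : Fin G → ℕ) → (∀ g → l g ≡ d * y g) →
        sum (λ g → x g * l g) ≡ sum (λ g → x g * y g) * d
      factor x d y l e = trans (sum-cong-≗ λ g → trans (cong (x g *_) (e g)) (swap (x g) d (y g)))
        (sym (*-distribʳ-sum d (λ g → x g * y g)))
        where
        swap : ∀ x d y → x * (d * y) ≡ x * y * d
        swap = solve-∀

      -- A bin is reached from two sides: by the chosen triples of the cell `s` blocks before and by
      -- the unchosen ones of its own cell. For western, southern and tile bins, `s` is 1, `C` and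
      -- 0.
      two-blocks : ∀ s (φ : Fin N → Block) → (∀ i → toℕ (φ i) ≡ s + toℕ i) →
        ∀ j t (x y : Fin N → ℕ) →
        (∀ i → sum (λ g → a i g * load (Triple.members (chosen i g)) t) ≡ x i * δ (φ i) j) →
        (∀ i → sum (λ g → b i g * load (Triple.members (unchosen i g)) t) ≡ y i * δ (own i) j) →
        usage t ≡ shift s x (toℕ j) + shift 0 y (toℕ j)
      two-blocks s φ e j t x y ex ey = trans (usage-options t)
        (trans (sum-cong-≗ λ i → cong₂ _+_ (ex i) (ey i))
          (trans (∑-distrib-+ (λ i → x i * δ (φ i) j) (λ i → y i * δ (own i) j))
            (cong₂ _+_ (at-block s φ e x j) (at-block 0 own (λ i → Fin.toℕ-↑ˡ i C) y j))))

      private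
        δ-west-west : ∀ i c j c′ → δ (westBin i c) (westBin j c′) ≡ δ i j * δ c c′
        δ-west-west i c j c′ = trans (δ-combine i j _ _) (cong (δ i j *_) (δ-↑ˡ (W + G) c c′))
        δ-south-south : ∀ i c j c′ → δ (southBin i c) (southBin j c′) ≡ δ i j * δ c c′
        δ-south-south i c j c′ = trans (δ-combine i j _ _)
          (cong (δ i j *_) (trans (δ-↑ʳ H (c ↑ˡ G) (c′ ↑ˡ G)) (δ-↑ˡ G c c′)))
        δ-tile-tile : ∀ i g j g′ → δ (tileBin i g) (tileBin j g′) ≡ δ i j * δ g g′
        δ-tile-tile i g j g′ = trans (δ-combine i j _ _)
          (cong (δ i j *_) (trans (δ-↑ʳ H (W ↑ʳ g) (W ↑ʳ g′)) (δ-↑ʳ W g g′)))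

        vanish : ∀ {m n} (i j : Fin m) {o o′ : Fin n} → δ o o′ ≡ 0 → δ (combine i o) (combine j o′) ≡ 0
        vanish i j {o} {o′} e = trans (δ-combine i j o o′) (trans (cong (δ i j *_) e) (*-zeroʳ (δ i j)))

        δ-west-south : ∀ i c j c′ → δ (westBin i c) (southBin j c′) ≡ 0
        δ-west-south i c j c′ = vanish i j (δ-↑ˡ-↑ʳ c (c′ ↑ˡ G))
        δ-west-tile : ∀ i c j g → δ (westBin i c) (tileBin j g) ≡ 0
        δ-west-tile i c j g = vanish i j (δ-↑ˡ-↑ʳ c (W ↑ʳ g))
        δ-south-west : ∀ i c j c′ → δ (southBin i c) (westBin j c′) ≡ 0
        δ-south-west i c j c′ = vanish i j (δ-↑ʳ-↑ˡ c′ (c ↑ˡ G))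
        δ-south-tile : ∀ i c j g → δ (southBin i c) (tileBin j g) ≡ 0
        δ-south-tile i c j g = vanish i j (trans (δ-↑ʳ H (c ↑ˡ G) (W ↑ʳ g)) (δ-↑ˡ-↑ʳ c g))
        δ-tile-west : ∀ i g j c → δ (tileBin i g) (westBin j c) ≡ 0
        δ-tile-west i g j c = vanish i j (δ-↑ʳ-↑ˡ c (W ↑ʳ g))
        δ-tile-south : ∀ i g j c → δ (tileBin i g) (southBin j c) ≡ 0
        δ-tile-south i g j c = vanish i j (trans (δ-↑ʳ H (W ↑ʳ g) (c ↑ˡ G)) (δ-↑ʳ-↑ˡ c g))

        only₁ : ∀ {x y z w} → x ≡ w → y ≡ 0 → z ≡ 0 → x + (y + (z + 0)) ≡ w
        only₁ {w = w} refl refl refl = +-identityʳ w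
        only₂ : ∀ {x y z w} → x ≡ 0 → y ≡ w → z ≡ 0 → x + (y + (z + 0)) ≡ w
        only₂ {w = w} refl refl refl = +-identityʳ w
        only₃ : ∀ {x y z w} → x ≡ 0 → y ≡ 0 → z ≡ w → x + (y + (z + 0)) ≡ w
        only₃ {w = w} refl refl refl = +-identityʳ w

      usage-west : ∀ j c → usage (westBin j c) ≡ shift 1 (via a east c) (toℕ j) + shift 0 (via b west c) (toℕ j)
      usage-west j c = two-blocks 1 ahead toℕ-ahead j (westBin j c) (via a east c) (via b west c)
        (λ i → factor (a i) (δ (ahead i) j) (λ g → δ (east g) c) _ λ g →
          only₂ (δ-tile-west (own i) g j c) (δ-west-west (ahead i) (east g) j c) (δ-south-west (above i) (north g) j c))
        (λ i → factor (b i) (δ (own i) j) (λ g → δ (west g) c) _ λ g →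
          only₁ (δ-west-west (own i) (west g) j c) (δ-south-west (own i) (south g) j c) (δ-tile-west (own i) g j c))

      usage-south : ∀ j c → usage (southBin j c) ≡ shift C (via a north c) (toℕ j) + shift 0 (via b south c) (toℕ j)
      usage-south j c = two-blocks C above toℕ-above j (southBin j c) (via a north c) (via b south c)
        (λ i → factor (a i) (δ (above i) j) (λ g → δ (north g) c) _ λ g →
          only₃ (δ-tile-south (own i) g j c) (δ-west-south (ahead i) (east g) j c) (δ-south-south (above i) (north g) j c))
        (λ i → factor (b i) (δ (own i) j) (λ g → δ (south g) c) _ λ g →
          only₂ (δ-west-south (own i) (west g) j c) (δ-south-south (own i) (south g) j c) (δ-tile-south (own i) g j c))

      usage-tile : ∀ j g → usage (tileBin j g) ≡ shift 0 (via a id g) (toℕ j) + shift 0 (via b id g) (toℕ j)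
      usage-tile j g = two-blocks 0 own (λ i → Fin.toℕ-↑ˡ i C) j (tileBin j g) (via a id g) (via b id g)
        (λ i → factor (a i) (δ (own i) j) (λ g′ → δ g′ g) _ λ g′ →
          only₁ (δ-tile-tile (own i) g′ j g) (δ-west-tile (ahead i) (east g′) j g) (δ-south-tile (above i) (north g′) j g))
        (λ i → factor (b i) (δ (own i) j) (λ g′ → δ g′ g) _ λ g′ →
          only₃ (δ-west-tile (own i) (west g′) j g) (δ-south-tile (own i) (south g′) j g) (δ-tile-tile (own i) g′ j g))

      supply-west : ∀ j c → supplyAt (westBin j c) ≡ westCap (toℕ j) c
      supply-west j c = trans (cong (uncurry (capacity ∘ toℕ)) (Fin.remQuot-combine {n = N + C} j (c ↑ˡ (W + G))))
        (cong [ westCap (toℕ j) , _ ]′ (Fin.splitAt-↑ˡ H c (W + G)))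

      supply-south : ∀ j c → supplyAt (southBin j c) ≡ southCap (toℕ j) c
      supply-south j c = trans (cong (uncurry (capacity ∘ toℕ)) (Fin.remQuot-combine {n = N + C} j (H ↑ʳ (c ↑ˡ G))))
        (trans (cong [ westCap (toℕ j) , _ ]′ (Fin.splitAt-↑ʳ H (W + G) (c ↑ˡ G)))
          (cong [ southCap (toℕ j) , tileCap (toℕ j) ]′ (Fin.splitAt-↑ˡ W c G)))

      supply-tile : ∀ j g → supplyAt (tileBin j g) ≡ tileCap (toℕ j) g
      supply-tile j g = trans (cong (uncurry (capacity ∘ toℕ)) (Fin.remQuot-combine {n = N + C} j (H ↑ʳ (W ↑ʳ g))))
        (trans (cong [ westCap (toℕ j) , _ ]′ (Fin.splitAt-↑ʳ H (W + G) (W ↑ʳ g)))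
          (cong [ southCap (toℕ j) , tileCap (toℕ j) ]′ (Fin.splitAt-↑ʳ W G g)))

<ᵇ-true : ∀ {m n} → m < n → (m <ᵇ n) ≡ true
<ᵇ-true {zero}  {suc n} _         = refl
<ᵇ-true {suc m} {suc n} (s≤s m<n) = <ᵇ-true m<n

<ᵇ-false : ∀ {m n} → n ≤ m → (m <ᵇ n) ≡ false
<ᵇ-false {m}     {zero}  _         = refl
<ᵇ-false {suc m} {suc n} (s≤s n≤m) = <ᵇ-false n≤m

δ-sym : ∀ {n} (i j : Fin n) → δ i j ≡ δ j i
δ-sym zero    zero    = refl
δ-sym zero    (suc _) = refl
δ-sym (suc _) zero    = refl
δ-sym (suc i) (suc j) = δ-sym i j

shift-at : ∀ {n} s (f : Fin n → ℕ) {k} (k<n : k < n) → shift s f (s + k) ≡ f (fromℕ< k<n)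
shift-at s f k<n = trans (cong (λ k → shift s f (s + k)) (sym (Fin.toℕ-fromℕ< k<n))) (shift-inside s f (fromℕ< k<n))

-- Equivalence of tilings and exact covers

module StripCover (𝒯 : Tiles) (N C : ℕ) (bottom : ℕ → Fin (Tiles.W 𝒯)) (0<C : 0 < C) (C≤N : C ≤ N) where

  open Tiles 𝒯
  open Strip 𝒯 N C bottom

  private
    Covering : (Fin (N * (G + G)) → Bool) → Set
    Covering = Cover 0<C

    0<N : 0 < N
    0<N = ≤-trans 0<C C≤N

  westCap-inner : ∀ {j} c → suc j < N → westCap (suc j) c ≡ count west c
  westCap-inner c j<N rewrite <ᵇ-true j<N = refl

  westCap-end : ∀ {j} c → suc j ≡ N → westCap (suc j) c ≡ δ edge c
  westCap-end {j} c refl rewrite <ᵇ-false {suc j} {suc j} ≤-refl | <ᵇ-true {j} {suc j} ≤-refl = refl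

  westCap-beyond : ∀ {j} c → N ≤ j → westCap (suc j) c ≡ 0
  westCap-beyond c N≤j rewrite <ᵇ-false (m≤n⇒m≤1+n N≤j) | <ᵇ-false N≤j = refl

  southCap-lowest : ∀ {j} c → j < C → southCap j c ≡ count south c ∸ δ (bottom j) c
  southCap-lowest c j<C rewrite <ᵇ-true j<C = refl

  southCap-inner : ∀ {j} c → C ≤ j → j < N → southCap j c ≡ count south c
  southCap-inner c C≤j j<N rewrite <ᵇ-false C≤j | <ᵇ-true j<N = refl

  southCap-top : ∀ {j} c → N ≤ j → southCap j c ≡ δ top c
  southCap-top c N≤j rewrite <ᵇ-false (≤-trans C≤N N≤j) | <ᵇ-false N≤j = refl

  tileCap-inner : ∀ {j} g → j < N → tileCap j g ≡ 1
  tileCap-inner g j<N rewrite <ᵇ-true j<N = refl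

  tileCap-beyond : ∀ {j} g → N ≤ j → tileCap j g ≡ 0
  tileCap-beyond g N≤j rewrite <ᵇ-false N≤j = refl

  module _ (z : Fin (N * (G + G)) → Bool) where

    open Usage 0<C z

    via-total : (∀ i g → a i g + b i g ≡ 1) → ∀ {n} (f : Fin G → Fin n) c i →
      via a f c i + via b f c i ≡ count f c
    via-total a+b f c i = trans (sym (∑-distrib-+ (λ g → a i g * δ (f g) c) (λ g → b i g * δ (f g) c)))
      (sum-cong-≗ λ g → trans (sym (*-distribʳ-+ (δ (f g) c) (a i g) (b i g)))
        (trans (cong (_* δ (f g) c) (a+b i g)) (*-identityˡ (δ (f g) c))))

    via-one : ∀ i g₀ → a i ≗ δ g₀ → ∀ {n} (f : Fin G → Fin n) c → via a f c i ≡ δ (f g₀) c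
    via-one i g₀ e f c = trans (sum-cong-≗ λ g → cong (_* δ (f g) c) (e g)) (sum-δˡ (λ g → δ (f g) c) g₀)

    via-id : ∀ (x : Fin N → Fin G → ℕ) g i → via x id g i ≡ x i g
    via-id x g i = trans (sum-cong-≗ λ g′ → cong (x i g′ *_) (δ-sym g′ g)) (sum-δ (x i) g)

  tiling⇒cover : Tiling → ∃ Covering
  tiling⇒cover t = z , λ p → subst (λ p → usage p ≡ supplyAt p) (Fin.combine-remQuot {N + C} B p)
                               (at-bin (proj₁ (remQuot {N + C} B p)) (proj₂ (remQuot {N + C} B p)))
    where
    open Tiling t

    is : ℕ → Fin G → Bool
    is k g = does (tile k Fin.≟ g)

    z : Fin (N * (G + G)) → Bool
    z k = uncurry (λ i o → [ is (toℕ i) , not ∘ is (toℕ i) ]′ (splitAt G o)) (remQuot {N} (G + G) k)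

    open Usage 0<C z

    𝟙-is : ∀ k g → 𝟙 (is k g) ≡ δ (tile k) g
    𝟙-is k g with tile k Fin.≟ g
    ... | yes refl = sym (δ-refl (tile k))
    ... | no ≢g    = sym (δ-≢ ≢g)

    a≡ : ∀ i → a i ≗ δ (tile (toℕ i))
    a≡ i g = trans (cong 𝟙 (trans (cong (uncurry λ i o → [ is (toℕ i) , not ∘ is (toℕ i) ]′ (splitAt G o))
      (Fin.remQuot-combine i (g ↑ˡ G)))
      (cong [ is (toℕ i) , not ∘ is (toℕ i) ]′ (Fin.splitAt-↑ˡ G g G)))) (𝟙-is (toℕ i) g)

    b≡ : ∀ i g → b i g ≡ 𝟙 (not (is (toℕ i) g))
    b≡ i g = cong 𝟙 (trans (cong (uncurry λ i o → [ is (toℕ i) , not ∘ is (toℕ i) ]′ (splitAt G o))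
      (Fin.remQuot-combine {N} i (G ↑ʳ g)))
      (cong [ is (toℕ i) , not ∘ is (toℕ i) ]′ (Fin.splitAt-↑ʳ G G g)))

    a+b : ∀ i g → a i g + b i g ≡ 1
    a+b i g = trans (cong₂ _+_ (trans (a≡ i g) (sym (𝟙-is (toℕ i) g))) (b≡ i g)) (complement (is (toℕ i) g))
      where
      complement : ∀ x → 𝟙 x + 𝟙 (not x) ≡ 1
      complement true  = refl
      complement false = refl

    module _ {n} (f : Fin G → Fin n) (c : Fin n) where

      via-a : ∀ s {k} → k < N → shift s (via a f c) (s + k) ≡ δ (f (tile k)) c
      via-a s {k} k<N = trans (shift-at s (via a f c) k<N)
        (trans (via-one z (fromℕ< k<N) (tile (toℕ (fromℕ< k<N))) (a≡ (fromℕ< k<N)) f c)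
        (cong (λ k → δ (f (tile k)) c) (Fin.toℕ-fromℕ< k<N)))

      via-a+b : ∀ {k} → k < N → δ (f (tile k)) c + shift 0 (via b f c) k ≡ count f c
      via-a+b {k} k<N =
        trans (cong₂ _+_ (sym (trans (sym (shift-at 0 (via a f c) k<N)) (via-a 0 k<N))) (shift-at 0 (via b f c) k<N))
        (via-total z a+b f c (fromℕ< k<N))

      via-b : ∀ {k} → k < N → shift 0 (via b f c) k ≡ count f c ∸ δ (f (tile k)) c
      via-b {k} k<N = trans (sym (m+n∸m≡n (δ (f (tile k)) c) _)) (cong (_∸ δ (f (tile k)) c) (via-a+b k<N))

    west-bin : ∀ k c → shift 1 (via a east c) k + shift 0 (via b west c) k ≡ westCap k c
    west-bin zero c = trans (via-b west c 0<N) (cong (λ d → count west c ∸ δ d c) first)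
    west-bin (suc k) c with <-cmp (suc k) N
    ... | tri< k<N _ _ = trans (cong (_+ shift 0 (via b west c) (suc k))
            (trans (via-a east c 1 (<⇒≤ k<N)) (cong (λ d → δ d c) (horiz k k<N))))
            (trans (via-a+b west c k<N) (sym (westCap-inner c k<N)))
    ... | tri≈ _ refl _ = trans (cong₂ _+_ (trans (via-a east c 1 ≤-refl) (cong (λ d → δ d c) (last k refl)))
            (shift-after 0 (via b west c) ≤-refl)) (trans (+-identityʳ (δ edge c)) (sym (westCap-end c refl)))
    ... | tri> _ _ (s≤s N≤k) =
      trans (cong₂ _+_ (shift-after 1 (via a east c) (s≤s N≤k)) (shift-after 0 (via b west c) (m≤n⇒m≤1+n N≤k)))
            (sym (westCap-beyond c N≤k))

    south-bin : ∀ k c → k < N + C → shift C (via a north c) k + shift 0 (via b south c) k ≡ southCap k c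
    south-bin k c k<N+C with k <? C
    ... | yes k<C = trans (cong (_+ shift 0 (via b south c) k) (shift-before C (via a north c) k<C))
            (trans (via-b south c (<-≤-trans k<C C≤N))
              (trans (cong (λ d → count south c ∸ δ d c) (lowest k k<C)) (sym (southCap-lowest c k<C))))
    ... | no k≮C with l , refl ← m≤n⇒∃[o]m+o≡n (≮⇒≥ k≮C) | C + l <? N
    ...   | yes k<N = trans (cong (_+ shift 0 (via b south c) k)
              (trans (via-a north c C (≤-trans (s≤s (m≤n+m l C)) k<N)) (cong (λ d → δ d c) (vert l k<N))))
              (trans (via-a+b south c k<N) (sym (southCap-inner c (m≤m+n C l) k<N)))
    ...   | no k≮N = trans (cong₂ _+_ (trans (via-a north c C l<N) (cong (λ d → δ d c) (utmost l l<N (≮⇒≥ k≮N))))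
              (shift-after 0 (via b south c) (≮⇒≥ k≮N))) (trans (+-identityʳ (δ top c)) (sym (southCap-top c (≮⇒≥ k≮N))))
      where
      l<N : l < N
      l<N = +-cancelˡ-< C l N (<-≤-trans k<N+C (≤-reflexive (+-comm N C)))

    tile-bin : ∀ k g → shift 0 (via a id g) k + shift 0 (via b id g) k ≡ tileCap k g
    tile-bin k g with k <? N
    ... | yes k<N = trans (cong₂ _+_ (trans (shift-at 0 (via a id g) k<N) (via-id z a g _))
      (trans (shift-at 0 (via b id g) k<N) (via-id z b g _)))
            (trans (a+b (fromℕ< k<N) g) (sym (tileCap-inner g k<N)))
    ... | no k≮N = trans (cong₂ _+_ (shift-after 0 (via a id g) (≮⇒≥ k≮N)) (shift-after 0 (via b id g) (≮⇒≥ k≮N)))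
            (sym (tileCap-beyond g (≮⇒≥ k≮N)))

    at-bin : ∀ j o → usage (combine j o) ≡ supplyAt (combine j o)
    at-bin j o =
      subst (λ o → usage (combine j o) ≡ supplyAt (combine j o)) (Fin.join-splitAt H (W + G) o) (split (splitAt H o))
      where
      inner : ∀ o → usage (combine j (H ↑ʳ Fin.join W G o)) ≡ supplyAt (combine j (H ↑ʳ Fin.join W G o))
      inner (inj₁ c) = trans (usage-south j c) (trans (south-bin (toℕ j) c (Fin.toℕ<n j)) (sym (supply-south j c)))
      inner (inj₂ g) = trans (usage-tile j g) (trans (tile-bin (toℕ j) g) (sym (supply-tile j g)))
      split : ∀ o → usage (combine j (Fin.join H (W + G) o)) ≡ supplyAt (combine j (Fin.join H (W + G) o))
      split (inj₁ c) = trans (usage-west j c) (trans (west-bin (toℕ j) c) (sym (supply-west j c)))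
      split (inj₂ o) = subst (λ o → usage (combine j (H ↑ʳ o)) ≡ supplyAt (combine j (H ↑ʳ o)))
        (Fin.join-splitAt W G o) (inner (splitAt W o))

  module _ (edge-tile : ∃ λ g → west g ≡ edge) (bottom-tile : ∀ j → j < C → ∃ λ g → south g ≡ bottom j) where

    -- Makes the truncated subtractions in `westCap` and `southCap` exact: the withheld colour does
    -- occur on some tile.
    δ≤count : ∀ {n} (f : Fin G → Fin n) {d} → (∃ λ g → f g ≡ d) → ∀ c → δ d c ≤ count f c
    δ≤count f (g , refl) c = ≤-sum (λ g → δ (f g) c) g

    -- The tile bins give `a i g + b i g ≡ 1`. So the unchosen colours complement the chosen ones,
    -- and each capacity becomes an equation between the chosen colours of neighbours.
    cover⇒tiling : ∃ Covering → Tiling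
    cover⇒tiling (z , covers) = record
      { tile   = tile
      ; first  = δ-≗ λ c → trans (sym (via-a west c 0<N)) (west-0 0<N c)
      ; horiz  = λ k k<N → δ-≗ λ c → trans (sym (via-a east c (<⇒≤ k<N)))
                   (trans (sym (west-suc k<N c)) (via-a west c k<N))
      ; last   = λ { k refl → δ-≗ λ c → trans (sym (via-a east c ≤-refl)) (east-end c refl) }
      ; lowest = λ k k<C → δ-≗ λ c → trans (sym (via-a south c (<-≤-trans k<C C≤N))) (south-lowest k<C c)
      ; vert   = λ k k<N → δ-≗ λ c → trans (sym (via-a north c (≤-trans (s≤s (m≤n+m k C)) k<N)))
                   (trans (sym (south-inner k<N c)) (via-a south c k<N))
      ; utmost = λ k k<N N≤ → δ-≗ λ c → trans (sym (via-a north c k<N)) (north-top k<N N≤ c)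
      }
      where
      open Usage 0<C z

      at : ∀ {k} → k < N → Fin N
      at k<N = fromℕ< k<N

      block : ∀ k → k < N + C → ∃ λ (j : Block) → toℕ j ≡ k
      block k k<N+C = fromℕ< k<N+C , Fin.toℕ-fromℕ< k<N+C

      west-eq : ∀ k c → k < N + C → shift 1 (via a east c) k + shift 0 (via b west c) k ≡ westCap k c
      west-eq k c k< with j , refl ← block k k< =
        trans (sym (usage-west j c)) (trans (covers (westBin j c)) (supply-west j c))

      south-eq : ∀ k c → k < N + C → shift C (via a north c) k + shift 0 (via b south c) k ≡ southCap k c
      south-eq k c k< with j , refl ← block k k< =
        trans (sym (usage-south j c)) (trans (covers (southBin j c)) (supply-south j c))

      N≤ : ∀ {k} → k < N → k < N + C
      N≤ k<N = ≤-trans k<N (m≤m+n N C)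

      a+b : ∀ i g → a i g + b i g ≡ 1
      a+b i g = trans (cong₂ _+_ (sym (trans (shift-inside 0 (via a id g) i) (via-id z a g i)))
                                 (sym (trans (shift-inside 0 (via b id g) i) (via-id z b g i))))
        (subst (λ k → shift 0 (via a id g) k + shift 0 (via b id g) k ≡ 1) (Fin.toℕ-↑ˡ i C)
          (trans (sym (usage-tile (own 0<C i) g)) (trans (covers (tileBin (own 0<C i) g)) (trans (supply-tile (own 0<C i) g)
            (tileCap-inner g (subst (_< N) (sym (Fin.toℕ-↑ˡ i C)) (Fin.toℕ<n i)))))))

      module _ {n} (f : Fin G → Fin n) (c : Fin n) where

        complement : ∀ {i d} → via b f c i ≡ count f c ∸ d → d ≤ count f c → via a f c i ≡ d
        complement {i} {d} e d≤ = +-cancelʳ-≡ (count f c ∸ d) (via a f c i) d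
          (trans (cong (via a f c i +_) (sym e)) (trans (via-total z a+b f c i) (sym (m+[n∸m]≡n d≤))))

        agree : ∀ {i x} → x + via b f c i ≡ count f c → via a f c i ≡ x
        agree {i} {x} e = +-cancelʳ-≡ (via b f c i) (via a f c i) x (trans (via-total z a+b f c i) (sym e))

      west-0 : ∀ (0<N : 0 < N) c → via a west c (at 0<N) ≡ δ edge c
      west-0 0<N c = complement west c (trans (sym (shift-at 0 (via b west c) 0<N)) (west-eq 0 c (N≤ 0<N)))
        (δ≤count west edge-tile c)

      west-suc : ∀ {k} (k<N : suc k < N) c → via a west c (at k<N) ≡ via a east c (at (<⇒≤ k<N))
      west-suc {k} k<N c = agree west c (trans
        (cong₂ _+_ (sym (shift-at 1 (via a east c) (<⇒≤ k<N))) (sym (shift-at 0 (via b west c) k<N)))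
        (trans (west-eq (suc k) c (N≤ k<N)) (westCap-inner c k<N)))

      east-end : ∀ {k} c (e : suc k ≡ N) → via a east c (at (≤-reflexive e)) ≡ δ edge c
      east-end {k} c e = trans (sym (shift-at 1 (via a east c) (≤-reflexive e)))
        (trans (sym (trans (cong (shift 1 (via a east c) (suc k) +_)
          (shift-after 0 (via b west c) (≤-reflexive (sym e)))) (+-identityʳ _)))
          (trans (west-eq (suc k) c (≤-trans (s≤s (≤-reflexive e))
            (≤-trans (≤-reflexive (+-comm 1 N)) (+-monoʳ-≤ N 0<C)))) (westCap-end c e)))

      south-lowest : ∀ {k} (k<C : k < C) c → via a south c (at (<-≤-trans k<C C≤N)) ≡ δ (bottom k) c
      south-lowest {k} k<C c = complement south c
        (trans (sym (shift-at 0 (via b south c) (<-≤-trans k<C C≤N)))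
          (trans (cong (_+ shift 0 (via b south c) k) (sym (shift-before C (via a north c) k<C)))
            (trans (south-eq k c (N≤ (<-≤-trans k<C C≤N))) (southCap-lowest c k<C))))
        (δ≤count south (bottom-tile k k<C) c)

      south-inner : ∀ {k} (k<N : C + k < N) c → via a south c (at k<N) ≡ via a north c (at (≤-trans (s≤s (m≤n+m k C)) k<N))
      south-inner {k} k<N c = agree south c (trans
        (cong₂ _+_ (sym (shift-at C (via a north c) (≤-trans (s≤s (m≤n+m k C)) k<N)))
          (sym (shift-at 0 (via b south c) k<N)))
        (trans (south-eq (C + k) c (N≤ k<N)) (southCap-inner c (m≤m+n C k) k<N)))

      north-top : ∀ {k} (k<N : k < N) → N ≤ C + k → ∀ c → via a north c (at k<N) ≡ δ top c
      north-top {k} k<N N≤k c = trans (sym (shift-at C (via a north c) k<N))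
        (trans (sym (trans (cong (shift C (via a north c) (C + k) +_) (shift-after 0 (via b south c) N≤k)) (+-identityʳ _)))
          (trans (south-eq (C + k) c (<-≤-trans (+-monoʳ-< C k<N) (≤-reflexive (+-comm C N)))) (southCap-top c N≤k)))

      -- `tile` is defined on all of ℕ; from cell `N` on the condition is void, and `advance`
      -- repeats a tile.
      Choice : ℕ → Fin G → Set
      Choice k g = (k<N : k < N) → a (at k<N) ≗ δ g

      -- The western colours chosen in the next cell amount to the eastern colour of the one tile
      -- chosen here; by `one-hot`, a single tile is chosen there too.
      advance : ∀ {k} → ∃ (Choice k) → Dec (suc k < N) → ∃ (Choice (suc k))
      advance (g , e) (no k≮N)  = g , λ k<N → contradiction k<N k≮N
      advance (g , e) (yes k<N) =
        let g′ , e′ = one-hot (a (at k<N)) west (east g) λ c →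
                        trans (west-suc k<N c) (via-one z (at (<⇒≤ k<N)) g (e (<⇒≤ k<N)) east c)
        in g′ , λ _ → e′

      choose : ∀ k → ∃ (Choice k)
      choose zero    = let g , e = one-hot (a (at 0<N)) west edge (west-0 0<N) in g , λ _ → e
      choose (suc k) = advance (choose k) (suc k <? N)

      tile : ℕ → Fin G
      tile k = proj₁ (choose k)

      via-a : ∀ {n} (f : Fin G → Fin n) c {k} (k<N : k < N) → via a f c (at k<N) ≡ δ (f (tile k)) c
      via-a f c {k} k<N = via-one z (at k<N) (tile k) (proj₂ (choose k) k<N) f c

-- Computations as tilings

tabulate-lookup : {A : Set} {n : ℕ} {f : Fin n → A} {v : Vec A n} → (∀ k → f k ≡ lookup v k) → tabulate f ≡ v
tabulate-lookup {v = v} e = trans (Vec.tabulate-cong e) (Vec.tabulate∘lookup v)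

bitAt : Word → ℕ → Maybe Bool
bitAt []      _       = nothing
bitAt (b ∷ w) zero    = just b
bitAt (b ∷ w) (suc j) = bitAt w j

bitAt-beyond : ∀ w {j} → length w ≤ j → bitAt w j ≡ nothing
bitAt-beyond []      _         = refl
bitAt-beyond (b ∷ w) (s≤s w≤j) = bitAt-beyond w w≤j

-- The tapes of a configuration, seen from their heads: the cell at distance
-- 1 + j consists of the j-th symbols to the left and to the right of each
-- head. A step keeps the heads in place and moves the tapes.
module Rows (M : Machine) where

  open Machine M

  Sym : Set
  Sym = Symbol marks

  tapeCount : ℕ
  tapeCount = 2 + work

  Cell : Set
  Cell = Vec (Sym × Sym) tapeCount

  -- nothing: no state yet. This takes one step, in which each head moves onto
  -- the first symbol of its input.
  Info : Set
  Info = Maybe (Fin states) × Vec Sym tapeCount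

  actionOf : Info → Maybe (Fin states × Vec (Sym × Move) tapeCount)
  actionOf (nothing , _)  = just (start , Vec.replicate tapeCount (blank , right))
  actionOf (just q  , hs) = δᴹ q hs
    where δᴹ = Machine.δ M

  -- `l` is the cell nearer to the head and `r` the one farther away. When a head moves left, the
  -- left half of its tape comes nearer and the right half recedes.
  slide : Move → (l o r : Sym × Sym) → Sym × Sym
  slide left  l o r = proj₁ r , proj₂ l
  slide stay  l o r = o
  slide right l o r = proj₁ l , proj₂ r

  arriving : Sym × Move → Sym × Sym → Sym
  arriving (s , left)  o = proj₁ o
  arriving (s , stay)  o = s
  arriving (s , right) o = proj₂ o

  blankCell : Cell
  blankCell = Vec.replicate tapeCount (blank , blank)

  nextCellBy : Maybe (Fin states × Vec (Sym × Move) tapeCount) → (l o r : Cell) → Cell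
  nextCellBy nothing         l o r = o
  nextCellBy (just (_ , as)) l o r = tabulate λ k → slide (proj₂ (lookup as k)) (lookup l k) (lookup o k) (lookup r k)

  nextInfoBy : Maybe (Fin states × Vec (Sym × Move) tapeCount) → Info → Cell → Info
  nextInfoBy nothing         I o = I
  nextInfoBy (just (q , as)) I o = just q , tabulate λ k → arriving (lookup as k) (lookup o k)

  writtenBy : Maybe (Fin states × Vec (Sym × Move) tapeCount) → Cell
  writtenBy nothing         = blankCell
  writtenBy (just (_ , as)) = tabulate λ k → proj₁ (lookup as k) , proj₁ (lookup as k)

  nextCell : Info → (l o r : Cell) → Cell
  nextCell I = nextCellBy (actionOf I)

  nextInfo : Info → Cell → Info
  nextInfo I = nextInfoBy (actionOf I) I

  -- The symbols written under the heads, to the left of the cell at distance 1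
  -- when the tapes move.
  written : Info → Cell
  written I = writtenBy (actionOf I)

  record Row : Set where
    constructor row
    field
      info  : Info
      cells : ℕ → Cell

  open Row

  leftOf : Row → ℕ → Cell
  leftOf ρ zero    = written (info ρ)
  leftOf ρ (suc j) = cells ρ j

  nextRow : Row → Row
  nextRow ρ = row (nextInfo (info ρ) (cells ρ 0)) λ j → nextCell (info ρ) (leftOf ρ j) (cells ρ j) (cells ρ (suc j))

  rows : Row → ℕ → Row
  rows ρ zero    = ρ
  rows ρ (suc k) = nextRow (rows ρ k)

  symbol : Maybe Bool → Sym
  symbol nothing  = blank
  symbol (just b) = bit b

  inputCell : Maybe Bool → Maybe Bool → Cell
  inputCell x y = (blank , symbol x) ∷ (blank , symbol y) ∷ Vec.replicate work (blank , blank)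

  startInfo : Info
  startInfo = nothing , Vec.replicate tapeCount blank

  startRow : Word → Word → Row
  startRow x y = row startInfo λ j → inputCell (bitAt x j) (bitAt y j)

  isOne : Sym → Bool
  isOne (bit b) = b
  isOne _       = false

  -- The output of a verifier is a single bit, so once it has halted the verdict is the symbol under
  -- the first head.
  accepts : Info → Bool
  accepts (nothing , _)  = false
  accepts (just q  , hs) = is-nothing (Machine.δ M q hs) ∧ isOne (Vec.head hs)

  BlankFrom : ℕ → Row → Set
  BlankFrom b ρ = ∀ j → b ≤ j → cells ρ j ≡ blankCell

  -- The tapes move by at most one cell, so content spreads outwards by at most one cell per step.
  -- This bounds the width of the grid.
  blankFrom-next : ∀ {b ρ} → BlankFrom b ρ → BlankFrom (suc b) (nextRow ρ)
  blankFrom-next {b} {ρ} bl (suc j) (s≤s b≤j)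
    rewrite bl j b≤j | bl (suc j) (m≤n⇒m≤1+n b≤j) | bl (suc (suc j)) (m≤n⇒m≤1+n (m≤n⇒m≤1+n b≤j))
    = stays (actionOf (info ρ))
    where
    slid : ∀ m → slide m (blank , blank) (blank , blank) (blank , blank) ≡ (blank , blank)
    slid left  = refl
    slid stay  = refl
    slid right = refl
    stays : ∀ α → nextCellBy α blankCell blankCell blankCell ≡ blankCell
    stays nothing         = refl
    stays (just (_ , as)) = tabulate-lookup λ k →
      trans (cong (λ p → slide (proj₂ (lookup as k)) p p p) (Vec.lookup-replicate k (blank , blank)))
        (trans (slid (proj₂ (lookup as k))) (sym (Vec.lookup-replicate k (blank , blank))))

  blankFrom-rows : ∀ {b ρ} → BlankFrom b ρ → ∀ k → BlankFrom (k + b) (rows ρ k)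
  blankFrom-rows bl zero    = bl
  blankFrom-rows {ρ = ρ} bl (suc k) = blankFrom-next {ρ = rows ρ k} (blankFrom-rows bl k)

  blankFrom-start : ∀ {x y b} → length x ≤ b → length y ≤ b → BlankFrom b (startRow x y)
  blankFrom-start {x} {y} x≤b y≤b j b≤j =
    cong₂ inputCell (bitAt-beyond x (≤-trans x≤b b≤j)) (bitAt-beyond y (≤-trans y≤b b≤j))

  infix 4 _≈_

  record _≈_ (ρ σ : Row) : Set where
    constructor _,_
    field
      info≡  : info ρ ≡ info σ
      cells≡ : ∀ j → cells ρ j ≡ cells σ j

  open _≈_

  ≈-trans : ∀ {ρ σ τ} → ρ ≈ σ → σ ≈ τ → ρ ≈ τ
  ≈-trans e f = trans (info≡ e) (info≡ f) , λ j → trans (cells≡ e j) (cells≡ f j)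

  nextRow-cong : ∀ {ρ σ} → ρ ≈ σ → nextRow ρ ≈ nextRow σ
  nextRow-cong {ρ} {σ} e = cong₂ nextInfo (info≡ e) (cells≡ e 0) , cell
    where
    left≡ : ∀ j → leftOf ρ j ≡ leftOf σ j
    left≡ zero    = cong written (info≡ e)
    left≡ (suc j) = cells≡ e j
    cell : ∀ j → cells (nextRow ρ) j ≡ cells (nextRow σ) j
    cell j = trans (cong (λ I → nextCell I (leftOf ρ j) (cells ρ j) (cells ρ (suc j))) (info≡ e))
      (trans (cong (λ l → nextCell (info σ) l (cells ρ j) (cells ρ (suc j))) (left≡ j))
        (cong₂ (nextCell (info σ) (leftOf σ j)) (cells≡ e j) (cells≡ e (suc j))))

  rows-cong : ∀ {ρ σ} → ρ ≈ σ → ∀ k → rows ρ k ≈ rows σ k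
  rows-cong e zero    = e
  rows-cong e (suc k) = nextRow-cong (rows-cong e k)

  rows-next : ∀ ρ k → rows (nextRow ρ) k ≡ rows ρ (suc k)
  rows-next ρ zero    = refl
  rows-next ρ (suc k) = cong nextRow (rows-next ρ k)

  nth : List Sym → ℕ → Sym
  nth []       _       = blank
  nth (s ∷ ss) zero    = s
  nth (s ∷ ss) (suc j) = nth ss j

  tapePair : Tape marks → ℕ → Sym × Sym
  tapePair t j = nth (Tape.before t) j , nth (Tape.after t) j

  -- The written symbol acts as a cell at distance 0 on both sides: whichever way the head moves
  -- off, it becomes the nearest symbol on the opposite side.
  pairLeft : Sym → Tape marks → ℕ → Sym × Sym
  pairLeft s t zero    = s , s
  pairLeft s t (suc j) = tapePair t j

  act-pair : ∀ s m t j → tapePair (act (s , m) t) j ≡ slide m (pairLeft s t j) (tapePair t j) (tapePair t (suc j))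
  act-pair s left  (tape []       _ as)       zero    = refl
  act-pair s left  (tape []       _ as)       (suc j) = refl
  act-pair s left  (tape (b ∷ bs) _ as)       zero    = refl
  act-pair s left  (tape (b ∷ bs) _ as)       (suc j) = refl
  act-pair s stay  t                          j       = refl
  act-pair s right (tape bs       _ [])       zero    = refl
  act-pair s right (tape bs       _ [])       (suc j) = refl
  act-pair s right (tape bs       _ (a ∷ as)) zero    = refl
  act-pair s right (tape bs       _ (a ∷ as)) (suc j) = refl

  act-head : ∀ s m t → Tape.head (act (s , m) t) ≡ arriving (s , m) (tapePair t 0)
  act-head s left  (tape []       _ as)       = refl
  act-head s left  (tape (b ∷ bs) _ as)       = refl
  act-head s stay  t                          = refl
  act-head s right (tape bs       _ [])       = refl
  act-head s right (tape bs       _ (a ∷ as)) = refl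

  rowOf : Config M → Row
  rowOf (config q ts) = row (just q , Vec.map Tape.head ts) λ j → tabulate λ k → tapePair (lookup ts k) j

  rowOf-act : ∀ q q′ (as : Vec (Sym × Move) tapeCount) ts → Machine.δ M q (Vec.map Tape.head ts) ≡ just (q′ , as) →
    nextRow (rowOf (config q ts)) ≈ rowOf (config q′ (Vec.zipWith act as ts))
  rowOf-act q q′ as ts e rewrite e = cong (just q′ ,_) (tabulate-lookup heads) , λ j → Vec.tabulate-cong (pairs j)
    where
    pair : ℕ → Cell
    pair j = tabulate λ k → tapePair (lookup ts k) j
    pair-at : ∀ j k → lookup (pair j) k ≡ tapePair (lookup ts k) j
    pair-at j = Vec.lookup∘tabulate (λ k → tapePair (lookup ts k) j)
    moved : ∀ k → act (lookup as k) (lookup ts k) ≡ lookup (Vec.zipWith act as ts) k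
    moved k = sym (Vec.lookup-zipWith act k as ts)
    heads : ∀ k → arriving (lookup as k) (lookup (pair 0) k) ≡ lookup (Vec.map Tape.head (Vec.zipWith act as ts)) k
    heads k = trans (cong (arriving (lookup as k)) (pair-at 0 k))
      (trans (sym (act-head (proj₁ (lookup as k)) (proj₂ (lookup as k)) (lookup ts k)))
        (trans (cong Tape.head (moved k)) (sym (Vec.lookup-map k Tape.head (Vec.zipWith act as ts)))))
    lefts : ℕ → Cell
    lefts zero    = writtenBy (just (q′ , as))
    lefts (suc j) = pair j
    lefts-at : ∀ j k → lookup (lefts j) k ≡ pairLeft (proj₁ (lookup as k)) (lookup ts k) j
    lefts-at zero    = Vec.lookup∘tabulate λ k → proj₁ (lookup as k) , proj₁ (lookup as k)
    lefts-at (suc j) = pair-at j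
    slid : ∀ j k → slide (proj₂ (lookup as k)) (lookup (lefts j) k) (lookup (pair j) k) (lookup (pair (suc j)) k)
                 ≡ tapePair (lookup (Vec.zipWith act as ts) k) j
    slid j k =
      trans (cong (λ l → slide (proj₂ (lookup as k)) l (lookup (pair j) k) (lookup (pair (suc j)) k)) (lefts-at j k))
      (trans (cong₂ (slide (proj₂ (lookup as k)) (pairLeft (proj₁ (lookup as k)) (lookup ts k) j))
        (pair-at j k) (pair-at (suc j) k))
        (trans (sym (act-pair (proj₁ (lookup as k)) (proj₂ (lookup as k)) (lookup ts k) j))
          (cong (λ t → tapePair t j) (moved k))))
    written≡ : writtenBy (actionOf (just q , Vec.map Tape.head ts)) ≡ writtenBy (just (q′ , as))
    written≡ = cong writtenBy e
    pairs : ∀ j k → slide (proj₂ (lookup as k)) (lookup (leftOf (rowOf (config q ts)) j) k)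
      (lookup (pair j) k) (lookup (pair (suc j)) k)
                  ≡ tapePair (lookup (Vec.zipWith act as ts) k) j
    pairs zero    k = trans (cong (λ c → slide (proj₂ (lookup as k)) (lookup c k) (lookup (pair 0) k)
      (lookup (pair 1) k)) written≡) (slid zero k)
    pairs (suc j) k = slid (suc j) k

  rowOf-halted : ∀ q ts → Machine.δ M q (Vec.map Tape.head ts) ≡ nothing →
    nextRow (rowOf (config q ts)) ≈ rowOf (config q ts)
  rowOf-halted q ts e rewrite e = refl , λ j → refl

  rowOf-initial : ∀ x y → nextRow (startRow x y) ≈ rowOf (initial M x y)
  rowOf-initial x y = cong (just start ,_) (tabulate-lookup heads) , λ j → Vec.tabulate-cong (pairs j)
    where
    read : ∀ w → symbol (bitAt w 0) ≡ Tape.head (inputTape w)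
    read []      = refl
    read (b ∷ w) = refl
    rest : ∀ w j → symbol (bitAt w (suc j)) ≡ nth (Tape.after (inputTape w)) j
    rest []          j       = refl
    rest (b ∷ [])    j       = refl
    rest (b ∷ c ∷ w) zero    = refl
    rest (b ∷ c ∷ w) (suc j) = rest (c ∷ w) j
    before≡ : ∀ w j → blank ≡ nth (Tape.before (inputTape w)) j
    before≡ []      j = refl
    before≡ (b ∷ w) j = refl
    heads : ∀ k → arriving (lookup (Vec.replicate tapeCount (blank , right)) k)
      (lookup (inputCell (bitAt x 0) (bitAt y 0)) k)
                ≡ lookup (Vec.map Tape.head (inputTape x ∷ inputTape y ∷ Vec.replicate work emptyTape)) k
    heads zero       = read x
    heads (suc zero) = read y
    heads (suc (suc k)) =
      trans (cong₂ arriving (Vec.lookup-replicate k (blank , right)) (Vec.lookup-replicate k (blank , blank)))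
        (sym (trans (Vec.lookup-map k Tape.head (Vec.replicate work emptyTape))
          (cong Tape.head (Vec.lookup-replicate k emptyTape))))
    blanks : ∀ j (k : Fin work) → lookup (leftOf (startRow x y) j) (suc (suc k)) ≡ (blank , blank)
    blanks zero    k =
      trans (Vec.lookup∘tabulate _ k) (cong (λ a → proj₁ a , proj₁ a) (Vec.lookup-replicate k (blank , right)))
    blanks (suc j) k = Vec.lookup-replicate k (blank , blank)
    lefts : ∀ j → proj₁ (lookup (leftOf (startRow x y) j) zero) ≡ blank × proj₁
      (lookup (leftOf (startRow x y) j) (suc zero)) ≡ blank
    lefts zero    = refl , refl
    lefts (suc j) = refl , refl
    rightwards : Vec (Sym × Move) tapeCount
    rightwards = Vec.replicate tapeCount (blank , right)
    pairs : ∀ j k →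
      slide (proj₂ (lookup rightwards k)) (lookup (leftOf (startRow x y) j) k)
        (lookup (inputCell (bitAt x j) (bitAt y j)) k) (lookup (inputCell (bitAt x (suc j)) (bitAt y (suc j))) k)
      ≡ tapePair (lookup (inputTape x ∷ inputTape y ∷ Vec.replicate work emptyTape) k) j
    pairs j zero       = cong₂ _,_ (trans (proj₁ (lefts j)) (before≡ x j)) (rest x j)
    pairs j (suc zero) = cong₂ _,_ (trans (proj₂ (lefts j)) (before≡ y j)) (rest y j)
    pairs j (suc (suc k)) =
      trans (cong₂ (λ (m : Sym × Move) l → slide (proj₂ m) l (lookup empty k) (lookup empty k))
        (Vec.lookup-replicate k (Symbol.blank , right)) (blanks j k))
        (trans (cong (λ p → blank , proj₂ p) (Vec.lookup-replicate k (blank , blank)))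
          (cong (λ t → tapePair t j) (sym (Vec.lookup-replicate k emptyTape))))
      where
      empty : Vec (Sym × Sym) work
      empty = Vec.replicate work (blank , blank)

  data StepView (q : Fin states) (ts : Vec (Tape marks) tapeCount) : Maybe (Config M) → Set where
    halts : Machine.δ M q (Vec.map Tape.head ts) ≡ nothing → StepView q ts nothing
    moves : ∀ {q′ as} → Machine.δ M q (Vec.map Tape.head ts) ≡ just (q′ , as) →
            StepView q ts (just (config q′ (Vec.zipWith act as ts)))

  stepView : ∀ q ts → StepView q ts (step M (config q ts))
  stepView q ts with Machine.δ M q (Vec.map Tape.head ts) in e
  ... | nothing       = halts e
  ... | just (q′ , a) = moves e

  rows-halted : ∀ c → nextRow (rowOf c) ≈ rowOf c → ∀ t → rows (rowOf c) t ≈ rowOf c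
  rows-halted c e zero    = refl , λ _ → refl
  rows-halted c e (suc t) = ≈-trans (nextRow-cong (rows-halted c e t)) e

  step-halts : ∀ q ts → step M (config q ts) ≡ nothing → Machine.δ M q (Vec.map Tape.head ts) ≡ nothing
  step-halts q ts e with step M (config q ts) | stepView q ts
  step-halts q ts refl | .nothing | halts e = e

  step-moves : ∀ q ts {c} → step M (config q ts) ≡ just c → nextRow (rowOf (config q ts)) ≈ rowOf c
  step-moves q ts e with step M (config q ts) | stepView q ts
  step-moves q ts refl | .(just _) | moves e = rowOf-act q _ _ ts e

  rows-halts : ∀ {c t d} → HaltsWithin M c t d → step M d ≡ nothing × rows (rowOf c) t ≈ rowOf d
  rows-halts {config q ts} {t} (halted e) = e , rows-halted (config q ts) (rowOf-halted q ts (step-halts q ts e)) t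
  rows-halts {config q ts} {suc t} {d} (next {c′ = c′} e h) =
    let e′ , r = rows-halts h
    in e′ , subst (_≈ rowOf d) (rows-next (rowOf (config q ts)) t) (≈-trans (rows-cong (step-moves q ts e) t) r)

  -- One step more than the time of the machine, for the initial move onto the inputs. The number of
  -- rows can be fixed in advance because a halted row repeats itself.
  accepts-computes : ∀ {x y t b} → Computes M x y t (b ∷ []) → accepts (info (rows (startRow x y) (suc t))) ≡ b
  accepts-computes {x} {y} {t} {b} (config q ts , h , out) =
    let e , r = rows-halts h
        r′ = subst (_≈ rowOf (config q ts)) (rows-next (startRow x y) t) (≈-trans (rows-cong (rowOf-initial x y) t) r)
    in trans (cong accepts (info≡ r′)) (accepts-halted ts (step-halts q ts e) out)
    where
    reads : ∀ (t : Tape marks) → readOutput t ≡ (b ∷ []) → isOne (Tape.head t) ≡ b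
    reads (tape _ (bit _) _) e = List.∷-injectiveˡ e
    accepts-halted : ∀ ts → Machine.δ M q (Vec.map Tape.head ts) ≡ nothing → readOutput (Vec.head ts) ≡ (b ∷ []) →
      accepts (just q , Vec.map Tape.head ts) ≡ b
    accepts-halted ts e out rewrite e with t ∷ ts′ ← ts = reads t out

-- Codes for finite types

record Finite (A : Set) : Set where
  field
    size    : ℕ
    enc     : A → Fin size
    dec     : Fin size → A
    -- A retraction is enough. Several codes may stand for one tile, which merely adds copies of it,
    -- and colours occur only as values of `enc`.
    dec-enc : ∀ a → dec (enc a) ≡ a

  enc-injective : ∀ {a b} → enc a ≡ enc b → a ≡ b
  enc-injective {a} {b} e = trans (sym (dec-enc a)) (trans (cong dec e) (dec-enc b))

open Finite

finite-retract : {A B : Set} → Finite B → (f : A → B) (g : B → A) → (∀ a → g (f a) ≡ a) → Finite A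
finite-retract F f g gf = record
  { size    = size F
  ; enc     = enc F ∘ f
  ; dec     = g ∘ dec F
  ; dec-enc = λ a → trans (cong g (dec-enc F (f a))) (gf a)
  }

finite-Fin : ∀ n → Finite (Fin n)
finite-Fin n = record { size = n ; enc = id ; dec = id ; dec-enc = λ _ → refl }

finite-⊤ : Finite ⊤
finite-⊤ = record { size = 1 ; enc = λ _ → zero ; dec = λ _ → tt ; dec-enc = λ _ → refl }

finite-⊎ : {A B : Set} → Finite A → Finite B → Finite (A ⊎ B)
finite-⊎ {A} {B} F G = record
  { size    = size F + size G
  ; enc     = [ (λ a → enc F a ↑ˡ size G) , (λ b → size F ↑ʳ enc G b) ]′
  ; dec     = decode ∘ splitAt (size F)
  ; dec-enc = λ where
      (inj₁ a) → trans (cong decode (Fin.splitAt-↑ˡ (size F) (enc F a) (size G))) (cong inj₁ (dec-enc F a))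
      (inj₂ b) → trans (cong decode (Fin.splitAt-↑ʳ (size F) (size G) (enc G b))) (cong inj₂ (dec-enc G b))
  }
  where
  decode : Fin (size F) ⊎ Fin (size G) → A ⊎ B
  decode = [ inj₁ ∘ dec F , inj₂ ∘ dec G ]′

finite-× : {A B : Set} → Finite A → Finite B → Finite (A × B)
finite-× {A} {B} F G = record
  { size    = size F * size G
  ; enc     = λ (a , b) → combine (enc F a) (enc G b)
  ; dec     = decode ∘ remQuot {size F} (size G)
  ; dec-enc =
    λ (a , b) → trans (cong decode (Fin.remQuot-combine (enc F a) (enc G b))) (cong₂ _,_ (dec-enc F a) (dec-enc G b))
  }
  where
  decode : Fin (size F) × Fin (size G) → A × B
  decode (i , j) = dec F i , dec G j

finite-Bool : Finite Bool
finite-Bool = finite-retract (finite-⊎ finite-⊤ finite-⊤)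
  (λ { true → inj₁ tt ; false → inj₂ tt }) (λ { (inj₁ _) → true ; (inj₂ _) → false })
  λ { true → refl ; false → refl }

finite-Maybe : {A : Set} → Finite A → Finite (Maybe A)
finite-Maybe F = finite-retract (finite-⊎ finite-⊤ F)
  (maybe inj₂ (inj₁ tt)) [ (λ _ → nothing) , just ]′ λ { nothing → refl ; (just _) → refl }

finite-Vec : {A : Set} → Finite A → ∀ n → Finite (Vec A n)
finite-Vec F zero    = finite-retract finite-⊤ (λ _ → tt) (λ _ → []) λ { [] → refl }
finite-Vec F (suc n) = finite-retract (finite-× F (finite-Vec F n))
  (λ { (a ∷ as) → a , as }) (λ (a , as) → a ∷ as) λ { (_ ∷ _) → refl }

finite-Symbol : ∀ n → Finite (Symbol n)
finite-Symbol n = finite-retract (finite-⊎ finite-⊤ (finite-⊎ finite-Bool (finite-Fin n)))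
  (λ { blank → inj₁ tt ; (bit b) → inj₂ (inj₁ b) ; (mark i) → inj₂ (inj₂ i) })
  [ (λ _ → blank) , [ bit , mark ]′ ]′
  λ { blank → refl ; (bit _) → refl ; (mark _) → refl }

-- The tiles of a machine

module MachineTiles (M : Machine) where

  open Machine M using (states; marks)
  open Rows M

  -- A row of guess tiles reads the input and guesses the certificate, rows of
  -- work tiles make the steps, and a row of final tiles checks acceptance. The
  -- first argument of each constructor is nothing or, for final, just _ in the
  -- leftmost tile of a row.
  data Tile : Set where
    guess : (previous : Maybe Bool) (x : Maybe Bool) (allowed : Bool) (y : Maybe Bool) (last : Bool) → Tile
    work  : (l : Maybe Cell) (I : Info) (o : Cell) (r : Maybe Cell) → Tile
    final : (I : Maybe Info) (o : Cell) (last : Bool) → Tile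

  -- A colour inside a work row carries the info of the row and both cells that meet there, so that
  -- each tile learns the state and its neighbours. `guessing` passes on whether the certificate has
  -- reached this far. `boundary` separates the rows joined end to end.
  data HColour : Set where
    boundary : HColour
    guessing : Bool → HColour
    working  : Info → Cell → Cell → HColour
    closing  : HColour

  -- `input` tells whether the cell is the first of its row, what its input bit is and whether the
  -- certificate may extend to it. `never` is the northern colour of no tile and bars final tiles
  -- that reject.
  data VColour : Set where
    input      : Bool → Maybe Bool → Bool → VColour
    content    : Maybe Info → Cell → VColour
    done never : VColour

  -- The guessed bit, unless the certificate has already ended or is full.
  guessed : Maybe Bool → Bool → Maybe Bool → Maybe Bool
  guessed previous allowed y = if allowed ∧ Maybe.fromMaybe true previous then y else nothing

  -- The tiles do not know the width of the grid. The info, handed upwards in the first column only,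
  -- marks where the rows begin.
  owner : Maybe Cell → Info → Maybe Info
  owner nothing  I = just I
  owner (just _) I = nothing

  starter : Maybe Bool → Maybe Info
  starter nothing  = just startInfo
  starter (just _) = nothing

  westOf eastOf : Tile → HColour
  westOf (guess p x al y last) = maybe guessing boundary p
  westOf (work l I o r)        = maybe (λ l → working I l o) boundary l
  westOf (final (just _) o last) = boundary
  westOf (final nothing o last)  = closing
  eastOf (guess p x al y last) = if last then boundary else guessing (is-just (guessed p al y))
  eastOf (work l I o r)        = maybe (working I o) boundary r
  eastOf (final I o last)      = if last then boundary else closing

  southOf northOf : Tile → VColour
  southOf (guess p x al y last)   = input (is-nothing p) x al
  southOf (work l I o r)          = content (owner l I) o
  southOf (final (just I) o last) = if accepts I then content (just I) o else never
  southOf (final nothing o last)  = content nothing o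
  northOf (guess p x al y last)   = content (starter p) (inputCell x (guessed p al y))
  northOf (work l I o r)          =
    content (owner l (nextInfo I o)) (nextCell I (Maybe.fromMaybe (written I) l) o (Maybe.fromMaybe blankCell r))
  northOf (final I o last)        = done

  abstract
    finite-Cell : Finite Cell
    finite-Cell = finite-Vec (finite-× (finite-Symbol marks) (finite-Symbol marks)) tapeCount

    finite-Info : Finite Info
    finite-Info = finite-× (finite-Maybe (finite-Fin states)) (finite-Vec (finite-Symbol marks) tapeCount)

    finite-Tile : Finite Tile
    finite-Tile = finite-retract
      (finite-⊎ (finite-× (finite-Maybe finite-Bool) (finite-× (finite-Maybe finite-Bool) (finite-× finite-Bool
          (finite-× (finite-Maybe finite-Bool) finite-Bool))))
        (finite-⊎ (finite-× (finite-Maybe finite-Cell)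
          (finite-× finite-Info (finite-× finite-Cell (finite-Maybe finite-Cell))))
          (finite-× (finite-Maybe finite-Info) (finite-× finite-Cell finite-Bool))))
      (λ { (guess p x al y last) → inj₁ (p , x , al , y , last)
         ; (work l I o r)        → inj₂ (inj₁ (l , I , o , r))
         ; (final I o last)      → inj₂ (inj₂ (I , o , last)) })
      (λ { (inj₁ (p , x , al , y , last)) → guess p x al y last
         ; (inj₂ (inj₁ (l , I , o , r)))  → work l I o r
         ; (inj₂ (inj₂ (I , o , last)))   → final I o last })
      λ { (guess _ _ _ _ _) → refl ; (work _ _ _ _) → refl ; (final _ _ _) → refl }

    finite-HColour : Finite HColour
    finite-HColour = finite-retract
      (finite-⊎ finite-⊤ (finite-⊎ finite-Bool
        (finite-⊎ (finite-× finite-Info (finite-× finite-Cell finite-Cell)) finite-⊤)))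
      (λ { boundary → inj₁ tt ; (guessing b) → inj₂ (inj₁ b) ; (working I l o) → inj₂ (inj₂ (inj₁ (I , l , o)))
         ; closing → inj₂ (inj₂ (inj₂ tt)) })
      (λ { (inj₁ _) → boundary ; (inj₂ (inj₁ b)) → guessing b ; (inj₂ (inj₂ (inj₁ (I , l , o)))) → working I l o
         ; (inj₂ (inj₂ (inj₂ _))) → closing })
      λ { boundary → refl ; (guessing _) → refl ; (working _ _ _) → refl ; closing → refl }

    finite-VColour : Finite VColour
    finite-VColour = finite-retract
      (finite-⊎ (finite-× finite-Bool (finite-× (finite-Maybe finite-Bool) finite-Bool))
        (finite-⊎ (finite-× (finite-Maybe finite-Info) finite-Cell) finite-Bool))
      (λ { (input f x al) → inj₁ (f , x , al) ; (content I o) → inj₂ (inj₁ (I , o))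
         ; done → inj₂ (inj₂ true) ; never → inj₂ (inj₂ false) })
      (λ { (inj₁ (f , x , al)) → input f x al ; (inj₂ (inj₁ (I , o))) → content I o
         ; (inj₂ (inj₂ true)) → done ; (inj₂ (inj₂ false)) → never })
      λ { (input _ _ _) → refl ; (content _ _) → refl ; done → refl ; never → refl }

  tiles : Tiles
  tiles = record
    { G     = size finite-Tile
    ; H     = size finite-HColour
    ; W     = size finite-VColour
    ; west  = enc finite-HColour ∘ westOf ∘ dec finite-Tile
    ; east  = enc finite-HColour ∘ eastOf ∘ dec finite-Tile
    ; south = enc finite-VColour ∘ southOf ∘ dec finite-Tile
    ; north = enc finite-VColour ∘ northOf ∘ dec finite-Tile
    ; edge  = enc finite-HColour boundary
    ; top   = enc finite-VColour done
    }

≡ᵇ-refl : ∀ n → (n ≡ᵇ n) ≡ true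
≡ᵇ-refl zero    = refl
≡ᵇ-refl (suc n) = ≡ᵇ-refl n

≡ᵇ-≢ : ∀ {m n} → m ≢ n → (m ≡ᵇ n) ≡ false
≡ᵇ-≢ {zero}  {zero}  m≢n = contradiction refl m≢n
≡ᵇ-≢ {zero}  {suc n} m≢n = refl
≡ᵇ-≢ {suc m} {zero}  m≢n = refl
≡ᵇ-≢ {suc m} {suc n} m≢n = ≡ᵇ-≢ (m≢n ∘ cong suc)

bitAt-just : ∀ w {j b} → bitAt w j ≡ just b → j < length w
bitAt-just (_ ∷ w) {zero}  e = z<s
bitAt-just (_ ∷ w) {suc j} e = s≤s (bitAt-just w e)

bitAt-previous : ∀ w j {b} → bitAt w (suc j) ≡ just b → is-just (bitAt w j) ≡ true
bitAt-previous (_ ∷ w)     zero    e = refl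
bitAt-previous (_ ∷ w)     (suc j) e = bitAt-previous w j e

collect : (ℕ → Maybe Bool) → ℕ → Word
collect e zero    = []
collect e (suc n) with e 0
... | nothing = []
... | just b  = b ∷ collect (e ∘ suc) n

Contiguous : (ℕ → Maybe Bool) → ℕ → Set
Contiguous e n = ∀ j → suc j < n → e j ≡ nothing → e (suc j) ≡ nothing

contiguous-nothing : ∀ {e n} → Contiguous e n → e 0 ≡ nothing → ∀ j → j < n → e j ≡ nothing
contiguous-nothing c e₀ zero    _   = e₀
contiguous-nothing c e₀ (suc j) j<n = c j j<n (contiguous-nothing c e₀ j (<⇒≤ j<n))

bitAt-collect : ∀ e n → Contiguous e n → ∀ j → j < n → bitAt (collect e n) j ≡ e j
bitAt-collect e (suc n) c j j<n with e 0 in e₀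
bitAt-collect e (suc n) c j       j<n       | nothing = sym (contiguous-nothing c e₀ j j<n)
bitAt-collect e (suc n) c zero    j<n       | just b  = sym e₀
bitAt-collect e (suc n) c (suc j) (s≤s j<n) | just b  = bitAt-collect (e ∘ suc) n (λ i i<n → c (suc i) (s≤s i<n)) j j<n

length-collect : ∀ e n {P} → (∀ j → j < n → is-just (e j) ≡ true → j < P) → length (collect e n) ≤ P
length-collect e zero    b = z≤n
length-collect e (suc n) b with e 0 in e₀
... | nothing = z≤n
... | just _ with b 0 z<s (cong is-just e₀)
...   | s≤s {n = P} _ = s≤s (length-collect (e ∘ suc) n λ j j<n e → s≤s⁻¹ (b (suc j) (s≤s j<n) e))

-- From accepting computations to tilings

module Tableau (M : Machine) (x : Word) (P k C′ : ℕ) where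

  open Rows M
  open Row
  open MachineTiles M
  open Finite

  C R N : ℕ
  C = suc C′
  -- One row of guess tiles, `k` rows of work tiles and one row of final tiles.
  R = 2 + k
  N = R * C

  lowestColour : ℕ → VColour
  lowestColour j = input (j ≡ᵇ 0) (bitAt x j) (j <ᵇ P)

  bottom : ℕ → Fin (size finite-VColour)
  bottom j = enc finite-VColour (lowestColour j)

  open Strip tiles N C bottom using (Tiling)

  index : ℕ → ℕ → ℕ
  index r j = j + r * C

  C+index : ∀ r j → C + index r j ≡ index (suc r) j
  C+index r j = trans (sym (+-assoc C j (r * C))) (trans (cong (_+ r * C) (+-comm C j)) (+-assoc j C (r * C)))

  index<N : ∀ {r j} → r < R → j < C → index r j < N
  index<N {r} {j} r<R j<C = <-≤-trans (+-monoˡ-< (r * C) j<C) (*-monoˡ-≤ C r<R)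

  headOf : Row → ℕ → Maybe Info
  headOf ρ zero    = just (info ρ)
  headOf ρ (suc _) = nothing

  rowColour : Row → ℕ → VColour
  rowColour ρ j = content (headOf ρ j) (cells ρ j)

  leftCell : Row → ℕ → Maybe Cell
  leftCell ρ zero    = nothing
  leftCell ρ (suc j) = just (cells ρ j)

  rightCell : Row → ℕ → Maybe Cell
  rightCell ρ j = if j ≡ᵇ C′ then nothing else just (cells ρ (suc j))

  workTile : Row → ℕ → Tile
  workTile ρ j = work (leftCell ρ j) (info ρ) (cells ρ j) (rightCell ρ j)

  south-work : ∀ ρ j → southOf (workTile ρ j) ≡ rowColour ρ j
  south-work ρ zero    = refl
  south-work ρ (suc j) = refl

  rightCell-inner : ∀ ρ {j} → suc j < C → rightCell ρ j ≡ just (cells ρ (suc j))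
  rightCell-inner ρ {j} (s≤s j<C′) rewrite ≡ᵇ-≢ (<⇒≢ j<C′) = refl

  rightCell-last : ∀ ρ → rightCell ρ C′ ≡ nothing
  rightCell-last ρ rewrite ≡ᵇ-refl C′ = refl

  -- The last tile of a row takes the cell beyond the row for blank, which is right as long as the
  -- content fits the width.
  rightCell-blank : ∀ ρ → BlankFrom C ρ → ∀ j → j < C → Maybe.fromMaybe blankCell (rightCell ρ j) ≡ cells ρ (suc j)
  rightCell-blank ρ bl j j<C with j ≟ C′
  ... | yes refl rewrite ≡ᵇ-refl C′ = sym (bl C ≤-refl)
  ... | no j≢C′  rewrite ≡ᵇ-≢ j≢C′ = refl

  north-work : ∀ ρ → BlankFrom C ρ → ∀ j → j < C → northOf (workTile ρ j) ≡ rowColour (nextRow ρ) j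
  north-work ρ bl zero    j<C =
    cong (λ c → content _ (nextCell (info ρ) (written (info ρ)) (cells ρ 0) c)) (rightCell-blank ρ bl zero j<C)
  north-work ρ bl (suc j) j<C =
    cong (λ c → content _ (nextCell (info ρ) (cells ρ j) (cells ρ (suc j)) c)) (rightCell-blank ρ bl (suc j) j<C)

  module _ (x≤ : length x + k ≤ C) (P≤ : P + k ≤ C) where

    blank-row : ∀ y → length y ≤ P → ∀ r → r ≤ k → BlankFrom C (rows (startRow x y) r)
    blank-row y y≤P r r≤k j C≤j = blankFrom-rows {ρ = startRow x y}
      (blankFrom-start {x} {y} (m≤m⊔n (length x) (length y)) (m≤n⊔m (length x) (length y))) r j
      (≤-trans (≤-trans (+-monoˡ-≤ (length x ⊔ length y) r≤k) (≤-trans (≤-reflexive (+-comm k _)) bound)) C≤j)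
      where
      bound : length x ⊔ length y + k ≤ C
      bound = subst (_≤ C) (sym (+-distribʳ-⊔ k (length x) (length y))) (⊔-lub x≤ (≤-trans (+-monoˡ-≤ k y≤P) P≤))

    module _ (y : Word) (y≤P : length y ≤ P) (accepted : accepts (info (rows (startRow x y) k)) ≡ true) where

      private
        ρ : ℕ → Row
        ρ = rows (startRow x y)

      previous : ℕ → Maybe Bool
      previous zero    = nothing
      previous (suc j) = just (is-just (bitAt y j))

      guessTile : ℕ → Tile
      guessTile j = guess (previous j) (bitAt x j) (j <ᵇ P) (bitAt y j) (j ≡ᵇ C′)

      finalTile : ℕ → Tile
      finalTile j = final (headOf (ρ k) j) (cells (ρ k) j) (j ≡ᵇ C′)

      -- Off by one: the tiles of row `suc r` have `ρ r` to their south, and work tiles have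
      -- `ρ (suc r)` to their north.
      tileAt : ℕ → ℕ → Tile
      tileAt zero    j = guessTile j
      tileAt (suc r) j = if r <ᵇ k then workTile (ρ r) j else finalTile j

      tileAt-work : ∀ {r} j → r < k → tileAt (suc r) j ≡ workTile (ρ r) j
      tileAt-work j r<k rewrite <ᵇ-true r<k = refl

      tileAt-final : ∀ j → tileAt (suc k) j ≡ finalTile j
      tileAt-final j rewrite <ᵇ-false {k} {k} ≤-refl = refl

      continuing : ∀ j {b} → bitAt y j ≡ just b → Maybe.fromMaybe true (previous j) ≡ true
      continuing zero    _ = refl
      continuing (suc j) e = bitAt-previous y j e

      guessed-y : ∀ j → guessed (previous j) (j <ᵇ P) (bitAt y j) ≡ bitAt y j
      guessed-y j with bitAt y j in e
      ... | nothing with (j <ᵇ P) ∧ Maybe.fromMaybe true (previous j)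
      ...   | true  = refl
      ...   | false = refl
      guessed-y j | just b rewrite <ᵇ-true (≤-trans (bitAt-just y e) y≤P) | continuing j e = refl

      is-first : ∀ j → is-nothing (previous j) ≡ (j ≡ᵇ 0)
      is-first zero    = refl
      is-first (suc j) = refl

      north-guess : ∀ j → northOf (guessTile j) ≡ rowColour (ρ 0) j
      north-guess j =
        trans (cong (λ g → content (starter (previous j)) (inputCell (bitAt x j) g)) (guessed-y j)) (starter≡ j)
        where
        starter≡ : ∀ j → content (starter (previous j)) (inputCell (bitAt x j) (bitAt y j)) ≡ rowColour (ρ 0) j
        starter≡ zero    = refl
        starter≡ (suc j) = refl

      south-final : ∀ j → southOf (finalTile j) ≡ rowColour (ρ k) j
      south-final zero    rewrite accepted = refl
      south-final (suc j) = refl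

      south-row : ∀ {r} → r ≤ k → ∀ j → southOf (tileAt (suc r) j) ≡ rowColour (ρ r) j
      south-row {r} r≤k j with m≤n⇒m<n∨m≡n r≤k
      ... | inj₁ r<k  = trans (cong southOf (tileAt-work j r<k)) (south-work (ρ r) j)
      ... | inj₂ refl = trans (cong southOf (tileAt-final j)) (south-final j)

      north-row : ∀ {r} → r ≤ k → ∀ j → j < C → northOf (tileAt r j) ≡ rowColour (ρ r) j
      north-row {zero}  _   j j<C = north-guess j
      north-row {suc r} r<k j j<C =
        trans (cong northOf (tileAt-work j r<k)) (north-work (ρ r) (blank-row y y≤P r (<⇒≤ r<k)) j j<C)

      data RowKind : ℕ → Set where
        guess-row : RowKind 0
        work-row  : ∀ {r} → r < k → RowKind (suc r)
        final-row : RowKind (suc k)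

      rowKind : ∀ r → r < R → RowKind r
      rowKind zero    _ = guess-row
      rowKind (suc r) (s≤s (s≤s r≤k)) with m≤n⇒m<n∨m≡n r≤k
      ... | inj₁ r<k  = work-row r<k
      ... | inj₂ refl = final-row

      west-first : ∀ {r} → r < R → westOf (tileAt r 0) ≡ boundary
      west-first {r} r<R with rowKind r r<R
      ... | guess-row     = refl
      ... | work-row r<k  = cong westOf (tileAt-work 0 r<k)
      ... | final-row     = cong westOf (tileAt-final 0)

      east-last : ∀ {r} → r < R → eastOf (tileAt r C′) ≡ boundary
      east-last {r} r<R with rowKind r r<R
      ... | guess-row rewrite ≡ᵇ-refl C′ = refl
      ... | work-row {r} r<k  = trans (cong eastOf (tileAt-work C′ r<k))
        (cong (maybe (working (info (ρ r)) (cells (ρ r) C′)) boundary) (rightCell-last (ρ r)))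
      ... | final-row     = trans (cong eastOf (tileAt-final C′)) (closed (headOf (ρ k) C′))
        where
        closed : ∀ I → eastOf (final I (cells (ρ k) C′) (C′ ≡ᵇ C′)) ≡ boundary
        closed I rewrite ≡ᵇ-refl C′ = refl

      east-west : ∀ {r j} → r < R → suc j < C → eastOf (tileAt r j) ≡ westOf (tileAt r (suc j))
      east-west {r} {j} r<R j<C@(s≤s j<C′) with rowKind r r<R
      ... | guess-row = trans (cong (λ l → if l then boundary else guessing
        (is-just (guessed (previous j) (j <ᵇ P) (bitAt y j)))) (≡ᵇ-≢ (<⇒≢ j<C′)))
                          (cong (guessing ∘ is-just) (guessed-y j))
      ... | work-row {r} r<k = trans (cong eastOf (tileAt-work j r<k))
              (trans (cong (maybe (working (info (ρ r)) (cells (ρ r) j)) boundary) (rightCell-inner (ρ r) j<C))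
                (cong westOf (sym (tileAt-work (suc j) r<k))))
      ... | final-row = trans (cong eastOf (tileAt-final j))
              (trans (cong (λ l → if l then boundary else closing) (≡ᵇ-≢ (<⇒≢ j<C′)))
                (cong westOf (sym (tileAt-final (suc j)))))

      tileOf : ℕ → Tile
      tileOf i = tileAt (i / C) (i % C)

      tileOf-index : ∀ r {j} → j < C → tileOf (index r j) ≡ tileAt r j
      tileOf-index r {j} j<C = cong₂ tileAt
        (trans (+-distrib-/-∣ʳ j (n∣m*n r)) (cong₂ _+_ (m<n⇒m/n≡0 j<C) (m*n/n≡m r C)))
        (trans ([m+kn]%n≡m%n j r C) (m<n⇒m%n≡m j<C))

      Position : ℕ → Set
      Position i = ∃₂ λ r j → j < C × i ≡ index r j

      position : ∀ i → Position i
      position i = i / C , i % C , m%n<n i C , m≡m%n+[m/n]*n i C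

      row<R : ∀ r {j} → index r j < N → r < R
      row<R r {j} i<N = *-cancelʳ-< C r R (≤-<-trans (m≤n+m (r * C) j) i<N)

      accepting-tiling : Tiling
      accepting-tiling = record
        { tile   = tile
        ; first  = cong (enc finite-HColour)
          (trans (cong westOf (decoded 0)) (trans (cong westOf (tileOf-index 0 z<s)) (west-first z<s)))
        ; horiz  = λ i i<N → cong (enc finite-HColour)
          (trans (cong eastOf (decoded i)) (trans (horizontal i i<N) (cong westOf (sym (decoded (suc i))))))
        ; last   = λ i e → cong (enc finite-HColour) (trans (cong eastOf (decoded i)) (end i e))
        ; lowest = λ j j<C → cong (enc finite-VColour)
          (trans (cong southOf (decoded j))
            (trans (cong southOf (trans (cong tileOf (sym (+-identityʳ j))) (tileOf-index 0 j<C)))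
                     (cong (λ f → input f (bitAt x j) (j <ᵇ P)) (is-first j))))
        ; vert   = λ i i<N → cong (enc finite-VColour)
          (trans (cong northOf (decoded i)) (trans (vertical i i<N) (cong southOf (sym (decoded (C + i))))))
        ; utmost = λ i i<N N≤ → cong (enc finite-VColour) (trans (cong northOf (decoded i)) (topmost i i<N N≤))
        }
        where
        tile : ℕ → Fin (size finite-Tile)
        tile i = enc finite-Tile (tileOf i)

        decoded : ∀ i → dec finite-Tile (tile i) ≡ tileOf i
        decoded i = dec-enc finite-Tile (tileOf i)

        horizontal : ∀ i → suc i < N → eastOf (tileOf i) ≡ westOf (tileOf (suc i))
        horizontal i i<N with position i
        ... | r , j , j<C , refl with m≤n⇒m<n∨m≡n j<C
        ...   | inj₁ sj<C = trans (cong eastOf (tileOf-index r j<C))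
                  (trans (east-west (row<R r (<⇒≤ i<N)) sj<C) (cong westOf (sym (tileOf-index r sj<C))))
        ...   | inj₂ refl = trans (cong eastOf (tileOf-index r j<C))
                  (trans (east-last (row<R r (<⇒≤ i<N)))
                    (sym (trans (cong westOf (tileOf-index (suc r) {0} z<s)) (west-first (row<R (suc r) {0} i<N)))))

        end : ∀ i → suc i ≡ N → eastOf (tileOf i) ≡ boundary
        end i e =
          trans (cong eastOf (trans (cong tileOf (suc-injective e)) (tileOf-index (suc k) ≤-refl))) (east-last ≤-refl)

        vertical : ∀ i → C + i < N → northOf (tileOf i) ≡ southOf (tileOf (C + i))
        vertical i i<N with position i
        ... | r , j , j<C , refl = trans (cong northOf (tileOf-index r j<C))
              (trans (trans (north-row r≤k j j<C) (sym (south-row r≤k j)))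
                (cong southOf (sym (trans (cong tileOf (C+index r j)) (tileOf-index (suc r) j<C)))))
          where
          r≤k : r ≤ k
          r≤k = s≤s⁻¹ (s≤s⁻¹ (row<R (suc r) (subst (_< N) (C+index r j) i<N)))

        topmost : ∀ i → i < N → N ≤ C + i → northOf (tileOf i) ≡ done
        topmost i i<N N≤ with position i
        ... | r , j , j<C , refl = trans
          (cong northOf (trans (tileOf-index r j<C) (cong (λ r → tileAt r j) r≡))) (cong northOf (tileAt-final j))
          where
          r≡ : r ≡ suc k
          r≡ = ≤-antisym (s≤s⁻¹ (row<R r i<N))
            (s≤s⁻¹ (≮⇒≥ λ sr<R → <⇒≱ (index<N sr<R j<C) (≤-trans N≤ (≤-reflexive (C+index r j)))))

-- From tilings to accepting computations

module TableauSound (M : Machine) (x : Word) (P k C′ : ℕ) where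

  open Rows M
  open Row
  open MachineTiles M
  open Finite
  open Tableau M x P k C′ using (C; R; N; bottom; lowestColour; index; C+index; index<N; headOf; rowColour;
    leftCell; rightCell; rightCell-inner; rightCell-last; blank-row; north-work)
  open Strip tiles N C bottom using (Tiling)

  data GuessView (τ : Tile) (f : Bool) (b : Maybe Bool) (al : Bool) : Set where
    isGuess : ∀ p y last → τ ≡ guess p b al y last → f ≡ is-nothing p → GuessView τ f b al

  guessView : ∀ τ {f b al} → southOf τ ≡ input f b al → GuessView τ f b al
  guessView (guess p b al y last) refl = isGuess p y last refl refl
  guessView (final (just I) o last) e with accepts I
  guessView (final (just I) o last) () | true
  guessView (final (just I) o last) () | false

  data WorkView (τ : Tile) (J : Maybe Info) (o : Cell) : Set where
    isWork : ∀ l I r → τ ≡ work l I o r → J ≡ owner l I → WorkView τ J o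

  workView : ∀ τ {J o} → southOf τ ≡ content J o → northOf τ ≢ done → WorkView τ J o
  workView (work l I o r) refl _ = isWork l I r refl refl
  workView (final _ _ _)  _    n = contradiction refl n

  -- Final tiles show `done` to their north, so no tile fits above them: this keeps them in the last
  -- row.
  south≢done : ∀ τ → southOf τ ≢ done
  south≢done (final (just I) o last) e with accepts I
  south≢done (final (just I) o last) () | true
  south≢done (final (just I) o last) () | false

  -- A tile of the first column is recognised by the colour below it. Its western `boundary` closes
  -- the row before, whose last work tile then cannot claim a cell to its right.
  west-owner : ∀ τ {I o} → southOf τ ≡ content (just I) o → westOf τ ≡ boundary
  west-owner (work nothing I o r)   _ = refl
  west-owner (final (just I) o last) _ = refl

  final-accepts : ∀ τ {I o} → southOf τ ≡ content (just I) o → northOf τ ≡ done → accepts I ≡ true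
  final-accepts (final (just J) o last) e _ with accepts J in acc
  final-accepts (final (just J) o last) refl _ | true = acc

  working-injective : ∀ {I I′ l l′ o o′} → working I l o ≡ working I′ l′ o′ → I ≡ I′ × l ≡ l′ × o ≡ o′
  working-injective refl = refl , refl , refl

  guessing-injective : ∀ {b b′} → guessing b ≡ guessing b′ → b ≡ b′
  guessing-injective refl = refl

  module _ (x≤ : length x + k ≤ C) (P≤ : P + k ≤ C) (tiling : Tiling) where

    open Tiling tiling

    private
      t : ℕ → ℕ → Tile
      t r j = dec finite-Tile (tile (index r j))

      east-west : ∀ {r j} → r < R → suc j < C → eastOf (t r j) ≡ westOf (t r (suc j))
      east-west r<R j<C = enc-injective finite-HColour (horiz _ (index<N r<R j<C))

      east-end : ∀ {r} → suc r < R → eastOf (t r C′) ≡ westOf (t (suc r) 0)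
      east-end {r} r<R = enc-injective finite-HColour (horiz (index r C′) (index<N r<R z<s))

      north-south : ∀ {r j} → suc r < R → j < C → northOf (t r j) ≡ southOf (t (suc r) j)
      north-south {r} {j} r<R j<C = enc-injective finite-VColour (trans
        (vert (index r j) (subst (_< N) (sym (C+index r j)) (index<N r<R j<C)))
        (cong (enc finite-VColour ∘ southOf ∘ dec finite-Tile ∘ tile) (C+index r j)))

      south-lowest : ∀ {j} → j < C → southOf (t 0 j) ≡ lowestColour j
      south-lowest {j} j<C = enc-injective finite-VColour
        (trans (cong (enc finite-VColour ∘ southOf ∘ dec finite-Tile ∘ tile) (+-identityʳ j)) (lowest j j<C))

      north-top : ∀ {j} → j < C → northOf (t (suc k) j) ≡ done
      north-top {j} j<C = enc-injective finite-VColour (utmost _ (index<N {suc k} ≤-refl j<C)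
        (≤-trans (m≤n+m (R * C) j) (≤-reflexive (sym (C+index (suc k) j)))))

      guesses : ∀ {j} → j < C → GuessView (t 0 j) (j ≡ᵇ 0) (bitAt x j) (j <ᵇ P)
      guesses j<C = guessView _ (south-lowest j<C)

      guessOf : Tile → Maybe Bool
      guessOf (guess p _ al y _) = guessed p al y
      guessOf (work _ _ _ _)     = nothing
      guessOf (final _ _ _)      = nothing

      e : ℕ → Maybe Bool
      e j = guessOf (t 0 j)

      guessed-allowed : ∀ p al y → is-just (guessed p al y) ≡ true → al ≡ true
      guessed-allowed p true  y _ = refl
      guessed-allowed p false y ()

      guessed-closed : ∀ al y → guessed (just false) al y ≡ nothing
      guessed-closed true  y = refl
      guessed-closed false y = refl

      <ᵇ-sound : ∀ {m n} → (m <ᵇ n) ≡ true → m < n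
      <ᵇ-sound {zero}  {suc n} _ = z<s
      <ᵇ-sound {suc m} {suc n} e = s≤s (<ᵇ-sound e)

      e-allowed : ∀ j → j < C → is-just (e j) ≡ true → j < P
      e-allowed j j<C ej with t 0 j | guesses j<C
      ... | _ | isGuess p y _ refl _ = <ᵇ-sound (guessed-allowed p (j <ᵇ P) y ej)

      -- The colour between two guess tiles tells the right one that the left one has guessed
      -- nothing, and `guessed` then refuses any further bit.
      contiguous : ∀ τ τ′ {f b al b′ al′} → GuessView τ f b al → GuessView τ′ false b′ al′ → eastOf τ ≡ westOf τ′ →
        guessOf τ ≡ nothing → guessOf τ′ ≡ nothing
      contiguous _ _ {al = al} (isGuess p y false refl _) (isGuess (just c) y′ _ refl _) ew e₀
        with refl ← guessing-injective ew rewrite e₀ = guessed-closed _ y′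

      e-contiguous : Contiguous e C
      e-contiguous j j<C = contiguous (t 0 j) (t 0 (suc j)) (guesses (<⇒≤ j<C)) (guesses j<C) (east-west z<s j<C)

    certificate : Word
    certificate = collect e C

    certificate≤ : length certificate ≤ P
    certificate≤ = length-collect e C e-allowed

    private
      ρ : ℕ → Row
      ρ = rows (startRow x certificate)

      north-guess : ∀ j τ → GuessView τ (j ≡ᵇ 0) (bitAt x j) (j <ᵇ P) → bitAt certificate j ≡ guessOf τ →
        northOf τ ≡ rowColour (ρ 0) j
      north-guess zero    _ (isGuess nothing  y _ refl _) eq =
        cong (λ g → content (just startInfo) (inputCell (bitAt x 0) g)) (sym eq)
      north-guess (suc j) _ (isGuess (just _) y _ refl _) eq =
        cong (λ g → content nothing (inputCell (bitAt x (suc j)) g)) (sym eq)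

      module _ {r : ℕ} (r<k : r < k) (bl : BlankFrom C (ρ r)) (south≡ : ∀ j → j < C → southOf (t (suc r) j) ≡ rowColour (ρ r) j) where

        r+1<R : suc (suc r) < R
        r+1<R = s≤s (s≤s r<k)

        works : ∀ {j} → j < C → WorkView (t (suc r) j) (headOf (ρ r) j) (cells (ρ r) j)
        works {j} j<C =
          workView _ (south≡ j j<C) λ n → south≢done (t (suc (suc r)) j) (trans (sym (north-south r+1<R j<C)) n)

        Known : ℕ → Set
        Known j = ∃ λ r′ → t (suc r) j ≡ work (leftCell (ρ r) j) (info (ρ r)) (cells (ρ r) j) r′

        known-first : ∀ τ → WorkView τ (just (info (ρ r))) (cells (ρ r) 0) → ∃ λ r′ →
          τ ≡ work nothing (info (ρ r)) (cells (ρ r) 0) r′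
        known-first _ (isWork nothing I r′ refl refl) = r′ , refl

        -- The colour between two work tiles acts in both directions: it fixes the info and the left
        -- cell of the right tile, and the right cell of the left tile.
        known-next : ∀ {l I o o′ r′} τ → WorkView τ nothing o′ → eastOf (work l I o r′) ≡ westOf τ →
          r′ ≡ just o′ × ∃ λ r″ → τ ≡ work (just o) I o′ r″
        known-next {r′ = just _} _ (isWork (just _) I r″ refl _) ew
          with refl , refl , refl ← working-injective ew = refl , r″ , refl

        known : ∀ j → j < C → Known j
        known zero    j<C = known-first _ (works j<C)
        known (suc j) j<C = proj₂ (known-next {l = leftCell (ρ r) j} {r′ = proj₁ (known j (<⇒≤ j<C))} _
          (works j<C) (trans (cong eastOf (sym (proj₂ (known j (<⇒≤ j<C))))) (east-west (<⇒≤ r+1<R) j<C)))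

        right-cell : ∀ {j} (j<C : j < C) → proj₁ (known j j<C) ≡ rightCell (ρ r) j
        right-cell {j} j<C with m≤n⇒m<n∨m≡n j<C
        ... | inj₁ sj<C = trans (proj₁ (known-next {l = leftCell (ρ r) j} {r′ = proj₁ (known j j<C)} _
          (works sj<C) (trans (cong eastOf (sym (proj₂ (known j j<C)))) (east-west (<⇒≤ r+1<R) sj<C))))
                (sym (rightCell-inner (ρ r) sj<C))
        ... | inj₂ refl = trans (at-end (trans (cong eastOf (sym (proj₂ (known C′ j<C)))) (trans (east-end r+1<R)
                (west-owner (t (suc (suc r)) 0)
                  (trans (sym (north-south r+1<R z<s)) (cong northOf (proj₂ (known 0 z<s))))))))
                    (sym (rightCell-last (ρ r)))
          where
          at-end : ∀ {I o} {c : Maybe Cell} → maybe (working I o) boundary c ≡ boundary → c ≡ nothing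
          at-end {c = nothing} _ = refl

        north-next : ∀ j → j < C → southOf (t (suc (suc r)) j) ≡ rowColour (ρ (suc r)) j
        north-next j j<C = trans (sym (north-south r+1<R j<C))
          (trans (cong northOf (trans (proj₂ (known j j<C))
            (cong (work (leftCell (ρ r) j) (info (ρ r)) (cells (ρ r) j)) (right-cell j<C))))
            (north-work (ρ r) bl j j<C))

      -- Induction from row to row: the southern colours of a row determine its tiles, and thereby
      -- the southern colours of the next row.
      south-row : ∀ r → r ≤ k → ∀ j → j < C → southOf (t (suc r) j) ≡ rowColour (ρ r) j
      south-row zero    _   j j<C = trans (sym (north-south (s≤s (s≤s z≤n)) j<C))
        (north-guess j (t 0 j) (guesses j<C) (bitAt-collect e C e-contiguous j j<C))
      south-row (suc r) r<k j j<C =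
        north-next r<k (blank-row x≤ P≤ certificate certificate≤ r (<⇒≤ r<k)) (south-row r (<⇒≤ r<k)) j j<C

    tiling-accepts : accepts (info (rows (startRow x certificate) k)) ≡ true
    tiling-accepts = final-accepts (t (suc k) 0) (south-row k ≤-refl 0 z<s) (north-top z<s)

-- Writing down the instances

length-encodeℕ≥1 : ∀ n → 1 ≤ length (encodeℕ n)
length-encodeℕ≥1 n with fromℕ n
... | 0ᵇ       = s≤s z≤n
... | 2[1+ _ ] = s≤s z≤n
... | 1+[2 _ ] = s≤s z≤n

length-concatMap : {A B : Set} (e : A → List B) → (∀ a → 1 ≤ length (e a)) → ∀ as → length as ≤ length (concatMap e as)
length-concatMap e e≥1 []       = z≤n
length-concatMap e e≥1 (a ∷ as) =
  ≤-trans (+-mono-≤ (e≥1 a) (length-concatMap e e≥1 as)) (≤-reflexive (sym (List.length-++ (e a))))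

All-tabulate : {A : Set} {P : A → Set} {n : ℕ} (f : Fin n → A) → (∀ i → P (f i)) → All P (Vec.toList (tabulate f))
All-tabulate {n = zero}  f p = []
All-tabulate {n = suc n} f p = p zero ∷ All-tabulate (f ∘ suc) (p ∘ suc)

All-concatMap-tabulate : {A B : Set} {P : B → Set} {n : ℕ} (e : A → List B) (f : Fin n → A) →
  (∀ i → All P (e (f i))) → All P (concatMap e (Vec.toList (tabulate f)))
All-concatMap-tabulate {n = zero}  e f p = []
All-concatMap-tabulate {n = suc n} e f p = All.++⁺ (p zero) (All-concatMap-tabulate e (f ∘ suc) (p ∘ suc))

sum-≤ : ∀ {n k} {f : Vector ℕ n} → (∀ i → f i ≤ k) → sum f ≤ n * k
sum-≤ {zero}  f≤k = z≤n
sum-≤ {suc n} f≤k = +-mono-≤ (f≤k zero) (sum-≤ (f≤k ∘ suc))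

-- For `T` periods and `n` agents, both at most the size, values are at most `4 + T`. The target is
-- at most `T (2 + T) n`: it sums, over `T` periods, a price of at most `2 + T` times a supply of at
-- most `n`.
numberBound : Polynomial
numberBound = (con 4 ⊕ X) ⊕ (X ⊗ ((con 2 ⊕ X) ⊗ X))

module _ {T n : ℕ} .{{_ : NonZero T}} (τ : Fin n → Triple T) (m : Vector ℕ T) where

  private
    I : ChargeInstance
    I = coverInstance τ m

    s : ℕ
    s = length (encodeCharge I)

    agentPart : List ℕ
    agentPart = concatMap agentNumbers (Vec.toList (tabulate (agentOf ∘ τ)))

    -- Each period contributes its supply and each agent at least its number of requests to the
    -- encoding, and every number takes at least one bit.
    total≤s : T + n ≤ s
    total≤s = begin
      T + n                                             ≤⟨ +-monoʳ-≤ T n≤ ⟩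
      T + length agentPart                              ≤⟨ +-mono-≤
        (≤-reflexive (sym (Vec.length-toList (tabulate m)))) (n≤1+n _) ⟩
      length (Vec.toList (tabulate m)) + suc (length agentPart)
        ≡⟨ List.length-++ (Vec.toList (tabulate m)) ⟨
      length (Vec.toList (tabulate m) ++ n ∷ agentPart) ≤⟨ m≤n+m _ 2 ⟩
      length (chargeNumbers I)                          ≤⟨ length-concatMap encodeℕ length-encodeℕ≥1 (chargeNumbers I) ⟩
      length (concatMap encodeℕ (chargeNumbers I))      ≤⟨ n≤1+n _ ⟩
      s                                                 ∎
      where
      open ≤-Reasoning
      n≤ : n ≤ length agentPart
      n≤ = ≤-trans (≤-reflexive (sym (Vec.length-toList (tabulate (agentOf ∘ τ)))))
        (length-concatMap agentNumbers (λ _ → s≤s z≤n) (Vec.toList (tabulate (agentOf ∘ τ))))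

    T≤s : T ≤ s
    T≤s = m+n≤o⇒m≤o T total≤s

    n≤s : n ≤ s
    n≤s = m+n≤o⇒n≤o T total≤s

  cover-periods : PeriodsBoundedBy X I
  cover-periods = T≤s

  cover-deadlines : DeadlinesPerAgent 3 I
  cover-deadlines = VecAll.tabulate⁺ λ _ → refl

  cover-demands : DemandsBoundedBy 3 I
  cover-demands = VecAll.tabulate⁺ λ _ → s≤s z≤n ∷ s≤s (s≤s z≤n) ∷ ≤-refl ∷ []

  cover-numbers : (∀ t → m t ≤ n) → All (_≤ ⟦ numberBound ⟧ s) (chargeNumbers I)
  cover-numbers m≤n =
    target≤ ∷ ≤-trans T≤s s≤ ∷ All.++⁺ (All-tabulate m λ t → ≤-trans (m≤n t) n≤)
      (n≤ ∷ All-concatMap-tabulate agentNumbers (agentOf ∘ τ) agent≤)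
    where
    bound : ℕ
    bound = ⟦ numberBound ⟧ s
    small : ∀ {k} → k ≤ 4 + s → k ≤ bound
    small k≤ = ≤-trans k≤ (m≤m+n (4 + s) _)
    s≤ : s ≤ bound
    s≤ = small (m≤n+m s 4)
    n≤ : n ≤ bound
    n≤ = ≤-trans n≤s s≤
    target≤ : worth m ≤ bound
    target≤ = ≤-trans (sum-≤ λ t → *-mono-≤ (+-monoʳ-≤ 2 (m∸n≤m T (toℕ t))) (m≤n t))
      (≤-trans (*-mono-≤ T≤s (*-mono-≤ (+-monoʳ-≤ 2 T≤s) n≤s)) (m≤n+m _ (4 + s)))
    value≤ : ∀ {c} → c ≤ 4 → (d : Fin T) → c + (T ∸ toℕ d) ≤ bound
    value≤ c≤4 d = small (+-mono-≤ c≤4 (≤-trans (m∸n≤m T (toℕ d)) T≤s))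
    deadline≤ : (d : Fin T) → suc (toℕ d) ≤ bound
    deadline≤ d = ≤-trans (Fin.toℕ<n d) (≤-trans T≤s s≤)
    constant≤ : ∀ {c} → c ≤ 4 → c ≤ bound
    constant≤ c≤4 = small (≤-trans c≤4 (m≤m+n 4 s))
    1≤4 : 1 ≤ 4
    1≤4 = s≤s z≤n
    2≤4 : 2 ≤ 4
    2≤4 = s≤s (s≤s z≤n)
    3≤4 : 3 ≤ 4
    3≤4 = n≤1+n 3
    agent≤ : ∀ k → All (_≤ bound) (agentNumbers (agentOf (τ k)))
    agent≤ k =
      constant≤ 3≤4 ∷
      value≤ 1≤4 d₁ ∷ deadline≤ d₁ ∷ constant≤ 1≤4 ∷
      value≤ 1≤4 d₂ ∷ deadline≤ d₂ ∷ constant≤ 2≤4 ∷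
      value≤ ≤-refl d₃ ∷ deadline≤ d₃ ∷ constant≤ 3≤4 ∷ []
      where open Triple (τ k)

-- Concatenations and sums over ranges

concatFin : {A : Set} (n : ℕ) → (Fin n → List A) → List A
concatFin zero    f = []
concatFin (suc n) f = f zero ++ concatFin n (f ∘ suc)

-- Splits off the last index because `forWord` does.
concatBelow : {A : Set} (n : ℕ) → (ℕ → List A) → List A
concatBelow zero    f = []
concatBelow (suc n) f = concatBelow n f ++ f n

concatFin-cong : {A : Set} {n : ℕ} {f g : Fin n → List A} → (∀ i → f i ≡ g i) → concatFin n f ≡ concatFin n g
concatFin-cong {n = zero}  e = refl
concatFin-cong {n = suc n} e = cong₂ _++_ (e zero) (concatFin-cong (e ∘ suc))

concatBelow-suc : {A : Set} (n : ℕ) (f : ℕ → List A) → concatBelow (suc n) f ≡ f 0 ++ concatBelow n (f ∘ suc)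
concatBelow-suc zero    f = sym (List.++-identityʳ (f 0))
concatBelow-suc (suc n) f = trans (cong (_++ f (suc n)) (concatBelow-suc n f)) (List.++-assoc (f 0) _ _)

concatFin-toℕ : {A : Set} (n : ℕ) (f : ℕ → List A) → concatFin n (f ∘ toℕ) ≡ concatBelow n f
concatFin-toℕ zero    f = refl
concatFin-toℕ (suc n) f = trans (cong (f 0 ++_) (concatFin-toℕ n (f ∘ suc))) (sym (concatBelow-suc n f))

concatFin-+ : {A : Set} (m {n} : ℕ) (f : Fin (m + n) → List A) →
  concatFin (m + n) f ≡ concatFin m (λ i → f (i ↑ˡ n)) ++ concatFin n (λ j → f (m ↑ʳ j))
concatFin-+ zero    f = refl
concatFin-+ (suc m) f = trans (cong (f zero ++_) (concatFin-+ m (f ∘ suc))) (sym (List.++-assoc (f zero) _ _))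

concatFin-* : {A : Set} (m {n} : ℕ) (f : Fin (m * n) → List A) →
  concatFin (m * n) f ≡ concatFin m (λ i → concatFin n λ j → f (combine i j))
concatFin-* zero        f = refl
concatFin-* (suc m) {n} f =
  trans (concatFin-+ n f) (cong (concatFin n (λ j → f (j ↑ˡ (m * n))) ++_) (concatFin-* m (λ i → f (n ↑ʳ i))))

concatMap-tabulate : {A B : Set} {n : ℕ} (e : A → List B) (f : Fin n → A) →
  concatMap e (Vec.toList (tabulate f)) ≡ concatFin n (e ∘ f)
concatMap-tabulate {n = zero}  e f = refl
concatMap-tabulate {n = suc n} e f = cong (e (f zero) ++_) (concatMap-tabulate e (f ∘ suc))

toList-tabulate : {A : Set} {n : ℕ} (f : Fin n → A) → Vec.toList (tabulate f) ≡ concatFin n λ i → f i ∷ []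
toList-tabulate {n = zero}  f = refl
toList-tabulate {n = suc n} f = cong (f zero ∷_) (toList-tabulate (f ∘ suc))

sumBelow : ℕ → (ℕ → ℕ) → ℕ
sumBelow zero    f = 0
sumBelow (suc n) f = sumBelow n f + f n

sumBelow-suc : ∀ n f → sumBelow (suc n) f ≡ f 0 + sumBelow n (f ∘ suc)
sumBelow-suc zero    f = +-comm 0 (f 0)
sumBelow-suc (suc n) f = trans (cong (_+ f (suc n)) (sumBelow-suc n f)) (+-assoc (f 0) _ _)

sum-toℕ : ∀ n (f : ℕ → ℕ) → sum {n} (f ∘ toℕ) ≡ sumBelow n f
sum-toℕ zero    f = refl
sum-toℕ (suc n) f = trans (cong (f 0 +_) (sum-toℕ n (f ∘ suc))) (sym (sumBelow-suc n f))

sumBelow-const : ∀ n c → sumBelow n (λ _ → c) ≡ n * c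
sumBelow-const zero    c = refl
sumBelow-const (suc n) c = trans (cong (_+ c) (sumBelow-const n c)) (+-comm (n * c) c)

-- A generator as a number in unary, as opposed to `Spells`, a generator as a list of encoded
-- numbers; `num` leads from the former to the latter.
record Counts {k} (g : Gen k) (ρ : Vec Word k) (n : ℕ) : Set where
  constructor counts
  field counted : length (⟦ g ⟧ᴳ ρ) ≡ n

open Counts

record Spells {k} (g : Gen k) (ρ : Vec Word k) (ns : List ℕ) : Set where
  constructor spells
  field spelled : ⟦ g ⟧ᴳ ρ ≡ concatMap encodeℕ ns

open Spells

⨁ : ∀ {k} n → (Fin n → Gen k) → Gen k
⨁ zero    f = lit []
⨁ (suc n) f = f zero ⊹ ⨁ n (f ∘ suc)

onesᴳ : ∀ {k} → ℕ → Gen k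
onesᴳ n = lit (ones n)

polyᴳ : ∀ {k} → Polynomial → Fin k → Gen k
polyᴳ X       i = var i
polyᴳ (con c) i = onesᴳ c
polyᴳ (p ⊕ q) i = polyᴳ p i ⊹ polyᴳ q i
polyᴳ (p ⊗ q) i = for (polyᴳ p i) (polyᴳ q (suc i))

module _ {k} {ρ : Vec Word k} where

  counts-ones : ∀ n → Counts (onesᴳ n) ρ n
  counts-ones n = counts (length-ones n)

  counts-⊹ : ∀ {g h m n} → Counts g ρ m → Counts h ρ n → Counts (g ⊹ h) ρ (m + n)
  counts-⊹ {g} cg ch = counts (trans (List.length-++ (⟦ g ⟧ᴳ ρ)) (cong₂ _+_ (counted cg) (counted ch)))

  counts-drop : ∀ {g h m n} → Counts g ρ m → Counts h ρ n → Counts (drop g h) ρ (n ∸ m)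
  counts-drop {g} {h} cg ch =
    counts (trans (List.length-drop (length (⟦ g ⟧ᴳ ρ)) (⟦ h ⟧ᴳ ρ)) (cong₂ _∸_ (counted ch) (counted cg)))

  counts-for : ∀ {g h n} (f : ℕ → ℕ) → Counts g ρ n → (∀ w → Counts h (w ∷ ρ) (f (length w))) →
    Counts (for g h) ρ (sumBelow n f)
  counts-for {g} {h} f (counts refl) ch = counts (loop-length (⟦ g ⟧ᴳ ρ))
    where
    loop-length : ∀ w → length (forWord w λ u → ⟦ h ⟧ᴳ (u ∷ ρ)) ≡ sumBelow (length w) f
    loop-length []      = refl
    loop-length (b ∷ w) = trans (List.length-++ (forWord w _)) (cong₂ _+_ (loop-length w) (counted (ch w)))

  counts-times : ∀ {g h m n} → Counts g ρ m → (∀ w → Counts h (w ∷ ρ) n) → Counts (for g h) ρ (m * n)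
  counts-times {m = m} {n} cg ch = subst (Counts _ ρ) (sumBelow-const m n) (counts-for (λ _ → n) cg ch)

  counts-⨁ : ∀ {n} {g : Fin n → Gen k} (f : Fin n → ℕ) → (∀ i → Counts (g i) ρ (f i)) → Counts (⨁ n g) ρ (sum f)
  counts-⨁ {zero}  f c = counts refl
  counts-⨁ {suc n} f c = counts-⊹ (c zero) (counts-⨁ (f ∘ suc) (c ∘ suc))

  spells-num : ∀ {g n} → Counts g ρ n → Spells (num g) ρ (n ∷ [])
  spells-num (counts e) = spells (trans (cong encodeℕ e) (sym (List.++-identityʳ _)))

  spells-[] : Spells (lit []) ρ []
  spells-[] = spells refl

  spells-⊹ : ∀ {g h ms ns} → Spells g ρ ms → Spells h ρ ns → Spells (g ⊹ h) ρ (ms ++ ns)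
  spells-⊹ {ms = ms} {ns} (spells e) (spells e′) = spells (trans (cong₂ _++_ e e′) (sym (List.concatMap-++ encodeℕ ms ns)))

  spells-⨁ : ∀ {n} {g : Fin n → Gen k} {f : Fin n → List ℕ} → (∀ i → Spells (g i) ρ (f i)) →
    Spells (⨁ n g) ρ (concatFin n f)
  spells-⨁ {zero}  s = spells-[]
  spells-⨁ {suc n} s = spells-⊹ (s zero) (spells-⨁ (s ∘ suc))

  spells-for : ∀ {g h n} {f : ℕ → List ℕ} → Counts g ρ n → (∀ w → Spells h (w ∷ ρ) (f (length w))) →
    Spells (for g h) ρ (concatBelow n f)
  spells-for {g} {h} {f = f} (counts refl) sh = spells (loop-spells (⟦ g ⟧ᴳ ρ))
    where
    loop-spells : ∀ w → (forWord w λ u → ⟦ h ⟧ᴳ (u ∷ ρ)) ≡ concatMap encodeℕ (concatBelow (length w) f)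
    loop-spells []      = refl
    loop-spells (b ∷ w) = trans (cong₂ _++_ (loop-spells w) (spelled (sh w)))
      (sym (List.concatMap-++ encodeℕ (concatBelow (length w) f) (f (length w))))

counts-poly : ∀ p {k} {ρ : Vec Word k} i → Counts (polyᴳ p i) ρ (⟦ p ⟧ (length (lookup ρ i)))
counts-poly X       i = counts refl
counts-poly (con c) i = counts-ones c
counts-poly (p ⊕ q) i = counts-⊹ (counts-poly p i) (counts-poly q i)
counts-poly (p ⊗ q) i = counts-times (counts-poly p i) λ w → counts-poly q (suc i)

-- case (drop i g) …, for unary i and g, tests whether i < g.
below : ∀ {k} → Fin k → Gen k → Gen k → Gen k → Gen k
below i g inside outside = case (drop (var i) g) outside λ _ → inside

counts-below : ∀ {k} {ρ : Vec Word k} {i g inside outside m a b} → Counts g ρ m → Counts inside ρ a → Counts outside ρ b →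
  Counts (below i g inside outside) ρ (if length (lookup ρ i) <ᵇ m then a else b)
counts-below {ρ = ρ} {i} {g} {inside} {outside} (counts refl) (counts refl) (counts refl) =
  counts (select (lookup ρ i) (⟦ g ⟧ᴳ ρ))
  where
  select : ∀ v w → length (caseWord (List.drop (length v) w) (⟦ outside ⟧ᴳ ρ) λ _ → ⟦ inside ⟧ᴳ ρ)
                 ≡ (if length v <ᵇ length w then length (⟦ inside ⟧ᴳ ρ) else length (⟦ outside ⟧ᴳ ρ))
  select []      []      = refl
  select []      (_ ∷ _) = refl
  select (_ ∷ v) []      = refl
  select (_ ∷ v) (_ ∷ w) = select v w

counts-zero? : ∀ {k} {ρ : Vec Word k} {i inside outside} {f : ℕ → ℕ} → Counts inside ρ (f 0) →
  (∀ j → length (lookup ρ i) ≡ suc j → Counts outside ρ (f (suc j))) → Counts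
    (case (var i) inside λ _ → outside) ρ (f (length (lookup ρ i)))
counts-zero? {ρ = ρ} {i} {inside} {outside} {f} c₀ c₁ = counts (select (lookup ρ i) refl)
  where
  select : ∀ w → lookup ρ i ≡ w → length (caseWord w (⟦ inside ⟧ᴳ ρ) λ _ → ⟦ outside ⟧ᴳ ρ) ≡ f (length w)
  select []      e = counted c₀
  select (b ∷ w) e = counted (c₁ (length w) (cong length e))

-- Dropping as many bits as the index says and testing what remains reads the bit at that index.
counts-bitAt : ∀ {k} {ρ : Vec Word k} {i v u w} (f : Maybe Bool → ℕ) → Counts u ρ (f nothing) →
  (∀ b → Counts (w b) ρ (f (just b))) →
  Counts (case (drop (var i) (var v)) u w) ρ (f (bitAt (lookup ρ v) (length (lookup ρ i))))
counts-bitAt {ρ = ρ} {i} {v} {u} {w} f cu cw = counts (select (lookup ρ i) (lookup ρ v))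
  where
  select : ∀ j x → length (caseWord (List.drop (length j) x) (⟦ u ⟧ᴳ ρ) λ b → ⟦ w b ⟧ᴳ ρ) ≡ f (bitAt x (length j))
  select []      []      = counted cu
  select []      (b ∷ _) = counted (cw b)
  select (_ ∷ j) []      = counted cu
  select (_ ∷ j) (_ ∷ x) = select j x

if-float : {A B : Set} (f : A → B) (b : Bool) {u v : A} → (if b then f u else f v) ≡ f (if b then u else v)
if-float f true  = refl
if-float f false = refl

if-η : ∀ b → (if b then true else false) ≡ b
if-η true  = refl
if-η false = refl

fin⇒nonZero : ∀ {n} → Fin n → NonZero n
fin⇒nonZero {suc n} _ = _

-- What `agentNumbers` gives for `agentOf`, with the deadlines as natural numbers.
tripleNumbers : (T a b c : ℕ) → List ℕ
tripleNumbers T a b c =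
  3 ∷ suc (T ∸ a) ∷ suc a ∷ 1 ∷ suc (T ∸ b) ∷ suc b ∷ 2 ∷ 4 + (T ∸ c) ∷ suc c ∷ 3 ∷ []

tripleᴳ : ∀ {k} (t a b c : Gen k) → Gen k
tripleᴳ t a b c =
  num (onesᴳ 3) ⊹ num (onesᴳ 1 ⊹ drop a t) ⊹ num (onesᴳ 1 ⊹ a) ⊹ num (onesᴳ 1) ⊹
  num (onesᴳ 1 ⊹ drop b t) ⊹ num (onesᴳ 1 ⊹ b) ⊹ num (onesᴳ 2) ⊹
  num (onesᴳ 4 ⊹ drop c t) ⊹ num (onesᴳ 1 ⊹ c) ⊹ num (onesᴳ 3)

spells-triple : ∀ {k} {ρ : Vec Word k} {t a b c T l m n} → Counts t ρ T → Counts a ρ l → Counts b ρ m → Counts c ρ n →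
  Spells (tripleᴳ t a b c) ρ (tripleNumbers T l m n)
spells-triple {ρ = ρ} ct ca cb cc =
  spells-⊹ (one 3) (spells-⊹ (value 1 ca) (spells-⊹ (deadline ca) (spells-⊹ (one 1)
    (spells-⊹ (value 1 cb) (spells-⊹ (deadline cb) (spells-⊹ (one 2)
      (spells-⊹ (value 4 cc) (spells-⊹ (deadline cc) (one 3)))))))))
  where
  one : ∀ n → Spells (num (onesᴳ n)) ρ (n ∷ [])
  one n = spells-num (counts-ones n)
  value : ∀ v {g d} → Counts g ρ d → Spells (num (onesᴳ v ⊹ drop g _)) ρ (v + (_ ∸ d) ∷ [])
  value v c = spells-num (counts-⊹ (counts-ones v) (counts-drop c ct))
  deadline : ∀ {g d} → Counts g ρ d → Spells (num (onesᴳ 1 ⊹ g)) ρ (suc d ∷ [])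
  deadline c = spells-num (counts-⊹ (counts-ones 1) c)

-- Generators for the strip instances

module StripGen (𝒯 : Tiles) (β : Bool → Maybe Bool → Bool → Fin (Tiles.W 𝒯)) (Nᵖ Cᵖ Pᵖ : Polynomial) where

  open Tiles 𝒯

  bottom : Word → ℕ → Fin W
  bottom x j = β (j ≡ᵇ 0) (bitAt x j) (j <ᵇ ⟦ Pᵖ ⟧ (length x))

  module At (x : Word) = Strip 𝒯 (⟦ Nᵖ ⟧ (length x)) (⟦ Cᵖ ⟧ (length x)) (bottom x)

  -- `B` and `count` depend on the tiles alone, so any strip will do.
  open Strip 𝒯 0 0 (bottom []) using (B; count)

  Tᵖ : Polynomial
  Tᵖ = (Nᵖ ⊕ Cᵖ) ⊗ con B

  -- `i` is the variable whose length is the index of the block or cell, `v` the one that holds the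
  -- input.
  module _ {k} (i v : Fin k) where

    westᴳ : Fin H → Gen k
    westᴳ c = case (var i) (onesᴳ (count west c ∸ δ edge c)) λ _ →
      below i (polyᴳ Nᵖ v) (onesᴳ (count west c))
        -- The index is `suc j` here, so the test `j <ᵇ N` of `westCap` reads `suc j <ᵇ suc N`.
        (below i (onesᴳ 1 ⊹ polyᴳ Nᵖ v) (onesᴳ (δ edge c)) (onesᴳ 0))

    -- `β` depends on three finite data only. The possible capacities are therefore constants, and
    -- nested tests select among them.
    lowestᴳ : Fin W → Gen k
    lowestᴳ c = case (var i) (withFirst true) λ _ → withFirst false
      where
      leaf : Bool → Maybe Bool → Bool → Gen k
      leaf f b al = onesᴳ (count south c ∸ δ (β f b al) c)
      withBit : Bool → Maybe Bool → Gen k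
      withBit f b = below i (polyᴳ Pᵖ v) (leaf f b true) (leaf f b false)
      withFirst : Bool → Gen k
      withFirst f = case (drop (var i) (var v)) (withBit f nothing) λ b → withBit f (just b)

    southᴳ : Fin W → Gen k
    southᴳ c = below i (polyᴳ Cᵖ v) (lowestᴳ c) (below i (polyᴳ Nᵖ v) (onesᴳ (count south c)) (onesᴳ (δ top c)))

    tileᴳ : Fin G → Gen k
    tileᴳ g = below i (polyᴳ Nᵖ v) (onesᴳ 1) (onesᴳ 0)

    capacityᴳ : Fin B → Gen k
    capacityᴳ o = [ westᴳ , (λ o → [ southᴳ , tileᴳ ]′ (splitAt W o)) ]′ (splitAt H o)

    positionᴳ : Gen k → Fin B → Gen k
    positionᴳ g o = for g (onesᴳ B) ⊹ onesᴳ (toℕ o)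

    priceᴳ : Fin B → Gen k
    priceᴳ o = onesᴳ 2 ⊹ drop (positionᴳ (var i) o) (polyᴳ Tᵖ v)

    westOffset : Fin H → Fin B
    westOffset c = c ↑ˡ (W + G)

    southOffset : Fin W → Fin B
    southOffset c = H ↑ʳ (c ↑ˡ G)

    tileOffset : Fin G → Fin B
    tileOffset g = H ↑ʳ (W ↑ʳ g)

    chosenᴳ unchosenᴳ : Fin G → Gen k
    chosenᴳ g = tripleᴳ (polyᴳ Tᵖ v) (positionᴳ (var i) (tileOffset g))
      (positionᴳ (onesᴳ 1 ⊹ var i) (westOffset (east g))) (positionᴳ (polyᴳ Cᵖ v ⊹ var i) (southOffset (north g)))
    unchosenᴳ g = tripleᴳ (polyᴳ Tᵖ v) (positionᴳ (var i) (westOffset (west g)))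
      (positionᴳ (var i) (southOffset (south g))) (positionᴳ (var i) (tileOffset g))

    optionᴳ : Fin (G + G) → Gen k
    optionᴳ o = [ chosenᴳ , unchosenᴳ ]′ (splitAt G o)

    module _ (ρ : Vec Word k) where

      private
        x : Word
        x = lookup ρ v
        j : ℕ
        j = length (lookup ρ i)
        N C P T : ℕ
        N = ⟦ Nᵖ ⟧ (length x)
        C = ⟦ Cᵖ ⟧ (length x)
        P = ⟦ Pᵖ ⟧ (length x)
        T = ⟦ Tᵖ ⟧ (length x)

      counts-west : ∀ c → Counts (westᴳ c) ρ (At.westCap x j c)
      counts-west c = counts-zero? {f = λ j → At.westCap x j c} (counts-ones (count west c ∸ δ edge c)) λ j′ e →
        subst (λ l → Counts _ ρ (if l <ᵇ N then count west c else if l <ᵇ suc N then δ edge c else 0)) e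
          (counts-below (counts-poly Nᵖ v) (counts-ones (count west c))
            (counts-below (counts-⊹ (counts-ones 1) (counts-poly Nᵖ v)) (counts-ones (δ edge c)) (counts-ones 0)))

      counts-lowest : ∀ c → Counts (lowestᴳ c) ρ (count south c ∸ δ (bottom x j) c)
      counts-lowest c = counts-zero? {f = λ l → leaf (l ≡ᵇ 0) (bitAt x j) (j <ᵇ P)} (withFirst true) λ _ _ → withFirst false
        where
        leaf : Bool → Maybe Bool → Bool → ℕ
        leaf f b al = count south c ∸ δ (β f b al) c
        withBit : ∀ f b → Counts (below i (polyᴳ Pᵖ v) (onesᴳ (leaf f b true)) (onesᴳ (leaf f b false))) ρ
          (leaf f b (j <ᵇ P))
        withBit f b = subst (Counts _ ρ) (trans (if-float (leaf f b) (j <ᵇ P)) (cong (leaf f b) (if-η (j <ᵇ P))))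
          (counts-below (counts-poly Pᵖ v) (counts-ones (leaf f b true)) (counts-ones (leaf f b false)))
        withFirst : ∀ f → Counts _ ρ (leaf f (bitAt x j) (j <ᵇ P))
        withFirst f = counts-bitAt (λ b → leaf f b (j <ᵇ P)) (withBit f nothing) λ b → withBit f (just b)

      counts-south : ∀ c → Counts (southᴳ c) ρ (At.southCap x j c)
      counts-south c = counts-below (counts-poly Cᵖ v) (counts-lowest c)
        (counts-below (counts-poly Nᵖ v) (counts-ones (count south c)) (counts-ones (δ top c)))

      counts-tile : ∀ g → Counts (tileᴳ g) ρ (At.tileCap x j g)
      counts-tile g = counts-below (counts-poly Nᵖ v) (counts-ones 1) (counts-ones 0)

      counts-capacity : ∀ o → Counts (capacityᴳ o) ρ (At.capacity x j o)
      counts-capacity o with splitAt H o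
      ... | inj₁ c = counts-west c
      ... | inj₂ o′ with splitAt W o′
      ...   | inj₁ c = counts-south c
      ...   | inj₂ g = counts-tile g

      counts-position : ∀ {g m} → Counts g ρ m → ∀ o → Counts (positionᴳ g o) ρ (B * m + toℕ o)
      counts-position {g} {m} c o = subst (λ l → Counts (positionᴳ g o) ρ (l + toℕ o)) (*-comm m B)
        (counts-⊹ (counts-times c λ _ → counts-ones B) (counts-ones (toℕ o)))

      counts-price : ∀ o → Counts (priceᴳ o) ρ (2 + (T ∸ (B * j + toℕ o)))
      counts-price o = counts-⊹ (counts-ones 2) (counts-drop (counts-position (counts refl) o) (counts-poly Tᵖ v))

  position : ℕ → Fin B → ℕ
  position j o = B * j + toℕ o

  chosenNumbers unchosenNumbers : ℕ → ℕ → ℕ → Fin G → List ℕ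
  chosenNumbers T C j g = tripleNumbers T (position j (H ↑ʳ (W ↑ʳ g))) (position (suc j) (east g ↑ˡ (W + G)))
    (position (C + j) (H ↑ʳ (north g ↑ˡ G)))
  unchosenNumbers T C j g = tripleNumbers T (position j (west g ↑ˡ (W + G))) (position j (H ↑ʳ (south g ↑ˡ G)))
    (position j (H ↑ʳ (W ↑ʳ g)))

  optionNumbers : ℕ → ℕ → ℕ → Fin (G + G) → List ℕ
  optionNumbers T C j o = [ chosenNumbers T C j , unchosenNumbers T C j ]′ (splitAt G o)

  spells-option : ∀ {k} (i v : Fin k) ρ o → let n = length (lookup ρ v) in
    Spells (optionᴳ i v o) ρ (optionNumbers (⟦ Tᵖ ⟧ n) (⟦ Cᵖ ⟧ n) (length (lookup ρ i)) o)
  spells-option i v ρ o with splitAt G o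
  ... | inj₁ g = spells-triple (counts-poly Tᵖ v) (counts-position i v ρ (counts refl) _)
          (counts-position i v ρ (counts-⊹ (counts-ones 1) (counts refl)) _)
          (counts-position i v ρ (counts-⊹ (counts-poly Cᵖ v) (counts refl)) _)
  ... | inj₂ g = spells-triple (counts-poly Tᵖ v) (counts-position i v ρ (counts refl) _)
          (counts-position i v ρ (counts refl) _) (counts-position i v ρ (counts refl) _)

  -- The target is counted out in unary, capacity times price for each bin, before `num` encodes it.
  -- This takes polynomial time because the target is polynomially bounded.
  targetᴳ supplyᴳ agentsᴳ instanceᴳ : Gen 1
  targetᴳ = for (polyᴳ (Nᵖ ⊕ Cᵖ) zero) (⨁ B λ o → for (capacityᴳ zero (suc zero) o) (priceᴳ (suc zero) (suc (suc zero)) o))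
  supplyᴳ = for (polyᴳ (Nᵖ ⊕ Cᵖ) zero) (⨁ B λ o → num (capacityᴳ zero (suc zero) o))
  agentsᴳ = for (polyᴳ Nᵖ zero) (⨁ (G + G) (optionᴳ zero (suc zero)))
  instanceᴳ = lit (false ∷ []) ⊹ num targetᴳ ⊹ num (polyᴳ Tᵖ zero) ⊹ supplyᴳ ⊹
              num (for (polyᴳ Nᵖ zero) (onesᴳ (G + G))) ⊹ agentsᴳ

  module _ (g₀ : Fin G) (0<C : ∀ n → 0 < ⟦ Cᵖ ⟧ n) where

    strip-nonZero : ∀ (x : Word) → NonZero (⟦ Tᵖ ⟧ (length x))
    strip-nonZero x = fin⇒nonZero (combine j₀ (H ↑ʳ (W ↑ʳ g₀)))
      where
      j₀ : Fin (⟦ Nᵖ ⊕ Cᵖ ⟧ (length x))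
      j₀ = fromℕ< (≤-trans (0<C (length x)) (m≤n+m _ (⟦ Nᵖ ⟧ (length x))))

    stripInstance : Word → ChargeInstance
    stripInstance x = coverInstance {{strip-nonZero x}} (At.triples x (0<C (length x))) (At.supplyAt x)

    module _ (x : Word) where

      private
        n N C T : ℕ
        n = length x
        N = ⟦ Nᵖ ⟧ n
        C = ⟦ Cᵖ ⟧ n
        T = ⟦ Tᵖ ⟧ n
        open At x hiding (B; count)

      supplyAt-combine : ∀ j o → supplyAt (combine j o) ≡ capacity (toℕ j) o
      supplyAt-combine j o = cong (uncurry (capacity ∘ toℕ)) (Fin.remQuot-combine {n = N + C} j o)

      counts-target : Counts targetᴳ (x ∷ []) (worth supplyAt)
      counts-target = subst (Counts targetᴳ (x ∷ [])) (sym value)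
        (counts-for row-worth (counts-poly (Nᵖ ⊕ Cᵖ) zero) λ w → counts-⨁ _ λ o →
          counts-times (counts-capacity zero (suc zero) (w ∷ x ∷ []) o) λ b → counts-price (suc zero)
            (suc (suc zero)) (b ∷ w ∷ x ∷ []) o)
        where
        row-worth : ℕ → ℕ
        row-worth j = sum λ o → capacity j o * (2 + (T ∸ (B * j + toℕ o)))
        value : worth supplyAt ≡ sumBelow (N + C) row-worth
        value = trans (sum-combine (N + C) (λ t → price t * supplyAt t))
          (trans (sum-cong-≗ λ (j : Fin (N + C)) → sum-cong-≗ λ (o : Fin B) →
              trans (cong₂ _*_ (cong (λ l → 2 + (T ∸ l)) (Fin.toℕ-combine j o)) (supplyAt-combine j o))
                    (*-comm (2 + (T ∸ (B * toℕ j + toℕ o))) (capacity (toℕ j) o)))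
            (sum-toℕ (N + C) row-worth))

      spells-supply : Spells supplyᴳ (x ∷ []) (Vec.toList (tabulate supplyAt))
      spells-supply = subst (Spells supplyᴳ (x ∷ [])) (sym value)
        (spells-for {f = λ j → concatFin B λ o → capacity j o ∷ []} (counts-poly (Nᵖ ⊕ Cᵖ) zero) λ w → spells-⨁ λ o →
          spells-num (counts-capacity zero (suc zero) (w ∷ x ∷ []) o))
        where
        value : Vec.toList (tabulate supplyAt) ≡ concatBelow (N + C) λ j → concatFin B λ o → capacity j o ∷ []
        value = trans (toList-tabulate supplyAt) (trans (concatFin-* (N + C) (λ t → supplyAt t ∷ []))
          (trans (concatFin-cong λ (j : Fin (N + C)) → concatFin-cong λ (o : Fin B) → cong (_∷ []) (supplyAt-combine j o))
            (concatFin-toℕ (N + C) λ j → concatFin B λ o → capacity j o ∷ [])))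

      τ : Fin (N * (G + G)) → Triple T
      τ = triples (0<C n)

      option-numbers : ∀ i o → agentNumbers (agentOf (τ (combine i o))) ≡ optionNumbers T C (toℕ i) o
      option-numbers i o =
        trans (cong (agentNumbers ∘ agentOf ∘ uncurry (option (0<C n))) (Fin.remQuot-combine {n = N} i o))
        (by-kind (splitAt G o))
        where
        at : ∀ {j} (j′ : Fin (N + C)) o → toℕ j′ ≡ j → toℕ (combine j′ o) ≡ position j o
        at j′ o e = trans (Fin.toℕ-combine j′ o) (cong (λ l → B * l + toℕ o) e)
        triple≡ : ∀ {a b c a′ b′ c′} → a ≡ a′ → b ≡ b′ → c ≡ c′ → tripleNumbers T a b c ≡ tripleNumbers T a′ b′ c′
        triple≡ refl refl refl = refl
        own≡ : toℕ (own (0<C n) i) ≡ toℕ i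
        own≡ = Fin.toℕ-↑ˡ i C
        by-kind : ∀ o → agentNumbers (agentOf ([ chosen (0<C n) i , unchosen (0<C n) i ]′ o))
                      ≡ [ chosenNumbers T C (toℕ i) , unchosenNumbers T C (toℕ i) ]′ o
        by-kind (inj₁ g) = triple≡ (at (own (0<C n) i) _ own≡) (at (ahead (0<C n) i) _ (toℕ-ahead (0<C n) i))
                             (at (above (0<C n) i) _ (toℕ-above (0<C n) i))
        by-kind (inj₂ g) = triple≡ (at (own (0<C n) i) _ own≡) (at (own (0<C n) i) _ own≡) (at (own (0<C n) i) _ own≡)

      spells-agents : Spells agentsᴳ (x ∷ []) (concatMap agentNumbers (Vec.toList (tabulate (agentOf ∘ τ))))
      spells-agents = subst (Spells agentsᴳ (x ∷ [])) (sym value)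
        (spells-for {f = λ j → concatFin (G + G) (optionNumbers T C j)} (counts-poly Nᵖ zero) λ w → spells-⨁ λ o →
          spells-option zero (suc zero) (w ∷ x ∷ []) o)
        where
        value : concatMap agentNumbers (Vec.toList (tabulate (agentOf ∘ τ))) ≡ concatBelow N λ j →
          concatFin (G + G) (optionNumbers T C j)
        value = trans (concatMap-tabulate agentNumbers (agentOf ∘ τ)) (trans (concatFin-* N (agentNumbers ∘ agentOf ∘ τ))
          (trans (concatFin-cong λ (i : Fin N) → concatFin-cong λ (o : Fin (G + G)) → option-numbers i o)
            (concatFin-toℕ N λ j → concatFin (G + G) (optionNumbers T C j))))

      instance-spelled : ⟦ instanceᴳ ⟧ᴳ (x ∷ []) ≡ encodeCharge (stripInstance x)
      instance-spelled = cong (false ∷_) (Spells.spelled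
        (spells-⊹ (spells-num counts-target) (spells-⊹ (spells-num (counts-poly Tᵖ zero)) (spells-⊹ spells-supply
          (spells-⊹ (spells-num (counts-times (counts-poly Nᵖ zero) λ _ → counts-ones (G + G))) spells-agents)))))

    stripInstance-polyTime : PolyTime (encodeCharge ∘ stripInstance)
    stripInstance-polyTime =
      let M , p , run = gen-polyTime instanceᴳ
      in M , p , λ x → subst (Computes M x [] (⟦ p ⟧ (length x))) (instance-spelled x) (run x)

δ≤1 : ∀ {n} (i j : Fin n) → δ i j ≤ 1
δ≤1 zero    zero    = ≤-refl
δ≤1 zero    (suc _) = z≤n
δ≤1 (suc _) zero    = z≤n
δ≤1 (suc i) (suc j) = δ≤1 i j

module _ (𝒯 : Tiles) (N C : ℕ) (bottom : ℕ → Fin (Tiles.W 𝒯)) (g₀ : Fin (Tiles.G 𝒯)) (0<N : 0 < N) where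

  open Tiles 𝒯
  open Strip 𝒯 N C bottom

  private
    bound : ℕ
    bound = N * (G + G)

    G≤ : G ≤ bound
    G≤ = ≤-trans (m≤m+n G G) (≤-trans (≤-reflexive (sym (*-identityˡ (G + G)))) (*-monoˡ-≤ (G + G) 0<N))

    1≤ : 1 ≤ bound
    1≤ = ≤-trans (≤-trans (s≤s z≤n) (Fin.toℕ<n g₀)) G≤

    count≤ : ∀ {n} (f : Fin G → Fin n) c → count f c ≤ bound
    count≤ f c = ≤-trans (sum-≤ λ g → δ≤1 (f g) c) (≤-trans (≤-reflexive (*-identityʳ G)) G≤)

    if-≤ : ∀ b {m n} → m ≤ bound → n ≤ bound → (if b then m else n) ≤ bound
    if-≤ true  m≤ n≤ = m≤
    if-≤ false m≤ n≤ = n≤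

    δ≤ : ∀ {n} (c d : Fin n) → δ c d ≤ bound
    δ≤ c d = ≤-trans (δ≤1 c d) 1≤

    west≤ : ∀ j c → westCap j c ≤ bound
    west≤ zero    c = ≤-trans (m∸n≤m (count west c) (δ edge c)) (count≤ west c)
    west≤ (suc j) c = if-≤ (suc j <ᵇ N) (count≤ west c) (if-≤ (j <ᵇ N) (δ≤ edge c) z≤n)

    south≤ : ∀ j c → southCap j c ≤ bound
    south≤ j c = if-≤ (j <ᵇ C) (≤-trans (m∸n≤m (count south c) (δ (bottom j) c)) (count≤ south c))
      (if-≤ (j <ᵇ N) (count≤ south c) (δ≤ top c))

  -- No capacity exceeds `G`, and already a single cell has `G + G` agents. `cover-numbers` asks for
  -- supplies bounded by the number of agents.
  capacity≤ : ∀ j o → capacity j o ≤ bound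
  capacity≤ j o with splitAt H o
  ... | inj₁ c = west≤ j c
  ... | inj₂ o′ with splitAt W o′
  ...   | inj₁ c = south≤ j c
  ...   | inj₂ g = if-≤ (j <ᵇ N) 1≤ z≤n

  supplyAt≤ : ∀ t → supplyAt t ≤ bound
  supplyAt≤ t = capacity≤ (toℕ (proj₁ (remQuot {N + C} B t))) (proj₂ (remQuot {N + C} B t))

Restricted : ChargeInstance → Set
Restricted I = (PeriodsBoundedBy X I × DeadlinesPerAgent 3 I × DemandsBoundedBy 3 I) ×
  All (_≤ ⟦ numberBound ⟧ (length (encodeCharge I))) (chargeNumbers I)

module StripReduction (𝒯 : Tiles) (β : Bool → Maybe Bool → Bool → Fin (Tiles.W 𝒯)) (Nᵖ Cᵖ Pᵖ : Polynomial)
  (edge-tile : ∃ λ g → Tiles.west 𝒯 g ≡ Tiles.edge 𝒯)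
  (β-tile : ∀ first x allowed → ∃ λ g → Tiles.south 𝒯 g ≡ β first x allowed)
  (0<C : ∀ n → 0 < ⟦ Cᵖ ⟧ n) (C≤N : ∀ n → ⟦ Cᵖ ⟧ n ≤ ⟦ Nᵖ ⟧ n) where

  open StripGen 𝒯 β Nᵖ Cᵖ Pᵖ using (stripInstance; stripInstance-polyTime; strip-nonZero; bottom; module At)

  strip : Word → ChargeInstance
  strip = stripInstance (proj₁ edge-tile) 0<C

  strip-polyTime : PolyTime (encodeCharge ∘ strip)
  strip-polyTime = stripInstance-polyTime (proj₁ edge-tile) 0<C

  module _ (x : Word) where

    private
      n : ℕ
      n = length x

      instance
        nonZero : NonZero ((⟦ Nᵖ ⟧ n + ⟦ Cᵖ ⟧ n) * At.B x)
        nonZero = strip-nonZero (proj₁ edge-tile) 0<C x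

    open At x using (Tiling; triples; supplyAt)

    strip-restricted : Restricted (strip x)
    strip-restricted =
      (cover-periods (triples (0<C n)) supplyAt , cover-deadlines (triples (0<C n)) supplyAt ,
       cover-demands (triples (0<C n)) supplyAt) ,
      cover-numbers (triples (0<C n)) supplyAt
        (supplyAt≤ 𝒯 (⟦ Nᵖ ⟧ n) (⟦ Cᵖ ⟧ n) (bottom x) (proj₁ edge-tile) (≤-trans (0<C n) (C≤N n)))

    open StripCover 𝒯 (⟦ Nᵖ ⟧ n) (⟦ Cᵖ ⟧ n) (bottom x) (0<C n) (C≤N n) using (tiling⇒cover; cover⇒tiling)

    tiling⇒achievable : Tiling → Achievable (strip x)
    tiling⇒achievable t = cover⇒achievable (triples (0<C n)) supplyAt (tiling⇒cover t)

    achievable⇒tiling : Achievable (strip x) → Tiling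
    achievable⇒tiling achievable = cover⇒tiling edge-tile (λ j _ → β-tile _ _ _)
      (achievable⇒cover (triples (0<C n)) supplyAt achievable)

-- The reduction

module Reduction (M : Machine) (timeᵖ lengthᵖ : Polynomial) where

  open Rows M using (startRow; rows; accepts; accepts-computes)
  open MachineTiles M
  open Finite

  -- `kᵖ` allows one step for putting the heads on the inputs, and then the time of the verifier on
  -- certificates of full length. The width `Cᵖ` leaves room for input and certificate to spread
  -- during all these steps.
  kᵖ C′ᵖ Cᵖ Nᵖ : Polynomial
  kᵖ  = con 1 ⊕ (timeᵖ ∘ₚ (X ⊕ lengthᵖ))
  C′ᵖ = (X ⊕ lengthᵖ) ⊕ kᵖ
  Cᵖ  = con 1 ⊕ C′ᵖ
  Nᵖ  = (con 2 ⊕ kᵖ) ⊗ Cᵖ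

  inputColour : Bool → Maybe Bool → Bool → Fin (size finite-VColour)
  inputColour first x allowed = enc finite-VColour (input first x allowed)

  -- A witness that each bottom colour occurs on a tile, as the withheld places require; the guess
  -- and the end of the row are arbitrary.
  inputTile : Bool → Maybe Bool → Bool → Tile
  inputTile first x allowed = guess (if first then nothing else just true) x allowed nothing false

  edge-tile : ∃ λ g → Tiles.west tiles g ≡ Tiles.edge tiles
  edge-tile = enc finite-Tile (inputTile true nothing false) , cong (enc finite-HColour ∘ westOf) (dec-enc finite-Tile _)

  input-tile : ∀ first x allowed → ∃ λ g → Tiles.south tiles g ≡ inputColour first x allowed
  input-tile first x allowed = enc finite-Tile (inputTile first x allowed) ,
    trans (cong (enc finite-VColour ∘ southOf) (dec-enc finite-Tile _))
      (cong (λ f → inputColour f x allowed) (is-first first))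
    where
    is-first : ∀ b → is-nothing (if b then nothing else just true) ≡ b
    is-first true  = refl
    is-first false = refl

  open StripReduction tiles inputColour Nᵖ Cᵖ lengthᵖ edge-tile input-tile (λ _ → z<s) (λ n → m≤m+n (⟦ Cᵖ ⟧ n) _) public
    renaming (strip to reduce; strip-polyTime to reduce-polyTime; strip-restricted to reduce-restricted)

  module _ (x : Word) where

    private
      n P k C′ : ℕ
      n  = length x
      P  = ⟦ lengthᵖ ⟧ n
      k  = ⟦ kᵖ ⟧ n
      C′ = ⟦ C′ᵖ ⟧ n

      open Tableau M x P k C′ using (C; accepting-tiling)
      open TableauSound M x P k C′ using (certificate; certificate≤; tiling-accepts)

      x≤ : n + k ≤ C
      x≤ = ≤-trans (+-monoˡ-≤ k (m≤m+n n P)) (n≤1+n _)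

      P≤ : P + k ≤ C
      P≤ = ≤-trans (+-monoˡ-≤ k (m≤n+m P n)) (n≤1+n _)

    module _ (V : Word → Word → Bool)
             (computes : ∀ y → Computes M x y (⟦ timeᵖ ⟧ (n + length y)) (V x y ∷ [])) where

      -- All certificates are judged after the same number `k` of steps, which suffices for the
      -- longest ones.
      verdict : ∀ y → length y ≤ P → accepts (Rows.Row.info (rows (startRow x y) k)) ≡ V x y
      verdict y y≤P =
        let d , h , out = computes y
        in accepts-computes (d , HaltsWithin-weaken time≤ h , out)
        where
        time≤ : ⟦ timeᵖ ⟧ (n + length y) ≤ ⟦ timeᵖ ∘ₚ (X ⊕ lengthᵖ) ⟧ n
        time≤ = ≤-trans (⟦⟧-mono timeᵖ (+-monoʳ-≤ n y≤P)) (≤-reflexive (sym (⟦∘ₚ⟧ timeᵖ (X ⊕ lengthᵖ) n)))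

      certificate⇒achievable : (∃[ y ] length y ≤ P × V x y ≡ true) → Achievable (reduce x)
      certificate⇒achievable (y , y≤P , Vxy) =
        tiling⇒achievable x (accepting-tiling x≤ P≤ y y≤P (trans (verdict y y≤P) Vxy))

      achievable⇒certificate : Achievable (reduce x) → ∃[ y ] length y ≤ P × V x y ≡ true
      achievable⇒certificate achievable =
        let tiling = achievable⇒tiling x achievable
            y≤P    = certificate≤ x≤ P≤ tiling
        in certificate x≤ P≤ tiling , y≤P , trans (sym (verdict _ y≤P)) (tiling-accepts x≤ P≤ tiling)

theorem4 : Σ[ D ∈ ℕ ] Σ[ p ∈ Polynomial ]
    StronglyNPHardOn ChargeScheduling
    (λ I → PeriodsBoundedBy p I × DeadlinesPerAgent 3 I × DemandsBoundedBy D I)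
-- None of the bounds depends on `L`. `X` bounds the number of periods because each period has a
-- supply in the encoding.
theorem4 = 3 , X , numberBound , λ where
  L (V , (M , timeᵖ , computes) , lengthᵖ , L⇔) →
    let open Reduction M timeᵖ lengthᵖ
    in reduce , reduce-polyTime , reduce-restricted , λ x → mk⇔
      (certificate⇒achievable x V (computes x) ∘ Equivalence.to (L⇔ x))
      (Equivalence.from (L⇔ x) ∘ achievable⇒certificate x V (computes x))
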